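{- Let $K$ be a perfect field and let $f$ be an irreducible polynomial of degree $n>2$ over $K$ with Galois group $G=\mathrm{Gal}(K_f/K)$, where $K_f$ is the splitting field of $f$. Let $k$ be a positive integer with $k<n$. Then $G$ is sharply $k$-transitive (on the roots of $f$) if and only if both of the following hold: (1) Every minimal generating set for $f$ over $K$ has cardinality $k$, and every subset of the set of roots of $f$ of cardinality $k$ is a minimal generating set for $f$ over $K$. Thus there are exactly $\binom{n}{k}$ many distinct minimal generating sets. (2) The length of any cluster tower of $f$ is $k$, and its degree sequence is $({}^nP_1,{}^nP_2,\dots,{}^nP_k)$. Thus there are exactly ${}^nP_{k-1}$ many distinct cluster towers.
   Context: Fix an algebraic closure $\bar K$ of $K$; $R\subset\bar K$ is the set of roots of $f$, and $K(B)$ is the field generated over $K$ by $B$. Here ${}^nP_j=n(n-1)\cdots(n-j+1)$, with ${}^nP_0=1$. Sharp $k$-transitivity: $G$ is sharply $k$-transitive if for any two ordered $k$-tuples of distinct roots $(\alpha_1,\dots,\alpha_k)$ and $(\beta_1,\dots,\beta_k)$ of $f$ there is a unique $\sigma\in G$ with $\sigma(\alpha_i)=\beta_i$ for all $1\le i\le k$. Minimal generating set: $B\subset R$ is a minimal generating set for $f$ over $K$ if $K(B)=K_f$ and $K(A)\neq K_f$ for every $A\subsetneq B$. Clusters: roots $\alpha,\beta\in R$ are equivalent if $K(\alpha)=K(\beta)$ (equality of subfields of $\bar K$); the equivalence classes are the root clusters of $f$, and $s_K(f)$ is their number. Cluster towers: for an ordering $(\beta_1,\dots,\beta_s)$, $s=s_K(f)$,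 of a complete set of representatives of the clusters, the chain $K\subseteq K(\beta_1)\subseteq K(\beta_1,\beta_2)\subseteq\dots\subseteq K(\beta_1,\dots,\beta_s)=K_f$ is a cluster tower of $f$. Its length is the number of strict inclusions. Its degree sequence is $([L_1:K],[L_2:K],\dots,[K_f:K])$, where $K\subsetneq L_1\subsetneq L_2\subsetneq\dots\subsetneq K_f$ are the distinct fields in the tower. Two cluster towers are equal if their fields are equal at each step, and distinct otherwise. -}

module Defs where

open import Algebra.Apartness.Bundles using (HeytingField; HeytingCommutativeRing)
open import Algebra.Bundles using (CommutativeRing)
open import Algebra.Bundles.Raw using (RawRing; RawSemiring)
import Algebra.Definitions.RawMonoid as RawMonoidDefs
import Algebra.Definitions.RawSemiring as RawSemiringDefs
open import Algebra.Morphism.Structures using (IsRingHomomorphism; IsRingIsomorphism)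
open import Data.Fin.Base using (Fin; toℕ)
open import Data.List.Base using (List; []; _∷_; _∷ʳ_; map; foldr; applyUpTo)
open import Data.Nat.Base as ℕ using (ℕ; zero; suc)
open import Data.Nat.Combinatorics using (_P_)
open import Data.Product using (Σ; ∃; ∃-syntax; ∃₂; ∃!; _×_; _,_; proj₁; proj₂)
open import Function.Base using (_on_)
open import Function.Bundles using (Bijection; Injection)
open import Level using (Level; 0ℓ; _⊔_) renaming (suc to lsuc)
open import Relation.Binary.Bundles using (Setoid)
import Relation.Binary.Construct.On as On
open import Relation.Binary.Definitions using (_Respects_)
import Relation.Binary.PropositionalEquality as ≡
open import Relation.Nullary.Negation using (¬_)
open import Relation.Unary using (Pred; _∈_; _⊆_; _⊂_; _≐_)
open import Relation.Unary.Properties using (≐-refl; ≐-sym; ≐-trans)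
open import Relation.Unary.Relation.Binary.Equality using (≐-setoid)

HasCardinality : ∀ {a ℓ} → Setoid a ℓ → ℕ → Set (a ⊔ ℓ)
HasCardinality S m = Bijection (≡.setoid (Fin m)) S

-- A polynomial is its list of coefficients, constant term first. Trailing
-- zeros are allowed; _≈ₚ_ identifies lists with the same coefficients.
module Polynomial {a ℓ} (R : RawRing a ℓ) where
  open RawRing R

  Poly : Set a
  Poly = List Carrier

  coeff : Poly → ℕ → Carrier
  coeff []      _       = 0#
  coeff (x ∷ _) zero    = x
  coeff (_ ∷ p) (suc i) = coeff p i

  infix  4 _≈ₚ_
  infixl 6 _+ₚ_
  infixl 7 _*ₚ_

  _≈ₚ_ : Poly → Poly → Set ℓ
  p ≈ₚ q = ∀ i → coeff p i ≈ coeff q i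

  0ₚ 1ₚ : Poly
  0ₚ = []
  1ₚ = 1# ∷ []

  _+ₚ_ : Poly → Poly → Poly
  []      +ₚ q       = q
  (x ∷ p) +ₚ []      = x ∷ p
  (x ∷ p) +ₚ (y ∷ q) = (x + y) ∷ (p +ₚ q)

  _*ₚ_ : Poly → Poly → Poly
  []      *ₚ q = []
  (x ∷ p) *ₚ q = map (x *_) q +ₚ (0# ∷ (p *ₚ q))

  polyRawSemiring : RawSemiring a ℓ
  polyRawSemiring = record
    { Carrier = Poly ; _≈_ = _≈ₚ_ ; _+_ = _+ₚ_ ; _*_ = _*ₚ_ ; 0# = 0ₚ ; 1# = 1ₚ }

  open RawSemiringDefs polyRawSemiring public using (Irreducible)

  HasDegree : Poly → ℕ → Set ℓ
  HasDegree p d = ¬ (coeff p d ≈ 0#) × (∀ i → d ℕ.< i → coeff p i ≈ 0#)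

  eval : Poly → Carrier → Carrier
  eval p x = foldr (λ a v → a + x * v) 0# p

  -- (a + X p)′ = p + X p′
  derivative : Poly → Poly
  derivative []      = []
  derivative (_ ∷ p) = p +ₚ (0# ∷ derivative p)

  Separable : Poly → Set (a ⊔ ℓ)
  Separable p = ∃₂ λ u v → u *ₚ p +ₚ v *ₚ derivative p ≈ₚ 1ₚ

-- Under excluded middle a Heyting field is the same thing as a field: tightness
-- makes x # y equivalent to ¬ (x ≈ y), so the nonzero elements are exactly the
-- invertible ones; 1# # 0# (as 1# is invertible) and irreflexivity give ¬ (1# ≈ 0#).
fieldRawRing : ∀ {c ℓ₁ ℓ₂} → HeytingField c ℓ₁ ℓ₂ → RawRing c ℓ₁
fieldRawRing F = CommutativeRing.rawRing
  (HeytingCommutativeRing.commutativeRing (HeytingField.heytingCommutativeRing F))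

module _ {c ℓ₁ ℓ₂} (K : HeytingField c ℓ₁ ℓ₂) where
  private
    module K  = HeytingField K
    module KX = Polynomial (fieldRawRing K)

  Perfect : Set (c ⊔ ℓ₁)
  Perfect = ∀ p → KX.Irreducible p → KX.Separable p

  record AlgebraicClosure (c′ ℓ₁′ ℓ₂′ : Level)
         : Set (c ⊔ ℓ₁ ⊔ lsuc (c′ ⊔ ℓ₁′ ⊔ ℓ₂′)) where
    field
      closure : HeytingField c′ ℓ₁′ ℓ₂′

    open HeytingField closure public hiding (zero)
    module Closureₚ = Polynomial (fieldRawRing closure)

    field
      ι     : K.Carrier → Carrier
      ι-hom : IsRingHomomorphism (fieldRawRing K) (fieldRawRing closure) ι

    evalAt : KX.Poly → Carrier → Carrier
    evalAt p = Closureₚ.eval (map ι p)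

    field
      algebraic : ∀ x → ∃[ p ] ¬ (p KX.≈ₚ KX.0ₚ) × evalAt p x ≈ 0#
      closed    : ∀ p d → Closureₚ.HasDegree p (suc d) →
                  ∃[ x ] Closureₚ.eval p x ≈ 0#

module Extensions {c ℓ₁ ℓ₂ c′ ℓ₁′ ℓ₂′} {K : HeytingField c ℓ₁ ℓ₂}
                  (K̄ : AlgebraicClosure K c′ ℓ₁′ ℓ₂′) where
  private module K = HeytingField K
  open AlgebraicClosure K̄
  open RawMonoidDefs (RawRing.+-rawMonoid (fieldRawRing closure)) using (sum)

  -- The subfield K(B) of the closure.
  data Adjoin {ℓ} (B : Pred Carrier ℓ) : Pred Carrier (c ⊔ c′ ⊔ ℓ₁′ ⊔ ℓ) where
    base : ∀ a → Adjoin B (ι a)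
    gen  : ∀ {x} → x ∈ B → Adjoin B x
    add  : ∀ {x y} → Adjoin B x → Adjoin B y → Adjoin B (x + y)
    mul  : ∀ {x y} → Adjoin B x → Adjoin B y → Adjoin B (x * y)
    neg  : ∀ {x} → Adjoin B x → Adjoin B (- x)
    inv  : ∀ {x y} → Adjoin B x → x * y ≈ 1# → Adjoin B y
    resp : ∀ {x y} → x ≈ y → Adjoin B x → Adjoin B y

  adjoinRawRing : ∀ {ℓ} → Pred Carrier ℓ → RawRing (c ⊔ c′ ⊔ ℓ₁′ ⊔ ℓ) ℓ₁′
  adjoinRawRing B = record
    { Carrier = ∃ (Adjoin B)
    ; _≈_     = _≈_ on proj₁
    ; _+_     = λ (x , p) (y , q) → x + y , add p q
    ; _*_     = λ (x , p) (y , q) → x * y , mul p q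
    ; -_      = λ (x , p) → - x , neg p
    ; 0#      = 0# , resp ι0≈0 (base K.0#)
    ; 1#      = 1# , resp ι1≈1 (base K.1#)
    }
    where open IsRingHomomorphism ι-hom renaming (0#-homo to ι0≈0; 1#-homo to ι1≈1)

  -- Gal (K(B) / K)
  record Automorphism {ℓ} (B : Pred Carrier ℓ) : Set (c ⊔ c′ ⊔ ℓ₁′ ⊔ ℓ) where
    field
      to            : ∃ (Adjoin B) → ∃ (Adjoin B)
      isIsomorphism : IsRingIsomorphism (adjoinRawRing B) (adjoinRawRing B) to
      fixesBase     : ∀ a → proj₁ (to (ι a , base a)) ≈ ι a

  _≈ᴳ_ : ∀ {ℓ} {B : Pred Carrier ℓ} (σ τ : Automorphism B) → Set (c ⊔ c′ ⊔ ℓ₁′ ⊔ ℓ)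
  σ ≈ᴳ τ = ∀ x → proj₁ (Automorphism.to σ x) ≈ proj₁ (Automorphism.to τ x)

  linearCombination : ∀ {d} → (Fin d → K.Carrier) → (Fin d → Carrier) → Carrier
  linearCombination a b = sum (λ i → ι (a i) * b i)

  record IsBasis {ℓ} (L : Pred Carrier ℓ) {d} (b : Fin d → Carrier)
         : Set (c ⊔ ℓ₁ ⊔ c′ ⊔ ℓ₁′ ⊔ ℓ) where
    field
      member      : ∀ i → b i ∈ L
      independent : ∀ a → linearCombination a b ≈ 0# → ∀ i → a i K.≈ K.0#
      spanning    : ∀ {x} → x ∈ L → ∃[ a ] x ≈ linearCombination a b

  -- [ L : K ] = d
  HasDegreeOverBase : ∀ {ℓ} → Pred Carrier ℓ → ℕ → Set (c ⊔ ℓ₁ ⊔ c′ ⊔ ℓ₁′ ⊔ ℓ)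
  HasDegreeOverBase L d = ∃[ b ] IsBasis L {d} b

  -- DegreeSequence F s ds: ds lists, in order, the degrees over K of those
  -- F (suc j) with j < s that strictly contain F j.
  data DegreeSequence {ℓ} (F : ℕ → Pred Carrier ℓ)
       : ℕ → List ℕ → Set (c ⊔ ℓ₁ ⊔ c′ ⊔ ℓ₁′ ⊔ ℓ) where
    done : DegreeSequence F zero []
    stay : ∀ {s ds} → DegreeSequence F s ds → F s ≐ F (suc s) →
           DegreeSequence F (suc s) ds
    grow : ∀ {s ds d} → DegreeSequence F s ds → F s ⊂ F (suc s) →
           HasDegreeOverBase (F (suc s)) d → DegreeSequence F (suc s) (ds ∷ʳ d)

module Roots {c ℓ₁ ℓ₂ c′ ℓ₁′ ℓ₂′} {K : HeytingField c ℓ₁ ℓ₂}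
             (K̄ : AlgebraicClosure K c′ ℓ₁′ ℓ₂′)
             (f : Polynomial.Poly (fieldRawRing K)) where
  open AlgebraicClosure K̄
  open Extensions K̄

  IsRoot : Pred Carrier ℓ₁′
  IsRoot x = evalAt f x ≈ 0#

  Root : Set (c′ ⊔ ℓ₁′)
  Root = ∃ IsRoot

  rootSetoid : Setoid (c′ ⊔ ℓ₁′) ℓ₁′
  rootSetoid = On.setoid setoid (proj₁ {B = IsRoot})

  SplittingField : Pred Carrier (c ⊔ c′ ⊔ ℓ₁′)
  SplittingField = Adjoin IsRoot

  Galois : Set (c ⊔ c′ ⊔ ℓ₁′)
  Galois = Automorphism IsRoot

  _maps_to_ : Galois → Root → Root → Set ℓ₁′
  σ maps (α , αRoot) to (β , _) = proj₁ (Automorphism.to σ (α , gen αRoot)) ≈ β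

  DistinctRoots : ℕ → Set (c′ ⊔ ℓ₁′)
  DistinctRoots k = Injection (≡.setoid (Fin k)) rootSetoid

  SharplyTransitive : ℕ → Set (c ⊔ c′ ⊔ ℓ₁′)
  SharplyTransitive k = ∀ (α β : DistinctRoots k) →
    ∃! _≈ᴳ_ λ σ → ∀ i → σ maps Injection.to α i to Injection.to β i

  -- Respecting ≈ makes these subsets of the set of roots modulo ≈. The level
  -- ℓ₁′ is no restriction: under excluded middle a predicate at any level has an
  -- equivalent one at this level.
  record RootSubset : Set (c′ ⊔ lsuc ℓ₁′) where
    field
      Mem      : Pred Carrier ℓ₁′
      respects : Mem Respects _≈_
      isRoot   : Mem ⊆ IsRoot

  open RootSubset public

  elements : RootSubset → Setoid (c′ ⊔ ℓ₁′) ℓ₁′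
  elements B = On.setoid setoid (proj₁ {B = Mem B})

  record IsMinimalGenerating (B : RootSubset) : Set (c ⊔ c′ ⊔ lsuc ℓ₁′) where
    field
      generates : Adjoin (Mem B) ≐ SplittingField
      minimal   : ∀ (A : RootSubset) → Mem A ⊂ Mem B →
                  ¬ (Adjoin (Mem A) ≐ SplittingField)

  minimalGeneratingSets : Setoid (c ⊔ c′ ⊔ lsuc ℓ₁′) (c′ ⊔ ℓ₁′)
  minimalGeneratingSets =
    On.setoid {B = Σ RootSubset IsMinimalGenerating} (≐-setoid Carrier ℓ₁′)
      (λ (B , _) → Mem B)

  -- Its cardinality is the number of root clusters.
  clusters : Setoid (c′ ⊔ ℓ₁′) (c ⊔ c′ ⊔ ℓ₁′)
  clusters = On.setoid {B = Root} (≐-setoid Carrier (c ⊔ c′ ⊔ ℓ₁′))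
    (λ (α , _) → Adjoin (α ≈_))

  -- An ordering of a complete set of representatives of the clusters amounts to
  -- a bijection onto the roots up to cluster equivalence; s is then the number
  -- of clusters.
  record ClusterTower : Set (c ⊔ c′ ⊔ ℓ₁′) where
    field
      s        : ℕ
      ordering : Bijection (≡.setoid (Fin s)) clusters

    rep : Fin s → Carrier
    rep i = proj₁ (Bijection.to ordering i)

    -- step j is K(β₁,…,βⱼ); in particular step 0 is K, and the sequence is
    -- constant from j = s on.
    step : ℕ → Pred Carrier (c ⊔ c′ ⊔ ℓ₁′)
    step j = Adjoin (λ x → ∃[ i ] toℕ i ℕ.< j × rep i ≈ x)

    strictInclusions : Setoid (c ⊔ c′ ⊔ ℓ₁′) 0ℓ
    strictInclusions = On.setoid (≡.setoid (Fin s))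
      (proj₁ {B = λ i → step (toℕ i) ⊂ step (suc (toℕ i))})

  open ClusterTower

  HasLength : ClusterTower → ℕ → Set (c ⊔ c′ ⊔ ℓ₁′)
  HasLength T = HasCardinality (strictInclusions T)

  HasDegreeSequence : ClusterTower → List ℕ → Set (c ⊔ ℓ₁ ⊔ c′ ⊔ ℓ₁′)
  HasDegreeSequence T = DegreeSequence (step T) (s T)

  clusterTowers : Setoid (c ⊔ c′ ⊔ ℓ₁′) (c ⊔ c′ ⊔ ℓ₁′)
  clusterTowers = record
    { Carrier       = ClusterTower
    ; _≈_           = λ T U → ∀ j → step T j ≐ step U j
    ; isEquivalence = record
      { refl  = λ _ → ≐-refl
      ; sym   = λ e j → ≐-sym (e j)
      ; trans = λ e e′ j → ≐-trans (e j) (e′ j)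
      }
    }

  MinimalGeneratingSetsAreKSubsets : ℕ → Set (c ⊔ c′ ⊔ lsuc ℓ₁′)
  MinimalGeneratingSetsAreKSubsets k =
    (∀ B → IsMinimalGenerating B → HasCardinality (elements B) k) ×
    (∀ B → HasCardinality (elements B) k → IsMinimalGenerating B)

  ClusterTowersAreFalling : ℕ → ℕ → Set (c ⊔ ℓ₁ ⊔ c′ ⊔ ℓ₁′)
  ClusterTowersAreFalling n k = ∀ T →
    HasLength T k × HasDegreeSequence T (applyUpTo (λ i → n P suc i) k)

{-# OPTIONS --safe #-}
module Submission where

open import Defs
open import Algebra.Apartness.Bundles using (HeytingCommutativeRing; HeytingField)
open import Algebra.Bundles using (AbelianGroup; CommutativeRing; RawRing)
import Algebra.Construct.DirectProduct as DirectProduct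
open import Algebra.Morphism.Structures using (IsRingHomomorphism; module RingMorphisms)
import Algebra.Properties.Ring as RingProperties
import Algebra.Properties.Semiring.Sum as SemiringSum
open import Axiom.ExcludedMiddle using (ExcludedMiddle)
open import Data.Bool.Base using (true)
open import Data.Empty using (⊥; ⊥-elim)
open import Data.Fin.Base using (Fin; _↑ʳ_; _↑ˡ_; fromℕ; fromℕ<; inject₁; inject≤; punchIn; punchOut; splitAt; suc; toℕ; zero)
import Data.Fin.Properties as Finₚ
open import Data.List.Base using (List; []; _∷_; _∷ʳ_; applyUpTo; map)
import Data.List.Properties as Listₚ
open import Data.Nat.Base as ℕ using (ℕ; zero; suc)
open import Data.Nat.Base using (_<_; _∸_; _≤_; _≤ᵇ_)
open import Data.Nat.Combinatorics using (nCk+nC[k+1]≡[n+1]C[k+1])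
open import Data.Nat.Combinatorics.Base using (_P′_)
open import Data.Nat.Combinatorics.Specification using (k>n⇒nPk≡0; nP′k≡n[n∸1P′k∸1])
import Data.Nat.Properties as ℕₚ
open import Data.Product using (_,_; _×_; proj₁; proj₂; Σ-syntax; ∃-syntax)
open import Data.Product.Function.NonDependent.Propositional using (_×-↔_)
open import Data.Sum.Base using ([_,_]′; _⊎_; inj₁; inj₂)
open import Data.Sum.Function.Propositional using (_⊎-↔_)
open import Data.Unit.Base using (tt; ⊤)
open import Data.Vec.Functional using (insertAt)
import Data.Vec.Functional.Properties as Vecₚ
open import Function.Base using (_∘_)
open import Function.Bundles using (Bijection; Injection; Inverse; _↔_; _⇔_; mk↔ₛ′; mk⇔)
open import Function.Construct.Composition using (_↔-∘_)
open import Function.Construct.Identity using (↔-id)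
open import Level using (Level; _⊔_)
open import Relation.Binary.Bundles using (Setoid)
open import Relation.Binary.Definitions using (tri<; tri>; tri≈)
import Relation.Binary.PropositionalEquality as ≡
open ≡ using (_≡_; _≗_)
import Relation.Binary.Reasoning.Setoid as SetoidReasoning
open import Relation.Nullary.Decidable.Core using (Dec; no; yes)
open import Relation.Nullary.Negation using (contradiction; ¬_)
open import Relation.Unary using (Pred; _≐_; _⊂_; _⊆_)
open import Relation.Unary.Properties using (≐-refl; ≐-sym; ≐-trans)

-- Call f generic up to k if, for all distinct roots β₁, …, β_{j+1} with j < k, the root β_{j+1} has
-- degree n - j over K(β₁, …, β_j), that is, if f / ∏ (X - βᵢ) is its minimal polynomial there. Sharp
-- k-transitivity, as well as condition (2), is equivalent to: f is generic up to k, and any k distinct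
-- roots generate K_f.
-- If G is sharply k-transitive, the minimal polynomial of β_{j+1} over K(β₁, …, β_j) vanishes at all
-- n - j remaining roots by transitivity, and a root outside K(β₁, …, β_k) would have a conjugate over that
-- field (f is separable), so a nontrivial automorphism would fix β₁, …, β_k. Conversely, genericity lets
-- one extend βᵢ ↦ γᵢ one root at a time, and any isomorphism between intermediate fields extends to K_f.
-- Given (2), any tuple starts a cluster tower; by induction its first j fields have the degrees nP1, …,
-- nPj, so the next root that enlarges the field has degree n - j, and all remaining roots are its
-- conjugates. Condition (1) and the two counts follow from genericity, since n - j ≥ 2 for j < k.

-- The polynomial arguments are made over an arbitrary commutative ring R because they serve for
-- three of them. For R = K̄ they give spans, roots and degrees. For R = K̄ × K̄ an isomorphism
-- between intermediate fields is a subring, its graph, and a pair of roots is a single element; so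
-- adjoining a root to a field and extending an isomorphism to it are one construction, `Span`. For
-- R = K̄[ε] evaluation at α + ε yields derivatives, and α is a double root when α + ε is a root.
-- Division occurs only by linear factors and modulo monic polynomials. The minimal polynomial of x
-- over L is captured by the pair `Dependent L x d` and `Independent L x d`, without irreducibility
-- or gcds. Intermediate fields are built by ring operations alone, since every intermediate ring of
-- an algebraic extension is a field. The obstacle in coming back from (2) is that a cluster tower
-- orders clusters, not roots: a tuple can start a tower only if its roots lie in different
-- clusters. Genericity and towers are therefore built up together, one root at a time.

module RingSolver {r ℓr} (R : CommutativeRing r ℓr) where
  open import Algebra.Solver.Ring.NaturalCoefficients.Default (CommutativeRing.commutativeSemiring R) public
    using (solve; _:=_; _:+_; _:*_; con)

-- Polynomials over a commutative ring: synthetic division and simple ring extensions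

module RingPolynomials {r ℓr} (R : CommutativeRing r ℓr) where
  open CommutativeRing R hiding (zero)

  private variable
    d e : ℕ

  -- c₀ + c₁ x + … + c_{d-1} x^{d-1} + t x^d
  evalF : (Fin d → Carrier) → Carrier → Carrier → Carrier
  evalF {zero}  c t x = t
  evalF {suc d} c t x = c zero + x * evalF (c ∘ suc) t x

  evalF-cong : {c c′ : Fin d → Carrier} {t t′ x x′ : Carrier} →
    (∀ i → c i ≈ c′ i) → t ≈ t′ → x ≈ x′ → evalF c t x ≈ evalF c′ t′ x′
  evalF-cong {zero}  ec et ex = et
  evalF-cong {suc d} ec et ex = +-cong (ec zero) (*-cong ex (evalF-cong (ec ∘ suc) et ex))

  evalF-congᵗ : (c : Fin d → Carrier) (x : Carrier) {t t′ : Carrier} →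
    t ≈ t′ → evalF c t x ≈ evalF c t′ x
  evalF-congᵗ c x et = evalF-cong {c = c} (λ _ → refl) et refl

  evalF-congˣ : (c : Fin d → Carrier) (t : Carrier) {x x′ : Carrier} →
    x ≈ x′ → evalF c t x ≈ evalF c t x′
  evalF-congˣ c t ex = evalF-cong {c = c} (λ _ → refl) refl ex

  evalF-add : (a b : Fin d → Carrier) (t u x : Carrier) →
    evalF (λ i → a i + b i) (t + u) x ≈ evalF a t x + evalF b u x
  evalF-add {zero}  a b t u x = refl
  evalF-add {suc d} a b t u x = begin
    a zero + b zero + x * evalF (λ i → a (suc i) + b (suc i)) (t + u) x
      ≈⟨ +-congˡ (*-congˡ (evalF-add (a ∘ suc) (b ∘ suc) t u x)) ⟩
    a zero + b zero + x * (evalF (a ∘ suc) t x + evalF (b ∘ suc) u x)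
      ≈⟨ solve 5 (λ p q x y z → p :+ q :+ x :* (y :+ z) := (p :+ x :* y) :+ (q :+ x :* z))
           refl (a zero) (b zero) x _ _ ⟩
    evalF a t x + evalF b u x ∎
    where
    open SetoidReasoning setoid
    open RingSolver R

  evalF-scale : (s : Carrier) (b : Fin d → Carrier) (u x : Carrier) →
    evalF (λ i → s * b i) (s * u) x ≈ s * evalF b u x
  evalF-scale {zero}  s b u x = refl
  evalF-scale {suc d} s b u x = begin
    s * b zero + x * evalF (λ i → s * b (suc i)) (s * u) x
      ≈⟨ +-congˡ (*-congˡ (evalF-scale s (b ∘ suc) u x)) ⟩
    s * b zero + x * (s * evalF (b ∘ suc) u x)
      ≈⟨ solve 4 (λ s b x y → s :* b :+ x :* (s :* y) := s :* (b :+ x :* y)) refl s (b zero) x _ ⟩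
    s * evalF b u x ∎
    where
    open SetoidReasoning setoid
    open RingSolver R

  evalF-zero : {c : Fin d → Carrier} {t : Carrier} (x : Carrier) →
    (∀ i → c i ≈ 0#) → t ≈ 0# → evalF c t x ≈ 0#
  evalF-zero {zero}  x ec et = et
  evalF-zero {suc d} x ec et =
    trans (+-cong (ec zero) (trans (*-congˡ (evalF-zero x (ec ∘ suc) et)) (zeroʳ x))) (+-identityˡ 0#)

  evalF-last : (c : Fin (suc e) → Carrier) (t x : Carrier) →
    evalF c t x ≈ evalF (c ∘ inject₁) (c (fromℕ e) + x * t) x
  evalF-last {zero}  c t x = refl
  evalF-last {suc e} c t x = +-congˡ (*-congˡ (evalF-last (c ∘ suc) t x))

  -- The quotient of synthetic division by x - α; its leading coefficient is again t.
  quot : (Fin (suc d) → Carrier) → Carrier → Carrier → Fin d → Carrier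
  quot {suc d} c t α zero    = evalF (c ∘ suc) t α
  quot {suc d} c t α (suc i) = quot (c ∘ suc) t α i

  -- Written at α + w instead of at z with w = z - α: without subtraction this is an identity of
  -- commutative semirings. `split` restores the usual form in `factor-root`.
  evalF-quot : (c : Fin (suc d) → Carrier) (t α w : Carrier) →
    evalF c t (α + w) ≈ evalF c t α + w * evalF (quot c t α) t (α + w)
  evalF-quot {zero}  c t α w =
    solve 4 (λ c t α w → c :+ (α :+ w) :* t := (c :+ α :* t) :+ w :* t) refl (c zero) t α w
    where
    open RingSolver R
  evalF-quot {suc d} c t α w = begin
    c zero + (α + w) * evalF (c ∘ suc) t (α + w)
      ≈⟨ +-congˡ (*-congˡ (evalF-quot (c ∘ suc) t α w)) ⟩
    c zero + (α + w) * (evalF (c ∘ suc) t α + w * evalF (quot (c ∘ suc) t α) t (α + w))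
      ≈⟨ solve 5 (λ c α w e q → c :+ (α :+ w) :* (e :+ w :* q) := (c :+ α :* e) :+ w :* (e :+ (α :+ w) :* q))
           refl (c zero) α w _ _ ⟩
    evalF c t α + w * evalF (quot c t α) t (α + w) ∎
    where
    open SetoidReasoning setoid
    open RingSolver R

  -- p′(α) = q(α) + (α - γ) q′(α) for p(x) = p(γ) + (x - γ) q(x), since evalF (quot c t α) t α
  -- is the derivative at α.
  quot-quot : (c : Fin (suc (suc d)) → Carrier) (t γ w : Carrier) →
    let q = quot c t γ; α = γ + w in
    evalF (quot c t α) t α ≈ evalF q t α + w * evalF (quot q t α) t α
  quot-quot {zero} c t γ w =
    solve 4 (λ c t γ w → c :+ (γ :+ w) :* t :+ (γ :+ w) :* t := c :+ γ :* t :+ (γ :+ w) :* t :+ w :* t)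
      refl (c (suc zero)) t γ w
    where
    open RingSolver R
  quot-quot {suc d} c t γ w = begin
    evalF c′ t α + α * evalF (quot c′ t α) t α
      ≈⟨ +-cong (evalF-quot c′ t γ w) (*-congˡ (quot-quot c′ t γ w)) ⟩
    (evalF c′ t γ + w * evalF q′ t α) + α * (evalF q′ t α + w * evalF (quot q′ t α) t α)
      ≈⟨ solve 5 (λ e w q α d → (e :+ w :* q) :+ α :* (q :+ w :* d) := (e :+ α :* q) :+ w :* (q :+ α :* d))
           refl (evalF c′ t γ) w (evalF q′ t α) α (evalF (quot q′ t α) t α) ⟩
    (evalF c′ t γ + α * evalF q′ t α) + w * (evalF q′ t α + α * evalF (quot q′ t α) t α) ∎
    where
    open SetoidReasoning setoid
    open RingSolver R
    α = γ + w
    c′ = c ∘ suc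
    q′ = quot c′ t γ

  split : (z α : Carrier) → z ≈ α + (z - α)
  split z α = begin
    z              ≈⟨ +-identityˡ z ⟨
    0# + z         ≈⟨ +-congʳ (-‿inverseʳ α) ⟨
    α + - α + z    ≈⟨ solve 3 (λ a b z → a :+ b :+ z := a :+ (z :+ b)) refl α (- α) z ⟩
    α + (z - α)    ∎
    where
    open SetoidReasoning setoid
    open RingSolver R

  factor-root : (c : Fin (suc d) → Carrier) (t α z : Carrier) → evalF c t α ≈ 0# →
    evalF c t z ≈ (z - α) * evalF (quot c t α) t z
  factor-root c t α z root = begin
    evalF c t z ≈⟨ evalF-congˣ c t (split z α) ⟩
    evalF c t (α + (z - α)) ≈⟨ evalF-quot c t α (z - α) ⟩
    evalF c t α + (z - α) * evalF (quot c t α) t (α + (z - α))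
      ≈⟨ +-cong root (*-congˡ (evalF-congˣ (quot c t α) t (sym (split z α)))) ⟩
    0# + (z - α) * evalF (quot c t α) t z ≈⟨ +-identityˡ _ ⟩
    (z - α) * evalF (quot c t α) t z ∎
    where
    open SetoidReasoning setoid

  -- In a field these are the nonzero elements. In the product of two fields they are the pairs with
  -- both entries nonzero, so that `deflate` can divide two polynomials at the same time.
  Regular : Carrier → Set _
  Regular w = ∀ v → w * v ≈ 0# → v ≈ 0#

  record IsSubring {ℓ} (S : Pred Carrier ℓ) : Set (r ⊔ ℓr ⊔ ℓ) where
    field
      0∈   : S 0#
      1∈   : S 1#
      add  : ∀ {x y} → S x → S y → S (x + y)
      mul  : ∀ {x y} → S x → S y → S (x * y)
      neg  : ∀ {x} → S x → S (- x)
      resp : ∀ {x y} → x ≈ y → S x → S y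

  module _ {ℓ} {S : Pred Carrier ℓ} (isSubring : IsSubring S) where
    open IsSubring isSubring

    evalF-∈ : {c : Fin d → Carrier} {t x : Carrier} →
      (∀ i → S (c i)) → S t → S x → S (evalF c t x)
    evalF-∈ {zero}  c∈ t∈ x∈ = t∈
    evalF-∈ {suc d} c∈ t∈ x∈ = add (c∈ zero) (mul x∈ (evalF-∈ (c∈ ∘ suc) t∈ x∈))

    quot-∈ : {c : Fin (suc d) → Carrier} {t α : Carrier} →
      (∀ i → S (c i)) → S t → S α → ∀ i → S (quot c t α i)
    quot-∈ {suc d} c∈ t∈ α∈ zero    = evalF-∈ (c∈ ∘ suc) t∈ α∈
    quot-∈ {suc d} c∈ t∈ α∈ (suc i) = quot-∈ (c∈ ∘ suc) t∈ α∈ i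

    -- One factor X - βᵢ is divided off at a time. A further root z survives each division because z
    -- - βᵢ may be cancelled, and this applies to the later βᵢ themselves. The leading coefficient t
    -- never changes.
    deflate : ∀ {n} {c : Fin n → Carrier} {t} → (∀ i → S (c i)) → S t →
      (β : ℕ → Carrier) (j m : ℕ) → j ℕ.+ m ≡ n →
      (∀ {i} → i ℕ.< j → S (β i)) →
      (∀ {i} → i ℕ.< j → evalF c t (β i) ≈ 0#) →
      (∀ {i i′} → i ℕ.< i′ → i′ ℕ.< j → Regular (β i′ - β i)) →
      ∃[ c′ ] (∀ (i : Fin m) → S (c′ i)) ×
        (∀ z → (∀ {i} → i ℕ.< j → Regular (z - β i)) → evalF c t z ≈ 0# → evalF c′ t z ≈ 0#)
    deflate c∈ t∈ β zero m ≡.refl β∈ root regular = _ , c∈ , λ _ _ e → e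
    deflate {c = c} {t} c∈ t∈ β (suc j) m eq β∈ root regular
      with c₁ , c₁∈ , roots₁ ← deflate c∈ t∈ β j (suc m) (≡.trans (ℕₚ.+-suc j m) eq)
             (λ i<j → β∈ (ℕₚ.m<n⇒m<1+n i<j)) (λ i<j → root (ℕₚ.m<n⇒m<1+n i<j))
             (λ i<i′ i′<j → regular i<i′ (ℕₚ.m<n⇒m<1+n i′<j))
      = quot c₁ t (β j) , quot-∈ c₁∈ t∈ (β∈ ℕₚ.≤-refl) , roots
      where
      βj-root : evalF c₁ t (β j) ≈ 0#
      βj-root = roots₁ (β j) (λ i<j → regular i<j ℕₚ.≤-refl) (root ℕₚ.≤-refl)
      roots : ∀ z → (∀ {i} → i ℕ.< suc j → Regular (z - β i)) → evalF c t z ≈ 0# →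
        evalF (quot c₁ t (β j)) t z ≈ 0#
      roots z reg e = reg ℕₚ.≤-refl _
        (trans (sym (factor-root c₁ t (β j) z βj-root)) (roots₁ z (reg ∘ ℕₚ.m<n⇒m<1+n) e))

  -- The polynomials in x of degree below d. Once x satisfies a monic equation of degree d over S,
  -- this is the ring S[x].
  Span : ∀ {ℓ} → Pred Carrier ℓ → Carrier → ℕ → Pred Carrier (r ⊔ ℓr ⊔ ℓ)
  Span S x d z = ∃[ c ] (∀ (i : Fin d) → S (c i)) × z ≈ evalF c 0# x

  module _ {ℓ} {S : Pred Carrier ℓ} (isSubring : IsSubring S) {e : ℕ}
           {μ : Fin (suc e) → Carrier} {x : Carrier}
           (μ∈ : ∀ i → S (μ i)) (μ-root : evalF μ 1# x ≈ 0#) where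
    open IsSubring isSubring
    private
      M = Span S x (suc e)

      addM : ∀ {y z} → M y → M z → M (y + z)
      addM {y} {z} (a , a∈ , ea) (b , b∈ , eb) = (λ i → a i + b i) , (λ i → add (a∈ i) (b∈ i)) , (begin
        y + z                         ≈⟨ +-cong ea eb ⟩
        evalF a 0# x + evalF b 0# x   ≈⟨ evalF-add a b 0# 0# x ⟨
        evalF (λ i → a i + b i) (0# + 0#) x ≈⟨ evalF-congᵗ (λ i → a i + b i) x (+-identityˡ 0#) ⟩
        evalF (λ i → a i + b i) 0# x  ∎)
        where
        open SetoidReasoning setoid

      scaleM : ∀ {s z} → S s → M z → M (s * z)
      scaleM {s} {z} s∈ (b , b∈ , eb) = (λ i → s * b i) , (λ i → mul s∈ (b∈ i)) , (begin
        s * z                ≈⟨ *-congˡ eb ⟩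
        s * evalF b 0# x     ≈⟨ evalF-scale s b 0# x ⟨
        evalF (λ i → s * b i) (s * 0#) x ≈⟨ evalF-congᵗ (λ i → s * b i) x (zeroʳ s) ⟩
        evalF (λ i → s * b i) 0# x ∎)
        where
        open SetoidReasoning setoid

      constM : ∀ {s} → S s → M s
      constM {s} s∈ = (λ { zero → s ; (suc _) → 0# }) , (λ { zero → s∈ ; (suc _) → 0∈ }) , (begin
        s               ≈⟨ +-identityʳ s ⟨
        s + 0#          ≈⟨ +-congˡ (zeroʳ x) ⟨
        s + x * 0#      ≈⟨ +-congˡ (*-congˡ (evalF-zero {e} {λ _ → 0#} x (λ _ → refl) refl)) ⟨
        s + x * evalF {e} (λ _ → 0#) 0# x ∎)
        where
        open SetoidReasoning setoid

      respM : ∀ {y z} → y ≈ z → M y → M z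
      respM y≈z (c , c∈ , ec) = c , c∈ , trans (sym y≈z) ec

      shift : (Fin (suc e) → Carrier) → Fin (suc e) → Carrier
      shift c zero    = 0#
      shift c (suc i) = c (inject₁ i)

      -- x (c₀ + … + c_e x^e) has leading term c_e x^{e+1} = c_e (x^{e+1} - μ(x)).
      shiftM : ∀ {z} → M z → M (x * z)
      shiftM {z} (c , c∈ , ec) = c′ , c′∈ , (begin
        x * z ≈⟨ *-congˡ (trans ec (trans (evalF-last c 0# x)
                   (evalF-congᵗ (c ∘ inject₁) x (trans (+-congˡ (zeroʳ x)) (+-identityʳ t))))) ⟩
        x * evalF (c ∘ inject₁) t x ≈⟨ +-identityˡ _ ⟨
        evalF (shift c) t x ≈⟨ +-identityʳ _ ⟨
        evalF (shift c) t x + 0# ≈⟨ +-congˡ (trans (*-congˡ μ-root) (zeroʳ (- t))) ⟨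
        evalF (shift c) t x + - t * evalF μ 1# x ≈⟨ +-congˡ (evalF-scale (- t) μ 1# x) ⟨
        evalF (shift c) t x + evalF (λ i → - t * μ i) (- t * 1#) x
          ≈⟨ evalF-add (shift c) (λ i → - t * μ i) t (- t * 1#) x ⟨
        evalF c′ (t + - t * 1#) x
          ≈⟨ evalF-congᵗ c′ x (trans (+-congˡ (*-identityʳ (- t))) (-‿inverseʳ t)) ⟩
        evalF c′ 0# x ∎)
        where
        open SetoidReasoning setoid
        t = c (fromℕ e)
        c′ = λ i → shift c i + - t * μ i
        shift∈ : ∀ i → S (shift c i)
        shift∈ zero    = 0∈
        shift∈ (suc i) = c∈ (inject₁ i)
        c′∈ : ∀ i → S (c′ i)
        c′∈ i = add (shift∈ i) (mul (neg (c∈ (fromℕ e))) (μ∈ i))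

      -- Horner's scheme reduces multiplication in the span to addition, scaling by S and
      -- multiplication by x.
      hornerM : {c : Fin d → Carrier} {z : Carrier} → (∀ i → S (c i)) → M z → M (evalF c 0# x * z)
      hornerM {zero}  c∈ z∈ = respM (sym (zeroˡ _)) (constM 0∈)
      hornerM {suc d} {c} {z} c∈ z∈ =
        respM (solve 4 (λ c z x y → c :* z :+ x :* (y :* z) := (c :+ x :* y) :* z) refl (c zero) z x _)
          (addM (scaleM (c∈ zero) z∈) (shiftM (hornerM (c∈ ∘ suc) z∈)))
        where
        open RingSolver R

    Span-const : S ⊆ Span S x (suc e)
    Span-const = constM

    Span-gen : Span S x (suc e) x
    Span-gen = respM (*-identityʳ x) (shiftM (constM 1∈))

    Span-isSubring : IsSubring (Span S x (suc e))
    Span-isSubring = record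
      { 0∈ = constM 0∈ ; 1∈ = constM 1∈ ; add = addM
      ; mul = λ { (c , c∈ , ec) z∈ → respM (*-congʳ (sym ec)) (hornerM c∈ z∈) }
      ; neg = λ {y} y∈ → respM (trans (sym (-‿distribˡ-* 1# y)) (-‿cong (*-identityˡ y))) (scaleM (neg 1∈) y∈)
      ; resp = respM }
      where open RingProperties ring using (-‿distribˡ-*)

-- Dual numbers and products of rings

module DualNumbers {r ℓr} (R : CommutativeRing r ℓr) where
  open CommutativeRing R hiding (zero)
  private
    module R = RingPolynomials R
    additive = DirectProduct.abelianGroup +-abelianGroup +-abelianGroup

  -- R[ε] with ε² = 0; (a , b) stands for a + b ε.
  dualNumbers : CommutativeRing r ℓr
  dualNumbers = record
    { Carrier = Carrier × Carrier
    ; _≈_ = AbelianGroup._≈_ additive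
    ; _+_ = AbelianGroup._∙_ additive
    ; _*_ = λ (a , b) (c , d) → a * c , a * d + b * c
    ; -_ = AbelianGroup._⁻¹ additive
    ; 0# = AbelianGroup.ε additive
    ; 1# = 1# , 0#
    ; isCommutativeRing = record
      { isRing = record
        { +-isAbelianGroup = AbelianGroup.isAbelianGroup additive
        ; *-cong = λ (e , e′) (g , g′) → *-cong e g , +-cong (*-cong e g′) (*-cong e′ g)
        ; *-assoc = λ (a , a′) (b , b′) (c , c′) → *-assoc a b c ,
            solve 6 (λ a a′ b b′ c c′ → a :* b :* c′ :+ (a :* b′ :+ a′ :* b) :* c :=
                                        a :* (b :* c′ :+ b′ :* c) :+ a′ :* (b :* c)) refl a a′ b b′ c c′
        ; *-identity =
            (λ (a , a′) → *-identityˡ a ,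
              solve 2 (λ a a′ → con 1 :* a′ :+ con 0 :* a := a′) refl a a′) ,
            (λ (a , a′) → *-identityʳ a ,
              solve 2 (λ a a′ → a :* con 0 :+ a′ :* con 1 := a′) refl a a′)
        ; distrib =
            (λ (a , a′) (b , b′) (c , c′) → distribˡ a b c ,
              solve 6 (λ a a′ b b′ c c′ → a :* (b′ :+ c′) :+ a′ :* (b :+ c) :=
                         (a :* b′ :+ a′ :* b) :+ (a :* c′ :+ a′ :* c)) refl a a′ b b′ c c′) ,
            (λ (a , a′) (b , b′) (c , c′) → distribʳ a b c ,
              solve 6 (λ a a′ b b′ c c′ → (b :+ c) :* a′ :+ (b′ :+ c′) :* a :=
                         (b :* a′ :+ b′ :* a) :+ (c :* a′ :+ c′ :* a)) refl a a′ b b′ c c′)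
        }
      ; *-comm = λ (a , a′) (b , b′) → *-comm a b ,
          solve 4 (λ a a′ b b′ → a :* b′ :+ a′ :* b := b :* a′ :+ b′ :* a) refl a a′ b b′
      }
    }
    where
    open RingSolver R

  open RingPolynomials dualNumbers using (evalF)

  evalF-proj₁ : ∀ {d} (c : Fin d → Carrier × Carrier) t x →
    proj₁ (evalF c t x) ≡ R.evalF (proj₁ ∘ c) (proj₁ t) (proj₁ x)
  evalF-proj₁ {zero}  c t x = ≡.refl
  evalF-proj₁ {suc d} c t x = ≡.cong (λ v → proj₁ (c zero) + proj₁ x * v) (evalF-proj₁ (c ∘ suc) t x)

  -- The Taylor expansion p(α + ε) = p(α) + p′(α) ε, by which the value at α of the synthetic
  -- quotient is recognised as p′(α).
  evalF-proj₂ : ∀ {d} (c : Fin (suc d) → Carrier) t α →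
    proj₂ (evalF (λ i → c i , 0#) (t , 0#) (α , 1#)) ≈ R.evalF (R.quot c t α) t α
  evalF-proj₂ {zero}  c t α =
    solve 2 (λ t α → con 0 :+ (α :* con 0 :+ con 1 :* t) := t) refl t α
    where
    open RingSolver R
  evalF-proj₂ {suc d} c t α =
    trans (+-congˡ (+-cong (*-congˡ (evalF-proj₂ (c ∘ suc) t α))
                           (*-congˡ (reflexive (evalF-proj₁ (λ i → c (suc i) , 0#) (t , 0#) (α , 1#))))))
      (solve 3 (λ α q e → con 0 :+ (α :* q :+ con 1 :* e) := e :+ α :* q) refl α _ _)
    where
    open RingSolver R

  module _ {ℓ} {S : Pred Carrier ℓ} (isSubring : R.IsSubring S) where
    private
      module S = R.IsSubring isSubring
      module D = RingPolynomials dualNumbers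

      S₀ : Pred (Carrier × Carrier) (ℓr ⊔ ℓ)
      S₀ (a , b) = S a × b ≈ 0#

      mul₀ : ∀ {x y} → S₀ x → S₀ y → S₀ (proj₁ x * proj₁ y , proj₁ x * proj₂ y + proj₂ x * proj₁ y)
      mul₀ (p , q) (p′ , q′) = S.mul p p′ ,
        trans (+-cong (trans (*-congˡ q′) (zeroʳ _)) (trans (*-congʳ q) (zeroˡ _))) (+-identityˡ 0#)

      S₀-subring : D.IsSubring S₀
      S₀-subring = record
        { 0∈ = S.0∈ , refl ; 1∈ = S.1∈ , refl
        ; add = λ (p , q) (p′ , q′) → S.add p p′ , trans (+-cong q q′) (+-identityˡ 0#)
        ; mul = mul₀
        ; neg = λ (p , q) → S.neg p , trans (-‿cong q) (trans (sym (+-identityˡ _)) (-‿inverseʳ 0#))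
        ; resp = λ (r , r′) (p , q) → S.resp r p , trans (sym r′) q }

    -- A double root α of μ gives a root α + ε in R[ε]: there F reduces modulo μ to a polynomial of
    -- smaller degree, with the same value and derivative at α.
    reduce-double-root : ∀ {d e} (μ : Fin (suc d) → Carrier) {α} → (∀ i → S (μ i)) →
      R.evalF μ 1# α ≈ 0# → R.evalF (R.quot μ 1# α) 1# α ≈ 0# →
      (F : Fin (suc e) → Carrier) → (∀ i → S (F i)) →
      ∃[ a ] (∀ (i : Fin (suc d)) → S (a i)) × R.evalF F 1# α ≈ R.evalF a 0# α ×
        ((∀ i → a i ≈ 0#) → R.evalF (R.quot F 1# α) 1# α ≈ 0#)
    reduce-double-root {d} {e} μ {α} μ∈ root root′ F F∈
      = let a , a∈ , eq₁ , eq₂ = reduced in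
        proj₁ ∘ a , (λ i → proj₁ (a∈ i)) ,
        trans (reflexive (≡.sym (evalF-proj₁ F₀ (1# , 0#) (α , 1#)))) (trans eq₁
          (reflexive (evalF-proj₁ a (0# , 0#) (α , 1#)))) ,
        λ a≈0 → trans (sym (evalF-proj₂ F 1# α)) (trans eq₂
          (proj₂ (D.evalF-zero {c = a} (α , 1#) (λ i → a≈0 i , proj₂ (a∈ i)) (refl , refl))))
      where
      F₀ : Fin (suc e) → Carrier × Carrier
      F₀ i = F i , 0#
      μ₀ : Fin (suc d) → Carrier × Carrier
      μ₀ i = μ i , 0#
      root₀ : CommutativeRing._≈_ dualNumbers (D.evalF μ₀ (1# , 0#) (α , 1#)) (0# , 0#)
      root₀ = trans (reflexive (evalF-proj₁ μ₀ (1# , 0#) (α , 1#))) root , trans (evalF-proj₂ μ 1# α) root′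
      μ₀∈ : ∀ i → S₀ (μ₀ i)
      μ₀∈ i = μ∈ i , refl
      -- As μ(α + ε) = μ(α) + μ′(α) ε = 0, the span is the whole ring S[α + ε]; hence F(α + ε) is
      -- also the value of a polynomial over S of degree at most d.
      span : D.IsSubring (D.Span S₀ (α , 1#) (suc d))
      span = D.Span-isSubring S₀-subring μ₀∈ root₀
      reduced : D.Span S₀ (α , 1#) (suc d) (D.evalF F₀ (1# , 0#) (α , 1#))
      reduced = D.evalF-∈ span {c = F₀} {1# , 0#} {α , 1#}
        (λ i → D.Span-const S₀-subring μ₀∈ root₀ (F∈ i , refl))
        (D.IsSubring.1∈ span) (D.Span-gen S₀-subring μ₀∈ root₀)

module ProductRing {r ℓr} (R : CommutativeRing r ℓr) where
  open CommutativeRing R hiding (zero)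
  private module R = RingPolynomials R

  productRing : CommutativeRing r ℓr
  productRing = DirectProduct.commutativeRing R R

  open RingPolynomials productRing using (evalF)

  evalF-proj₁ : ∀ {d} (c : Fin d → Carrier × Carrier) t x →
    proj₁ (evalF c t x) ≡ R.evalF (proj₁ ∘ c) (proj₁ t) (proj₁ x)
  evalF-proj₁ {zero}  c t x = ≡.refl
  evalF-proj₁ {suc d} c t x = ≡.cong (λ v → proj₁ (c zero) + proj₁ x * v) (evalF-proj₁ (c ∘ suc) t x)

  evalF-proj₂ : ∀ {d} (c : Fin d → Carrier × Carrier) t x →
    proj₂ (evalF c t x) ≡ R.evalF (proj₂ ∘ c) (proj₂ t) (proj₂ x)
  evalF-proj₂ {zero}  c t x = ≡.refl
  evalF-proj₂ {suc d} c t x = ≡.cong (λ v → proj₂ (c zero) + proj₂ x * v) (evalF-proj₂ (c ∘ suc) t x)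

-- Evaluation of coefficient lists under a map of rings

module ListEvaluation {a ℓa r ℓr} (A : CommutativeRing a ℓa) (R : CommutativeRing r ℓr)
    (φ : CommutativeRing.Carrier A → CommutativeRing.Carrier R)
    (φ-cong : ∀ {x y} → CommutativeRing._≈_ A x y → CommutativeRing._≈_ R (φ x) (φ y))
    (φ-0 : CommutativeRing._≈_ R (φ (CommutativeRing.0# A)) (CommutativeRing.0# R))
    (φ-* : ∀ x y → CommutativeRing._≈_ R (φ (CommutativeRing._*_ A x y)) (CommutativeRing._*_ R (φ x) (φ y))) where
  private
    module A = CommutativeRing A
    module R = CommutativeRing R
  open CommutativeRing R hiding (zero)
  open Polynomial A.rawRing using (Poly; coeff; HasDegree; _≈ₚ_; _+ₚ_; _*ₚ_; derivative)
  private module RX = Polynomial R.rawRing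
  open RingPolynomials R using (evalF; evalF-cong; evalF-scale)

  eval : Poly → Carrier → Carrier
  eval p = RX.eval (map φ p)

  eval-zero : ∀ p x → (∀ i → coeff p i A.≈ A.0#) → eval p x ≈ 0#
  eval-zero [] x e = refl
  eval-zero (a ∷ p) x e = trans (+-cong (trans (φ-cong (e 0)) φ-0)
    (trans (*-congˡ (eval-zero p x (e ∘ suc))) (zeroʳ x))) (+-identityˡ 0#)

  -- A list may end in zeros, so its length says nothing about the degree; the vanishing of all
  -- coefficients beyond n permits the passage to a coefficient function of fixed length.
  eval-degree : ∀ p n x → (∀ i → n ℕ.< i → coeff p i A.≈ A.0#) →
    eval p x ≈ evalF {n} (λ i → φ (coeff p (toℕ i))) (φ (coeff p n)) x
  eval-degree p zero x e with p
  ... | []    = sym φ-0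
  ... | a ∷ q = trans (+-congˡ (trans (*-congˡ (eval-zero q x (λ i → e (suc i) (ℕ.s≤s ℕ.z≤n)))) (zeroʳ x)))
                  (+-identityʳ (φ a))
  eval-degree (a ∷ p) (suc n) x e =
    +-congˡ (*-congˡ (eval-degree p n x (λ i n<i → e (suc i) (ℕ.s≤s n<i))))
  eval-degree [] (suc n) x e = begin
    0# ≈⟨ zeroʳ x ⟨
    x * 0# ≈⟨ *-congˡ (eval-degree [] n x (λ _ _ → A.refl)) ⟩
    x * evalF {n} (λ _ → φ A.0#) (φ A.0#) x ≈⟨ +-identityˡ _ ⟨
    0# + x * evalF {n} (λ _ → φ A.0#) (φ A.0#) x ≈⟨ +-congʳ φ-0 ⟨
    φ A.0# + x * evalF {n} (λ _ → φ A.0#) (φ A.0#) x ∎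
    where
    open SetoidReasoning setoid

  module _ (φ-1 : φ A.1# R.≈ R.1#) where
    eval-monic : ∀ p n l⁻¹ → coeff p n A.* l⁻¹ A.≈ A.1# → (∀ i → n ℕ.< i → coeff p i A.≈ A.0#) → ∀ x →
      eval p x ≈ φ (coeff p n) * evalF {n} (λ i → φ (l⁻¹ A.* coeff p (toℕ i))) 1# x
    eval-monic p n l⁻¹ l≉0 e x = begin
      eval p x
        ≈⟨ eval-degree p n x e ⟩
      evalF {n} (λ i → φ (coeff p (toℕ i))) (φ l) x
        ≈⟨ evalF-cong {n} (λ i → trans (φ-cong (A.sym (cancel (coeff p (toℕ i))))) (φ-* l _))
             (sym (*-identityʳ (φ l))) refl ⟩
      evalF {n} (λ i → φ l * φ (l⁻¹ A.* coeff p (toℕ i))) (φ l * 1#) x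
        ≈⟨ evalF-scale {n} (φ l) (λ i → φ (l⁻¹ A.* coeff p (toℕ i))) 1# x ⟩
      φ l * evalF {n} (λ i → φ (l⁻¹ A.* coeff p (toℕ i))) 1# x ∎
      where
      open SetoidReasoning setoid
      l = coeff p n
      cancel : ∀ b → l A.* (l⁻¹ A.* b) A.≈ b
      cancel b = A.trans (A.sym (A.*-assoc l l⁻¹ b)) (A.trans (A.*-congʳ l≉0) (A.*-identityˡ b))

  module _ (φ-+ : ∀ x y → φ (x A.+ y) R.≈ φ x R.+ φ y) where
    eval-+ : ∀ p q x → eval (p +ₚ q) x ≈ eval p x + eval q x
    eval-+ [] q x = sym (+-identityˡ _)
    eval-+ (a ∷ p) [] x = sym (+-identityʳ _)
    eval-+ (a ∷ p) (b ∷ q) x = trans (+-cong (φ-+ a b) (*-congˡ (eval-+ p q x)))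
      (solve 5 (λ a b x p q → a :+ b :+ x :* (p :+ q) := (a :+ x :* p) :+ (b :+ x :* q)) refl (φ a) (φ b) x _ _)
      where
      open RingSolver R

    eval-scale : ∀ a q x → eval (map (a A.*_) q) x ≈ φ a * eval q x
    eval-scale a [] x = sym (zeroʳ _)
    eval-scale a (b ∷ q) x = trans (+-cong (φ-* a b) (*-congˡ (eval-scale a q x)))
      (solve 4 (λ a b x q → a :* b :+ x :* (a :* q) := a :* (b :+ x :* q)) refl (φ a) (φ b) x _)
      where
      open RingSolver R

    eval-* : ∀ p q x → eval (p *ₚ q) x ≈ eval p x * eval q x
    eval-* [] q x = sym (zeroˡ _)
    eval-* (a ∷ p) q x = begin
      eval (map (a A.*_) q +ₚ (A.0# ∷ (p *ₚ q))) x
        ≈⟨ eval-+ (map (a A.*_) q) _ x ⟩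
      eval (map (a A.*_) q) x + (φ A.0# + x * eval (p *ₚ q) x)
        ≈⟨ +-cong (eval-scale a q x) (+-cong φ-0 (*-congˡ (eval-* p q x))) ⟩
      φ a * eval q x + (0# + x * (eval p x * eval q x))
        ≈⟨ solve 4 (λ a x p q → a :* q :+ (con 0 :+ x :* (p :* q)) := (a :+ x :* p) :* q)
             refl (φ a) x (eval p x) (eval q x) ⟩
      (φ a + x * eval p x) * eval q x ∎
      where
      open SetoidReasoning setoid
      open RingSolver R

    eval-cong : ∀ p q x → p ≈ₚ q → eval p x ≈ eval q x
    eval-cong [] q x e = sym (eval-zero q x (λ i → A.sym (e i)))
    eval-cong (a ∷ p) [] x e = eval-zero (a ∷ p) x e
    eval-cong (a ∷ p) (b ∷ q) x e = +-cong (φ-cong (e 0)) (*-congˡ (eval-cong p q x (e ∘ suc)))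

    -- p (x + ε) = p (x) + p′ (x) ε
    open DualNumbers R using (dualNumbers)
    eval-dual-proj₁ : ∀ p x → proj₁ (Polynomial.eval (CommutativeRing.rawRing dualNumbers)
      (map (λ a → φ a , 0#) p) (x , 1#)) ≡ eval p x
    eval-dual-proj₁ [] x = ≡.refl
    eval-dual-proj₁ (a ∷ p) x = ≡.cong (λ v → φ a + x * v) (eval-dual-proj₁ p x)

    eval-dual-proj₂ : ∀ p x → proj₂ (Polynomial.eval (CommutativeRing.rawRing dualNumbers)
      (map (λ a → φ a , 0#) p) (x , 1#)) ≈ eval (derivative p) x
    eval-dual-proj₂ [] x = refl
    eval-dual-proj₂ (a ∷ p) x = begin
      0# + (x * _ + 1# * _)
        ≈⟨ +-congˡ (+-cong (*-congˡ (eval-dual-proj₂ p x)) (*-congˡ (reflexive (eval-dual-proj₁ p x)))) ⟩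
      0# + (x * eval (derivative p) x + 1# * eval p x)
        ≈⟨ solve 3 (λ x d p → con 0 :+ (x :* d :+ con 1 :* p) := p :+ (con 0 :+ x :* d)) refl x _ _ ⟩
      eval p x + (0# + x * eval (derivative p) x)
        ≈⟨ +-congˡ (+-congʳ (sym φ-0)) ⟩
      eval p x + (φ A.0# + x * eval (derivative p) x)
        ≈⟨ eval-+ p (A.0# ∷ derivative p) x ⟨
      eval (p +ₚ (A.0# ∷ derivative p)) x ∎
      where
      open SetoidReasoning setoid
      open RingSolver R

-- Intermediate fields, minimal polynomials and partial isomorphisms

fieldRing : ∀ {c ℓ₁ ℓ₂} → HeytingField c ℓ₁ ℓ₂ → CommutativeRing c ℓ₁
fieldRing F = HeytingCommutativeRing.commutativeRing (HeytingField.heytingCommutativeRing F)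

module FieldProperties (em : ∀ {ℓ} → ExcludedMiddle ℓ) {c ℓ₁ ℓ₂} (F : HeytingField c ℓ₁ ℓ₂) where
  open HeytingField F hiding (zero)
  open CommutativeRing (fieldRing F) using (ring)
  open RingProperties ring using (-0#≈0#; x∙y⁻¹≈ε⇒x≈y)
  open RingPolynomials (fieldRing F) using (Regular)

  x-0≈x : ∀ x → x - 0# ≈ x
  x-0≈x x = trans (+-congˡ -0#≈0#) (+-identityʳ x)

  abstract
    inverse : ∀ x → ¬ x ≈ 0# → ∃[ y ] x * y ≈ 1#
    inverse x x≉0 with em {P = x # 0#}
    ... | no ¬x#0  = contradiction (proj₁ (tight x 0#) ¬x#0) x≉0
    ... | yes x#0 with y , _ , xy≈1 ← #⇒invertible x#0 = y , trans (*-congʳ (sym (x-0≈x x))) xy≈1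

  1≉0 : ¬ 1# ≈ 0#
  1≉0 1≈0 = proj₂ (tight 1# 0#) 1≈0
    (invertible⇒# (1# , trans (*-congˡ (x-0≈x 1#)) (*-identityˡ 1#) , trans (*-congʳ (x-0≈x 1#)) (*-identityˡ 1#)))

  ≉0⇒regular : ∀ {x} → ¬ x ≈ 0# → Regular x
  ≉0⇒regular {x} x≉0 v xv≈0 with y , xy≈1 ← inverse x x≉0 =
    trans (sym (*-identityˡ v)) (trans (*-congʳ (trans (sym xy≈1) (*-comm x y)))
      (trans (*-assoc y x v) (trans (*-congˡ xv≈0) (zeroʳ y))))

  ≉⇒regular : ∀ {x y} → ¬ x ≈ y → Regular (x - y)
  ≉⇒regular x≉y = ≉0⇒regular (x≉y ∘ x∙y⁻¹≈ε⇒x≈y _ _)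

module ClosureProperties (em : ∀ {ℓ} → ExcludedMiddle ℓ) {c ℓ₁ ℓ₂ c′ ℓ₁′ ℓ₂′}
    (K : HeytingField c ℓ₁ ℓ₂) (K̄ : AlgebraicClosure K c′ ℓ₁′ ℓ₂′) where
  private
    module K = HeytingField K
    module KX = Polynomial (fieldRawRing K)
    module KF = FieldProperties em K
  open AlgebraicClosure K̄
  open CommutativeRing (fieldRing closure) using (ring)
  open RingProperties ring using (x∙y⁻¹≈ε⇒x≈y; -‿involutive; -‿distribʳ-*; +-inverseʳ-unique)
  open FieldProperties em closure
  open RingPolynomials (fieldRing closure)
  open Extensions K̄ hiding (base; gen; add; mul; neg; inv; resp)
  open IsRingHomomorphism ι-hom renaming
    (⟦⟧-cong to ι-cong; 0#-homo to ι-0; 1#-homo to ι-1; +-homo to ι-+; *-homo to ι-*; -‿homo to ι-neg)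
  module Product = ProductRing (fieldRing closure)
  module P = RingPolynomials Product.productRing
  module ι-Evaluation = ListEvaluation (fieldRing K) (fieldRing closure) ι ι-cong ι-0 ι-*
  open ι-Evaluation using (eval-monic)

  ι-injective₀ : ∀ {a} → ι a ≈ 0# → a K.≈ K.0#
  ι-injective₀ {a} ιa≈0 with em {P = a K.≈ K.0#}
  ... | yes a≈0 = a≈0
  ... | no a≉0 with b , ab≈1 ← KF.inverse a a≉0 = contradiction
    (trans (sym ι-1) (trans (ι-cong (K.sym ab≈1)) (trans (ι-* a b) (trans (*-congʳ ιa≈0) (zeroˡ _))))) 1≉0

  -- As x is nonzero, vanishing low coefficients can be cancelled from p(x) = 0 together with a
  -- factor x each. The first nonzero coefficient then becomes the constant term, and this is what
  -- makes x invertible within K[x].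
  K-relation : ∀ p x → ¬ (p KX.≈ₚ KX.0ₚ) → evalAt p x ≈ 0# → ¬ x ≈ 0# →
    ∃[ a ] ∃[ q ] ¬ a K.≈ K.0# × ι a + x * evalAt q x ≈ 0#
  K-relation [] x p≉0 px≈0 x≉0 = contradiction (λ _ → K.refl) p≉0
  K-relation (a ∷ p) x p≉0 px≈0 x≉0 with em {P = a K.≈ K.0#}
  ... | no a≉0  = a , p , a≉0 , px≈0
  ... | yes a≈0 = K-relation p x (λ p≈0 → p≉0 λ { zero → a≈0 ; (suc i) → p≈0 i })
    (≉0⇒regular x≉0 _ (trans (sym (+-identityˡ _)) (trans (+-congʳ (sym (trans (ι-cong a≈0) ι-0))) px≈0))) x≉0

  abstract
    relation-over-K : ∀ x → ¬ x ≈ 0# → ∃[ a ] ∃[ q ] ¬ a K.≈ K.0# × ι a + x * evalAt q x ≈ 0#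
    relation-over-K x x≉0 with p , p≉0 , px≈0 ← algebraic x = K-relation p x p≉0 px≈0 x≉0

  private
    inverse-formula : ∀ {x y a b v} → x * y ≈ 1# → a * b ≈ 1# → a + x * v ≈ 0# → b * - v ≈ y
    inverse-formula {x} {y} {a} {b} {v} xy≈1 ab≈1 e = begin
      b * - v                ≈⟨ *-identityˡ _ ⟨
      1# * (b * - v)         ≈⟨ *-congʳ xy≈1 ⟨
      (x * y) * (b * - v)    ≈⟨ solve 4 (λ x y b v → (x :* y) :* (b :* v) := (b :* y) :* (x :* v)) refl x y b (- v) ⟩
      (b * y) * (x * - v)    ≈⟨ *-congˡ (sym (-‿distribʳ-* x v)) ⟩
      (b * y) * - (x * v)    ≈⟨ *-congˡ (-‿cong (+-inverseʳ-unique _ _ e)) ⟩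
      (b * y) * - - a        ≈⟨ *-congˡ (-‿involutive _) ⟩
      (b * y) * a            ≈⟨ solve 3 (λ a b y → (b :* y) :* a := (a :* b) :* y) refl a b y ⟩
      (a * b) * y            ≈⟨ *-congʳ ab≈1 ⟩
      1# * y                 ≈⟨ *-identityˡ y ⟩
      y                      ∎
      where
      open SetoidReasoning setoid
      open RingSolver (fieldRing closure)

  -- Formulated by ring operations so that spans and domains of graphs qualify at once; inverses
  -- then come from algebraicity, by `inv-∈`.
  record IsIntermediate {ℓ} (L : Pred Carrier ℓ) : Set (c ⊔ c′ ⊔ ℓ₁′ ⊔ ℓ) where
    field
      isSubring : IsSubring L
      const     : ∀ a → L (ι a)
    open IsSubring isSubring public

    evalAt-∈ : ∀ q {x} → L x → L (evalAt q x)
    evalAt-∈ []      x∈ = 0∈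
    evalAt-∈ (a ∷ q) x∈ = add (const a) (mul x∈ (evalAt-∈ q x∈))

    -- From a + x q(x) = 0 with a ∈ K nonzero, x⁻¹ = - q(x) / a.
    abstract
      inv-∈ : ∀ {x y} → L x → x * y ≈ 1# → L y
      inv-∈ {x} {y} x∈ xy≈1
        with a , q , a≉0 , e ← relation-over-K x
               (λ x≈0 → 1≉0 (trans (sym xy≈1) (trans (*-congʳ x≈0) (zeroˡ y))))
        with b , ab≈1 ← KF.inverse a a≉0
        = resp (inverse-formula xy≈1 (trans (sym (ι-* a b)) (trans (ι-cong ab≈1) ι-1)) e)
            (mul (const b) (neg (evalAt-∈ q x∈)))

  open IsIntermediate public using (isSubring; const; evalAt-∈; inv-∈)

  Adjoin-intermediate : ∀ {ℓ} (B : Pred Carrier ℓ) → IsIntermediate (Adjoin B)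
  Adjoin-intermediate B = record
    { isSubring = record
      { 0∈ = Adjoin.resp ι-0 (Adjoin.base K.0#) ; 1∈ = Adjoin.resp ι-1 (Adjoin.base K.1#)
      ; add = Adjoin.add ; mul = Adjoin.mul ; neg = Adjoin.neg ; resp = Adjoin.resp }
    ; const = Adjoin.base }

  Adjoin-least : ∀ {ℓ ℓ′} {B : Pred Carrier ℓ} {L : Pred Carrier ℓ′} →
    IsIntermediate L → B ⊆ L → Adjoin B ⊆ L
  Adjoin-least L B⊆L (Adjoin.base a)   = const L a
  Adjoin-least L B⊆L (Adjoin.gen x∈)   = B⊆L x∈
  Adjoin-least L B⊆L (Adjoin.add p q)  = IsIntermediate.add L (Adjoin-least L B⊆L p) (Adjoin-least L B⊆L q)
  Adjoin-least L B⊆L (Adjoin.mul p q)  = IsIntermediate.mul L (Adjoin-least L B⊆L p) (Adjoin-least L B⊆L q)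
  Adjoin-least L B⊆L (Adjoin.neg p)    = IsIntermediate.neg L (Adjoin-least L B⊆L p)
  Adjoin-least L B⊆L (Adjoin.inv p e)  = inv-∈ L (Adjoin-least L B⊆L p) e
  Adjoin-least L B⊆L (Adjoin.resp e p) = IsIntermediate.resp L e (Adjoin-least L B⊆L p)

  Adjoin-⊆ : ∀ {ℓ ℓ′} {B : Pred Carrier ℓ} {B′ : Pred Carrier ℓ′} → B ⊆ Adjoin B′ → Adjoin B ⊆ Adjoin B′
  Adjoin-⊆ = Adjoin-least (Adjoin-intermediate _)

  -- With `Independent` for the same d this says that x has degree d over L and that μ is its
  -- minimal polynomial, with the leading coefficient 1 left implicit.
  Dependent : ∀ {ℓ} → Pred Carrier ℓ → Carrier → ℕ → Set _
  Dependent L x d = ∃[ μ ] (∀ (i : Fin d) → L (μ i)) × evalF μ 1# x ≈ 0#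

  Independent : ∀ {ℓ} → Pred Carrier ℓ → Carrier → ℕ → Set _
  Independent L x d = ∀ (a : Fin d → Carrier) → (∀ i → L (a i)) → evalF a 0# x ≈ 0# → ∀ i → a i ≈ 0#

  ¬Dependent0 : ∀ {ℓ} {L : Pred Carrier ℓ} {x} → ¬ Dependent L x 0
  ¬Dependent0 (_ , _ , e) = 1≉0 e

  module _ {ℓ} {L : Pred Carrier ℓ} (isL : IsIntermediate L) where
    private module L = IsIntermediate isL

    monicise : ∀ {d} {μ : Fin d → Carrier} {t x} → (∀ i → L (μ i)) → L t → ¬ t ≈ 0# →
      evalF μ t x ≈ 0# → Dependent L x d
    monicise {d} {μ} {t} {x} μ∈ t∈ t≉0 e with s , ts≈1 ← inverse t t≉0 =
      (λ i → s * μ i) , (λ i → L.mul (L.inv-∈ t∈ ts≈1) (μ∈ i)) ,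
      trans (evalF-congᵗ (λ i → s * μ i) x (trans (sym ts≈1) (*-comm t s)))
        (trans (evalF-scale s μ t x) (trans (*-congˡ e) (zeroʳ s)))

    leading-term : ∀ {d} (a : Fin d → Carrier) → (∀ i → L (a i)) → ¬ (∀ i → a i ≈ 0#) →
      ∃[ e ] e ℕ.< d × ∃[ b ] ∃[ t ] (∀ (i : Fin e) → L (b i)) × L t × ¬ t ≈ 0# ×
        (∀ x → evalF a 0# x ≈ evalF b t x)
    leading-term {zero} a a∈ a≉0 = contradiction (λ ()) a≉0
    leading-term {suc d} a a∈ a≉0 with em {P = ∀ i → a (suc i) ≈ 0#}
    ... | yes tail≈0 = 0 , ℕ.s≤s ℕ.z≤n , (λ ()) , a zero , (λ ()) , a∈ zero ,
      (λ a₀≈0 → a≉0 λ { zero → a₀≈0 ; (suc i) → tail≈0 i }) ,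
      λ x → trans (+-congˡ (trans (*-congˡ (evalF-zero x tail≈0 refl)) (zeroʳ x))) (+-identityʳ _)
    ... | no tail≉0 with e , e<d , b , t , b∈ , t∈ , t≉0 , eq ← leading-term (a ∘ suc) (a∈ ∘ suc) tail≉0
      = suc e , ℕ.s≤s e<d , (λ { zero → a zero ; (suc i) → b i }) , t ,
        (λ { zero → a∈ zero ; (suc i) → b∈ i }) , t∈ , t≉0 , λ x → +-congˡ (*-congˡ (eq x))

    -- A nontrivial relation among 1, x, ..., x^{d-1}, cut off at its last nonzero coefficient and
    -- made monic, would be a dependence of degree below d.
    minimal⇒independent : ∀ {x d} → (∀ {e} → e ℕ.< d → ¬ Dependent L x e) → Independent L x d
    minimal⇒independent {x} min a a∈ e with em {P = ∀ i → a i ≈ 0#}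
    ... | yes a≈0 = a≈0
    ... | no a≉0 with e′ , e′<d , b , t , b∈ , t∈ , t≉0 , eq ← leading-term a a∈ a≉0
      = contradiction (monicise b∈ t∈ t≉0 (trans (sym (eq x)) e)) (min e′<d)

    leading-coefficient : ∀ (p : KX.Poly) → ¬ (p KX.≈ₚ KX.0ₚ) → ∃[ d ] KX.HasDegree p d
    leading-coefficient [] p≉0 = contradiction (λ _ → K.refl) p≉0
    leading-coefficient (a ∷ p) p≉0 with em {P = p KX.≈ₚ KX.0ₚ}
    ... | yes p≈0 = 0 , (λ a≈0 → p≉0 λ { zero → a≈0 ; (suc i) → p≈0 i }) , λ { (suc i) _ → p≈0 i }
    ... | no p≉0′ with d , l≉0 , above ← leading-coefficient p p≉0′ =
      suc d , l≉0 , λ { (suc i) (ℕ.s≤s d<i) → above i d<i }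

    some-dependence : ∀ x → ∃[ d ] Dependent L x d
    some-dependence x
      with p , p≉0 , e ← algebraic x
      with d , l≉0 , above ← leading-coefficient p p≉0
      with b , lb≈1 ← KF.inverse _ l≉0
      = d , _ , (λ i → L.const _) ,
        ≉0⇒regular (l≉0 ∘ ι-injective₀) _ (trans (sym (eval-monic ι-1 p d b lb≈1 above x)) e)

    least-dependence : ∀ x b → (∃[ d ] d ℕ.< b × Dependent L x d) →
      ∃[ d ] Dependent L x d × (∀ {e} → e ℕ.< d → ¬ Dependent L x e)
    least-dependence x zero (d , () , _)
    least-dependence x (suc b) (d , d<1+b , dep) with em {P = ∃[ e ] e ℕ.< b × Dependent L x e}
    ... | yes smaller = least-dependence x b smaller
    ... | no none = d , dep , λ e<d dep′ → none (_ , ℕₚ.<-≤-trans e<d (ℕₚ.≤-pred d<1+b) , dep′)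

    abstract
      minimal-polynomial : ∀ x → ∃[ d ] Dependent L x d × Independent L x d
      minimal-polynomial x with d , dep ← some-dependence x
        with d′ , dep′ , min ← least-dependence x (suc d) (d , ℕₚ.≤-refl , dep)
        = d′ , dep′ , minimal⇒independent min

  private
    toPoly : ∀ {d} → (Fin d → Carrier) → Carrier → Closureₚ.Poly
    toPoly {zero}  a t = t ∷ []
    toPoly {suc d} a t = a zero ∷ toPoly (a ∘ suc) t

    toPoly-degree : ∀ {d} (a : Fin d → Carrier) {t} → ¬ t ≈ 0# → Closureₚ.HasDegree (toPoly a t) d
    toPoly-degree {zero}  a t≉0 = t≉0 , λ { (suc i) _ → refl }
    toPoly-degree {suc d} a t≉0 with l≉0 , above ← toPoly-degree (a ∘ suc) t≉0 =
      l≉0 , λ { (suc i) (ℕ.s≤s d<i) → above i d<i }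

    toPoly-eval : ∀ {d} (a : Fin d → Carrier) t x → Closureₚ.eval (toPoly a t) x ≈ evalF a t x
    toPoly-eval {zero}  a t x = trans (+-congˡ (zeroʳ x)) (+-identityʳ t)
    toPoly-eval {suc d} a t x = +-congˡ (*-congˡ (toPoly-eval (a ∘ suc) t x))

  abstract
    root-of : ∀ {d} (μ : Fin (suc d) → Carrier) → ∃[ y ] evalF μ 1# y ≈ 0#
    root-of {d} μ with y , e ← closed (toPoly μ 1#) d (toPoly-degree μ 1≉0) =
      y , trans (sym (toPoly-eval μ 1# y)) e

  -- The graph of an isomorphism over K between two intermediate fields.
  record IsPartialIso {ℓ} (S : Pred (Carrier × Carrier) ℓ) : Set (c ⊔ c′ ⊔ ℓ₁′ ⊔ ℓ) where
    field
      subring : P.IsSubring S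
      diag    : ∀ a → S (ι a , ι a)
      vanish  : ∀ {x y} → S (x , y) → x ≈ 0# → y ≈ 0#
    open P.IsSubring subring public

    evalAt-∈² : ∀ q {x y} → S (x , y) → S (evalAt q x , evalAt q y)
    evalAt-∈² []      s = 0∈
    evalAt-∈² (a ∷ q) s = add (diag a) (mul s (evalAt-∈² q s))

    -- For x nonzero there is a relation a + x q(x) = 0 with a nonzero in K. Its image is a + y q(y)
    -- = 0, and y = 0 would force a = 0.
    vanish⁻¹ : ∀ {x y} → S (x , y) → y ≈ 0# → x ≈ 0#
    vanish⁻¹ {x} {y} s y≈0 with em {P = x ≈ 0#}
    ... | yes x≈0 = x≈0
    ... | no x≉0 with a , q , a≉0 , e ← relation-over-K x x≉0 = contradiction
      (ι-injective₀ (trans (sym (+-identityʳ _)) (trans (+-congˡ (sym (trans (*-congʳ y≈0) (zeroˡ _))))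
        (vanish (add (diag a) (mul s (evalAt-∈² q s))) e)))) a≉0

    functional : ∀ {x y x′ y′} → S (x , y) → S (x′ , y′) → x ≈ x′ → y ≈ y′
    functional s s′ x≈x′ = x∙y⁻¹≈ε⇒x≈y _ _
      (vanish (add s (neg s′)) (trans (+-congʳ x≈x′) (-‿inverseʳ _)))

    injective : ∀ {x y x′ y′} → S (x , y) → S (x′ , y′) → y ≈ y′ → x ≈ x′
    injective s s′ y≈y′ = x∙y⁻¹≈ε⇒x≈y _ _
      (vanish⁻¹ (add s (neg s′)) (trans (+-congʳ y≈y′) (-‿inverseʳ _)))

    dom : Pred Carrier (c′ ⊔ ℓ)
    dom x = ∃[ y ] S (x , y)

    dom-intermediate : IsIntermediate dom
    dom-intermediate = record
      { isSubring = record
        { 0∈ = _ , 0∈ ; 1∈ = _ , 1∈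
        ; add = λ (_ , s) (_ , s′) → _ , add s s′
        ; mul = λ (_ , s) (_ , s′) → _ , mul s s′
        ; neg = λ (_ , s) → _ , neg s
        ; resp = λ e (_ , s) → _ , resp (e , refl) s }
      ; const = λ a → _ , diag a }

    inverse-iso : IsPartialIso (λ (x , y) → S (y , x))
    inverse-iso = record
      { subring = record
        { 0∈ = 0∈ ; 1∈ = 1∈ ; add = add ; mul = mul ; neg = neg
        ; resp = λ (e , e′) → resp (e′ , e) }
      ; diag = diag ; vanish = vanish⁻¹ }

    -- The extension of L → L′ to L(x) → L′(x′), where x′ is a root of the transported minimal
    -- polynomial of x. It is well defined because a combination of 1, x, ..., x^{d-1} that vanishes
    -- has zero coefficients, whose images are zero as well.
    extend-by : ∀ {d} {μ : Fin d → Carrier × Carrier} {x x′} → (∀ i → S (μ i)) →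
      evalF (proj₁ ∘ μ) 1# x ≈ 0# → evalF (proj₂ ∘ μ) 1# x′ ≈ 0# → Independent dom x d →
      IsPartialIso (P.Span S (x , x′) d) × S ⊆ P.Span S (x , x′) d × P.Span S (x , x′) d (x , x′)
    extend-by {zero} μ∈ e e′ ind = contradiction e 1≉0
    extend-by {suc d} {μ} {x} {x′} μ∈ e e′ ind = record
      { subring = P.Span-isSubring subring μ∈ root
      ; diag    = λ a → P.Span-const subring μ∈ root (diag a)
      ; vanish  = vanishM } , P.Span-const subring μ∈ root , P.Span-gen subring μ∈ root
      where
      root = trans (reflexive (Product.evalF-proj₁ μ (1# , 1#) (x , x′))) e ,
             trans (reflexive (Product.evalF-proj₂ μ (1# , 1#) (x , x′))) e′
      vanishM : ∀ {y z} → P.Span S (x , x′) (suc d) (y , z) → y ≈ 0# → z ≈ 0#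
      vanishM (a , a∈ , ey , ez) y≈0 = trans ez
        (trans (reflexive (Product.evalF-proj₂ a (0# , 0#) (x , x′)))
          (evalF-zero x′ (λ i → vanish (a∈ i) (a₁≈0 i)) refl))
        where
        a₁≈0 = ind (proj₁ ∘ a) (λ i → _ , a∈ i)
          (trans (reflexive (≡.sym (Product.evalF-proj₁ a (0# , 0#) (x , x′)))) (trans (sym ey) y≈0))

    extend : ∀ x → ∃[ d ] ∃[ x′ ] let S′ = P.Span S (x , x′) d in
      IsPartialIso S′ × S ⊆ S′ × S′ (x , x′)
    extend x with minimal-polynomial dom-intermediate x
    ... | zero , dep , ind = contradiction dep (¬Dependent0 {L = dom} {x})
    ... | d@(suc _) , (μ , μ∈ , e) , ind with x′ , e′ ← root-of (λ i → proj₁ (μ∈ i))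
      = d , x′ , extend-by {μ = λ i → μ i , proj₁ (μ∈ i)} (λ i → proj₂ (μ∈ i)) e e′ ind

-- Linear algebra and degrees of extensions

module HomogeneousSystems (em : ∀ {ℓ} → ExcludedMiddle ℓ) {c ℓ₁ ℓ₂} (F : HeytingField c ℓ₁ ℓ₂) where
  open CommutativeRing (fieldRing F) hiding (zero)
  open RingProperties ring using (-‿distribˡ-*)
  open FieldProperties em F
  open SemiringSum semiring using (sum; sum-cong-≋; sum-remove; ∑-distrib-+; *-distribʳ-sum; sum-replicate-zero)

  some-nonzero : ∀ {n} {a : Fin n → Carrier} → ¬ (∀ i → a i ≈ 0#) → ∃[ i ] ¬ a i ≈ 0#
  some-nonzero {a = a} ¬all with em {P = ∃[ i ] ¬ a i ≈ 0#}
  ... | yes found = found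
  ... | no ¬found = contradiction all ¬all
    where
    all : ∀ i → a i ≈ 0#
    all i with em {P = a i ≈ 0#}
    ... | yes e = e
    ... | no e  = contradiction (i , e) ¬found

  -- Gaussian elimination of the unknown whose coefficient in the first equation is the pivot.
  nontrivial-solution : ∀ {n} m → m ℕ.< n → (A : Fin n → Fin m → Carrier) →
    Σ[ x ∈ (Fin n → Carrier) ] ¬ (∀ i → x i ≈ 0#) × (∀ j → sum (λ i → x i * A i j) ≈ 0#)
  nontrivial-solution {suc n} zero _ A = (λ _ → 1#) , (λ e → 1≉0 (e zero)) , λ ()
  nontrivial-solution {suc n} (suc m) (ℕ.s≤s m<n) A with em {P = ∀ i → A i zero ≈ 0#}
  ... | yes first≈0 with x , x≉0 , e ← nontrivial-solution m (ℕₚ.m<n⇒m<1+n m<n) (λ i → A i ∘ suc) =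
    x , x≉0 , λ
      { zero → trans (sum-cong-≋ (λ i → trans (*-congˡ (first≈0 i)) (zeroʳ (x i)))) (sum-replicate-zero (suc n))
      ; (suc j) → e j }
  ... | no first≉0
    with p , pivot≉0 ← some-nonzero first≉0
    with s , ps≈1 ← inverse (A p zero) pivot≉0
    with y , y≉0 , e ← nontrivial-solution m m<n
           -- The coefficient of yᵢ in a later equation after the first one has been solved for the
           -- unknown p, that is, after substituting - w / pivot for it.
           (λ i j → A (punchIn p i) (suc j) + (A (punchIn p i) zero * - s) * A p (suc j))
    = x , (λ x≈0 → y≉0 λ i → trans (reflexive (≡.sym (Vecₚ.insertAt-punchIn y p (w * - s) i))) (x≈0 (punchIn p i))) , λ
      { zero → begin
          sum (λ i → x i * A i zero)                    ≈⟨ expand zero ⟩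
          (w * - s) * A p zero + w                      ≈⟨ +-congʳ (trans (*-assoc w (- s) _) (*-congˡ (sym (-‿distribˡ-* s _)))) ⟩
          w * - (s * A p zero) + w                      ≈⟨ +-congʳ (*-congˡ (-‿cong (trans (*-comm s _) ps≈1))) ⟩
          w * - 1# + w                                  ≈⟨ +-congˡ (*-identityʳ w) ⟨
          w * - 1# + w * 1#                             ≈⟨ distribˡ w (- 1#) 1# ⟨
          w * (- 1# + 1#)                               ≈⟨ *-congˡ (-‿inverseˡ 1#) ⟩
          w * 0#                                        ≈⟨ zeroʳ w ⟩
          0#                                            ∎
      ; (suc j) → begin
          sum (λ i → x i * A i (suc j))                 ≈⟨ expand (suc j) ⟩
          (w * - s) * A p (suc j) + sum (λ i → y i * A (punchIn p i) (suc j))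
            ≈⟨ +-congʳ (trans (*-assoc w (- s) _) (*-distribʳ-sum (- s * A p (suc j)) (λ i → y i * A (punchIn p i) zero))) ⟩
          sum (λ i → (y i * A (punchIn p i) zero) * (- s * A p (suc j))) + sum (λ i → y i * A (punchIn p i) (suc j))
            ≈⟨ ∑-distrib-+ (λ i → (y i * A (punchIn p i) zero) * (- s * A p (suc j))) (λ i → y i * A (punchIn p i) (suc j)) ⟨
          sum (λ i → (y i * A (punchIn p i) zero) * (- s * A p (suc j)) + y i * A (punchIn p i) (suc j))
            ≈⟨ sum-cong-≋ (λ i → regroup (y i) (A (punchIn p i) zero) (- s) (A p (suc j)) (A (punchIn p i) (suc j))) ⟩
          sum (λ i → y i * (A (punchIn p i) (suc j) + (A (punchIn p i) zero * - s) * A p (suc j)))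
            ≈⟨ e j ⟩
          0# ∎ }
    where
    open SetoidReasoning setoid
    w = sum (λ i → y i * A (punchIn p i) zero)
    x : Fin (suc n) → Carrier
    x = insertAt y p (w * - s)
    expand : ∀ j → sum (λ i → x i * A i j) ≈ (w * - s) * A p j + sum (λ i → y i * A (punchIn p i) j)
    expand j = trans (sum-remove {i = p} (λ i → x i * A i j)) (+-cong
      (*-congʳ (reflexive (Vecₚ.insertAt-lookup y p (w * - s))))
      (sum-cong-≋ (λ i → *-congʳ (reflexive (Vecₚ.insertAt-punchIn y p (w * - s) i)))))
    regroup : ∀ y a q r b → (y * a) * (q * r) + y * b ≈ y * (b + (a * q) * r)
    regroup = solve 5 (λ y a q r b → (y :* a) :* (q :* r) :+ y :* b := y :* (b :+ (a :* q) :* r)) refl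
      where
      open RingSolver (fieldRing F)

module Degrees (em : ∀ {ℓ} → ExcludedMiddle ℓ) {c ℓ₁ ℓ₂ c′ ℓ₁′ ℓ₂′}
    (K : HeytingField c ℓ₁ ℓ₂) (K̄ : AlgebraicClosure K c′ ℓ₁′ ℓ₂′) where
  private
    module K = HeytingField K
    module KΣ = SemiringSum (CommutativeRing.semiring (fieldRing K))
  open AlgebraicClosure K̄
  open CommutativeRing (fieldRing closure) using (semiring)
  open SemiringSum semiring using (sum; sum-cong-≋; ∑-distrib-+; ∑-comm; *-distribˡ-sum; *-distribʳ-sum; sum-replicate-zero)
  open FieldProperties em closure
  open RingPolynomials (fieldRing closure)
  open Extensions K̄ hiding (base; gen; add; mul; neg; inv; resp)
  open ClosureProperties em K K̄
  open HomogeneousSystems em K using (nontrivial-solution)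
  open IsRingHomomorphism ι-hom using () renaming
    (⟦⟧-cong to ι-cong; 0#-homo to ι-0; 1#-homo to ι-1; +-homo to ι-+; *-homo to ι-*; -‿homo to ι-neg)

  ι-sum : ∀ {n} (a : Fin n → K.Carrier) → ι (KΣ.sum a) ≈ sum (ι ∘ a)
  ι-sum {zero}  a = ι-0
  ι-sum {suc n} a = trans (ι-+ _ _) (+-congˡ (ι-sum (a ∘ suc)))

  sum-zero : ∀ {n} (a : Fin n → Carrier) → (∀ i → a i ≈ 0#) → sum a ≈ 0#
  sum-zero {n} a e = trans (sum-cong-≋ e) (sum-replicate-zero n)

  sum-↑ : ∀ m {n} (a : Fin (m ℕ.+ n) → Carrier) → sum a ≈ sum (λ i → a (i ↑ˡ n)) + sum (λ j → a (m ↑ʳ j))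
  sum-↑ zero    a = sym (+-identityˡ _)
  sum-↑ (suc m) a = trans (+-congˡ (sum-↑ m (a ∘ suc))) (sym (+-assoc _ _ _))

  lincomb-∈ : ∀ {ℓ} {L : Pred Carrier ℓ} → IsIntermediate L → ∀ {d} (a : Fin d → K.Carrier) {b} →
    (∀ i → L (b i)) → L (linearCombination a b)
  lincomb-∈ isL {zero}  a b∈ = IsIntermediate.0∈ isL
  lincomb-∈ isL {suc d} a b∈ = L.add (L.mul (L.const (a zero)) (b∈ zero)) (lincomb-∈ isL (a ∘ suc) (b∈ ∘ suc))
    where module L = IsIntermediate isL

  -- Expressing b′ through b turns a linear relation among the d′ members of b′ into d homogeneous
  -- equations. With d < d′ these have a nontrivial solution, against the independence of b′.
  basis-≤ : ∀ {ℓ ℓ′} {L : Pred Carrier ℓ} {L′ : Pred Carrier ℓ′} {d d′} {b : Fin d → Carrier} {b′ : Fin d′ → Carrier} →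
    L′ ⊆ L → IsBasis L b → IsBasis L′ b′ → ¬ d ℕ.< d′
  basis-≤ {d = d} {d′} {b} {b′} L′⊆L B B′ d<d′ =
    let x , x≉0 , e = nontrivial-solution d d<d′ A in x≉0 (B′.independent x (dependence x e))
    where
    module B = IsBasis B
    module B′ = IsBasis B′
    A : Fin d′ → Fin d → K.Carrier
    A i = proj₁ (B.spanning (L′⊆L (B′.member i)))
    dependence : ∀ x → (∀ j → KΣ.sum (λ i → x i K.* A i j) K.≈ K.0#) → linearCombination x b′ ≈ 0#
    dependence x e = begin
      sum (λ i → ι (x i) * b′ i)
        ≈⟨ sum-cong-≋ {d′} (λ i → trans (*-congˡ (proj₂ (B.spanning (L′⊆L (B′.member i)))))
                               (*-distribˡ-sum (ι (x i)) (λ j → ι (A i j) * b j))) ⟩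
      sum (λ i → sum (λ j → ι (x i) * (ι (A i j) * b j)))
        ≈⟨ ∑-comm (λ i j → ι (x i) * (ι (A i j) * b j)) ⟩
      sum (λ j → sum (λ i → ι (x i) * (ι (A i j) * b j)))
        ≈⟨ sum-zero {d} _ (λ j → begin
             sum (λ i → ι (x i) * (ι (A i j) * b j))
               ≈⟨ sum-cong-≋ {d′} (λ i → trans (sym (*-assoc (ι (x i)) (ι (A i j)) (b j))) (*-congʳ (sym (ι-* (x i) (A i j))))) ⟩
             sum (λ i → ι (x i K.* A i j) * b j)   ≈⟨ *-distribʳ-sum (b j) (λ i → ι (x i K.* A i j)) ⟨
             sum (λ i → ι (x i K.* A i j)) * b j   ≈⟨ *-congʳ (ι-sum (λ i → x i K.* A i j)) ⟨
             ι (KΣ.sum (λ i → x i K.* A i j)) * b j ≈⟨ *-congʳ (trans (ι-cong (e j)) ι-0) ⟩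
             0# * b j                              ≈⟨ zeroˡ (b j) ⟩
             0# ∎) ⟩
      0# ∎
      where open SetoidReasoning setoid

  degree-unique : ∀ {ℓ ℓ′} {L : Pred Carrier ℓ} {L′ : Pred Carrier ℓ′} {d d′} → L ≐ L′ →
    HasDegreeOverBase L d → HasDegreeOverBase L′ d′ → d ≡ d′
  degree-unique (L⊆L′ , L′⊆L) (_ , B) (_ , B′) =
    ℕₚ.≤-antisym (ℕₚ.≮⇒≥ (basis-≤ L⊆L′ B′ B)) (ℕₚ.≮⇒≥ (basis-≤ L′⊆L B B′))

  degree-resp : ∀ {ℓ ℓ′} {L : Pred Carrier ℓ} {L′ : Pred Carrier ℓ′} {d} → L ≐ L′ →
    HasDegreeOverBase L d → HasDegreeOverBase L′ d
  degree-resp (L⊆L′ , L′⊆L) (b , B) = b , record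
    { member = L⊆L′ ∘ member ; independent = independent ; spanning = spanning ∘ L′⊆L }
    where open IsBasis B

  -- The elements xʲ bᵢ with j < d, grouped by j.
  powers-basis : ∀ {D} → (Fin D → Carrier) → Carrier → ∀ d → Fin (d ℕ.* D) → Carrier
  powers-basis {D} b x (suc d) i = [ b , (λ i′ → x * powers-basis b x d i′) ]′ (splitAt D i)

  -- Row j collects the coefficients of the elements xʲ bᵢ, so that it represents the coefficient of
  -- xʲ in L.
  rows : ∀ {a} {A : Set a} {D} d → (Fin (d ℕ.* D) → A) → Fin d → Fin D → A
  rows {D = D} (suc d) a zero    i = a (i ↑ˡ (d ℕ.* D))
  rows {D = D} (suc d) a (suc j) = rows d (λ i → a (D ↑ʳ i)) j

  module _ {D : ℕ} (b : Fin D → Carrier) (x : Carrier) where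
    lincomb-split : ∀ d (a : Fin (suc d ℕ.* D) → K.Carrier) →
      linearCombination a (powers-basis b x (suc d)) ≈
      linearCombination (λ i → a (i ↑ˡ (d ℕ.* D))) b + x * linearCombination (λ i → a (D ↑ʳ i)) (powers-basis b x d)
    lincomb-split d a = trans (sum-↑ D _) (+-cong
      (sum-cong-≋ {D} (λ i → *-congˡ {ι (a (i ↑ˡ (d ℕ.* D)))} (reflexive (≡.cong [ b , (λ i′ → x * powers-basis b x d i′) ]′ (Finₚ.splitAt-↑ˡ D i (d ℕ.* D))))))
      (trans (sum-cong-≋ {d ℕ.* D} (λ i → trans
          (*-congˡ {ι (a (D ↑ʳ i))} (reflexive (≡.cong [ b , (λ i′ → x * powers-basis b x d i′) ]′ (Finₚ.splitAt-↑ʳ D (d ℕ.* D) i))))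
          (move (ι (a (D ↑ʳ i))) x (powers-basis b x d i))))
        (sym (*-distribˡ-sum x (λ i → ι (a (D ↑ʳ i)) * powers-basis b x d i)))))
      where
      move : ∀ p q r → p * (q * r) ≈ q * (p * r)
      move p q r = trans (sym (*-assoc p q r)) (trans (*-congʳ (*-comm p q)) (*-assoc q p r))

    lincomb-powers : ∀ d (a : Fin (d ℕ.* D) → K.Carrier) →
      linearCombination a (powers-basis b x d) ≈ evalF (λ j → linearCombination (rows d a j) b) 0# x
    lincomb-powers zero    a = refl
    lincomb-powers (suc d) a =
      trans (lincomb-split d a) (+-congˡ (*-congˡ (lincomb-powers d (λ i → a (D ↑ʳ i)))))

    rows-zero : ∀ d (a : Fin (d ℕ.* D) → K.Carrier) → (∀ j i → rows d a j i K.≈ K.0#) → ∀ k → a k K.≈ K.0#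
    rows-zero (suc d) a e k with splitAt D k in eq
    ... | inj₁ i = ≡.subst (λ k → a k K.≈ K.0#) (Finₚ.splitAt⁻¹-↑ˡ eq) (e zero i)
    ... | inj₂ i = ≡.subst (λ k → a k K.≈ K.0#) (Finₚ.splitAt⁻¹-↑ʳ eq) (rows-zero d _ (e ∘ suc) i)

    powers-span : ∀ {ℓ} {L : Pred Carrier ℓ} → IsBasis L b → ∀ d (a : Fin d → Carrier) → (∀ j → L (a j)) →
      ∃[ r ] evalF a 0# x ≈ linearCombination r (powers-basis b x d)
    powers-span B zero a a∈ = (λ ()) , refl
    powers-span B (suc d) a a∈ =
      let r₀ , e₀ = IsBasis.spanning B (a∈ zero)
          r , e = powers-span B d (a ∘ suc) (a∈ ∘ suc)
          s = λ i → [ r₀ , r ]′ (splitAt D i)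
      in s , trans (+-cong
               (trans e₀ (sum-cong-≋ {D} (λ i → *-congʳ {b i} (ι-cong (K.reflexive (≡.cong [ r₀ , r ]′ (≡.sym (Finₚ.splitAt-↑ˡ D i (d ℕ.* D)))))))))
               (*-congˡ (trans e (sum-cong-≋ {d ℕ.* D} (λ i → *-congʳ {powers-basis b x d i} (ι-cong (K.reflexive (≡.cong [ r₀ , r ]′ (≡.sym (Finₚ.splitAt-↑ʳ D (d ℕ.* D) i))))))))))
             (sym (lincomb-split d s))

    powers-∈ : ∀ {ℓ} {L : Pred Carrier ℓ} → IsIntermediate L → (∀ i → L (b i)) → L x → ∀ d k → L (powers-basis b x d k)
    powers-∈ isL b∈ x∈ (suc d) k with splitAt D k
    ... | inj₁ i = b∈ i
    ... | inj₂ i = IsIntermediate.mul isL x∈ (powers-∈ isL b∈ x∈ d i)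

  -- The multiplicativity of degrees. A relation among the xʲ bᵢ is first read over L, as a
  -- polynomial in x whose coefficients must vanish, and then over K, row by row.
  degree-tower : ∀ {ℓ ℓ′} {L : Pred Carrier ℓ} {L′ : Pred Carrier ℓ′} → IsIntermediate L → IsIntermediate L′ →
    ∀ {D x d} → HasDegreeOverBase L D → Independent L x d →
    L ⊆ L′ → L′ x → L′ ⊆ Span L x d → HasDegreeOverBase L′ (d ℕ.* D)
  degree-tower isL isL′ {D} {x} {d} (b , B) ind L⊆L′ x∈ L′⊆span = powers-basis b x d , record
    { member = powers-∈ b x isL′ (λ i → L⊆L′ (B.member i)) x∈ d
    ; independent = λ a e → rows-zero b x d a (λ j → B.independent (rows d a j)
        (ind (λ j → linearCombination (rows d a j) b) (λ j → lincomb-∈ isL (rows d a j) B.member)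
          (trans (sym (lincomb-powers b x d a)) e) j))
    ; spanning = λ y∈ → let a , a∈ , y≈ = L′⊆span y∈
                            r , e = powers-span b x B d a a∈ in r , trans y≈ e
    }
    where module B = IsBasis B

  degree-base : ∀ {ℓ} {L : Pred Carrier ℓ} → IsIntermediate L → (∀ {x} → L x → ∃[ a ] x ≈ ι a) → HasDegreeOverBase L 1
  degree-base isL L⊆K = (λ _ → 1#) , record
    { member = λ _ → IsIntermediate.1∈ isL
    ; independent = λ { a e zero → ι-injective₀ (trans (sym (trans (+-identityʳ _) (*-identityʳ _))) e) }
    ; spanning = λ x∈ → let a , e = L⊆K x∈ in (λ _ → a) , trans e (sym (trans (+-identityʳ _) (*-identityʳ _)))
    }

  constants : IsIntermediate (λ x → ∃[ a ] x ≈ ι a)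
  constants = record
    { isSubring = record
      { 0∈ = _ , sym ι-0 ; 1∈ = _ , sym ι-1
      ; add = λ (_ , e) (_ , e′) → _ , trans (+-cong e e′) (sym (ι-+ _ _))
      ; mul = λ (_ , e) (_ , e′) → _ , trans (*-cong e e′) (sym (ι-* _ _))
      ; neg = λ (_ , e) → _ , trans (-‿cong e) (sym (ι-neg _))
      ; resp = λ x≈y (_ , e) → _ , trans (sym x≈y) e }
    ; const = λ a → a , refl }

-- Finite sequences as initial segments of functions on ℕ

module _ {a} {A : Set a} where
  -- Tuples are functions on ℕ of which only the terms below a bound count. Passing to a prefix then
  -- changes the bound alone, and the terms beyond it are arbitrary.
  snoc : (ℕ → A) → ℕ → A → ℕ → A
  snoc β j x i with i ℕₚ.≟ j
  ... | yes _ = x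
  ... | no _  = β i

  snoc-last : ∀ (β : ℕ → A) j x → snoc β j x j ≡ x
  snoc-last β j x with j ℕₚ.≟ j
  ... | yes _  = ≡.refl
  ... | no j≢j = contradiction ≡.refl j≢j

  snoc-init : ∀ (β : ℕ → A) j x {i} → i ℕ.< j → snoc β j x i ≡ β i
  snoc-init β j x {i} i<j with i ℕₚ.≟ j
  ... | yes ≡.refl = contradiction i<j (ℕₚ.<-irrefl ≡.refl)
  ... | no _       = ≡.refl

<suc-cases : ∀ {p} {P : Set p} {i j} → i ℕ.< suc j → (i ℕ.< j → P) → (i ≡ j → P) → P
<suc-cases i<1+j below equal with ℕₚ.m<1+n⇒m<n∨m≡n i<1+j
... | inj₁ i<j = below i<j
... | inj₂ i≡j = equal i≡j

padding : ∀ {a} {A : Set a} {k} → A → (Fin k → A) → ℕ → A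
padding {k = k} x g i with i ℕₚ.<? k
... | yes i<k = g (fromℕ< i<k)
... | no _    = x

padding-< : ∀ {a} {A : Set a} {k} (x : A) (g : Fin k → A) {i} (i<k : i ℕ.< k) → padding x g i ≡ g (fromℕ< i<k)
padding-< {k = k} x g {i} i<k with i ℕₚ.<? k
... | yes i<k′ = ≡.cong g (Finₚ.fromℕ<-cong i i ≡.refl i<k′ i<k)
... | no i≮k   = contradiction i<k i≮k

-- Roots of a separable polynomial

module SeparablePolynomial (em : ∀ {ℓ} → ExcludedMiddle ℓ) {c ℓ₁ ℓ₂ c′ ℓ₁′ ℓ₂′}
    (K : HeytingField c ℓ₁ ℓ₂) (K̄ : AlgebraicClosure K c′ ℓ₁′ ℓ₂′)
    (f : Polynomial.Poly (fieldRawRing K)) (n-1 : ℕ)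
    (separable : Polynomial.Separable (fieldRawRing K) f)
    (degree : Polynomial.HasDegree (fieldRawRing K) f (suc n-1)) where
  private
    module K = HeytingField K
    module KX = Polynomial (fieldRawRing K)
    module KF = FieldProperties em K
  open AlgebraicClosure K̄
  open CommutativeRing (fieldRing closure) using (ring)
  open RingProperties ring using (+-inverseʳ-unique)
  open FieldProperties em closure
  open RingPolynomials (fieldRing closure)
  open Extensions K̄ hiding (base; gen; add; mul; neg; inv; resp)
  open ClosureProperties em K K̄
  open Roots K̄ f
  open IsRingHomomorphism ι-hom using () renaming
    (⟦⟧-cong to ι-cong; 0#-homo to ι-0; 1#-homo to ι-1; +-homo to ι-+; *-homo to ι-*)
  private
    module Dual = DualNumbers (fieldRing closure)
    module D = RingPolynomials Dual.dualNumbers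

  n : ℕ
  n = suc n-1

  private
    lc = KX.coeff f n
    lc⁻¹ = proj₁ (KF.inverse lc (proj₁ degree))
    lc-inv = proj₂ (KF.inverse lc (proj₁ degree))
    ιlc≉0 : ¬ ι lc ≈ 0#
    ιlc≉0 = proj₁ degree ∘ ι-injective₀

  -- evalF (quot a 1# α) 1# α is the derivative at α, also when α is not a root.
  SimpleRoots : ∀ {d} → (Fin (suc d) → Carrier) → Set _
  SimpleRoots a = ∀ α → evalF a 1# α ≈ 0# → ¬ evalF (quot a 1# α) 1# α ≈ 0#

  private
    φ° : Fin n → K.Carrier
    φ° i = lc⁻¹ K.* KX.coeff f (toℕ i)

    evalAt-monic° : ∀ x → evalAt f x ≈ ι lc * evalF (ι ∘ φ°) 1# x
    evalAt-monic° = ι-Evaluation.eval-monic ι-1 f n lc⁻¹ lc-inv (proj₂ degree)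

    root⇒F° : ∀ {x} → IsRoot x → evalF (ι ∘ φ°) 1# x ≈ 0#
    root⇒F° {x} e = ≉0⇒regular ιlc≉0 _ (trans (sym (evalAt-monic° x)) e)

    F⇒root° : ∀ {x} → evalF (ι ∘ φ°) 1# x ≈ 0# → IsRoot x
    F⇒root° {x} e = trans (evalAt-monic° x) (trans (*-congˡ e) (zeroʳ _))

    -- At a double root both f and f′ would vanish, which contradicts u f + v f′ = 1.
    F-simple° : SimpleRoots (ι ∘ φ°)
    F-simple° α Fα≈0 F′α≈0 = 1≉0 (begin
      1#                                                    ≈⟨ ι-1 ⟨
      ι K.1#                                                ≈⟨ trans (+-congˡ (zeroʳ α)) (+-identityʳ _) ⟨
      evalAt KX.1ₚ α                                        ≈⟨ eval-cong ι-+ (u KX.*ₚ f KX.+ₚ v KX.*ₚ f′) KX.1ₚ α (proj₂ (proj₂ separable)) ⟨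
      evalAt (u KX.*ₚ f KX.+ₚ v KX.*ₚ f′) α                 ≈⟨ eval-+ ι-+ (u KX.*ₚ f) (v KX.*ₚ f′) α ⟩
      evalAt (u KX.*ₚ f) α + evalAt (v KX.*ₚ f′) α          ≈⟨ +-cong (eval-* ι-+ u f α) (eval-* ι-+ v f′ α) ⟩
      evalAt u α * evalAt f α + evalAt v α * evalAt f′ α    ≈⟨ +-cong (*-congˡ (F⇒root° Fα≈0)) (*-congˡ f′α≈0) ⟩
      evalAt u α * 0# + evalAt v α * 0#                     ≈⟨ +-cong (zeroʳ _) (zeroʳ _) ⟩
      0# + 0#                                               ≈⟨ +-identityˡ 0# ⟩
      0#                                                    ∎)
      where
      open SetoidReasoning setoid
      open ι-Evaluation
      f′ = KX.derivative f
      u = proj₁ separable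
      v = proj₁ (proj₂ separable)
      module δ = ListEvaluation (fieldRing K) Dual.dualNumbers (λ a → ι a , 0#)
        (λ e → ι-cong e , refl) (ι-0 , refl)
        (λ a b → ι-* a b , sym (trans (+-cong (zeroʳ _) (zeroˡ _)) (+-identityˡ 0#)))
      -- Let F be the monic multiple of f. The equation f = lc · F persists over the dual numbers,
      -- and at α + ε the ε-parts of its sides are f′(α) and lc · F′(α).
      f′α≈0 : evalAt f′ α ≈ 0#
      f′α≈0 = begin
        evalAt f′ α ≈⟨ eval-dual-proj₂ ι-+ f α ⟨
        proj₂ (δ.eval f (α , 1#)) ≈⟨ proj₂ (δ.eval-monic (ι-1 , refl) f n lc⁻¹ lc-inv (proj₂ degree) (α , 1#)) ⟩
        ι lc * proj₂ (D.evalF (λ i → ι (φ° i) , 0#) (1# , 0#) (α , 1#)) + 0# * _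
          ≈⟨ +-cong (*-congˡ (trans (Dual.evalF-proj₂ (ι ∘ φ°) 1# α) F′α≈0)) (zeroˡ _) ⟩
        ι lc * 0# + 0# ≈⟨ trans (+-identityʳ _) (zeroʳ _) ⟩
        0# ∎

  -- f = lc · (φ₀ + φ₁ X + … + X^n). Opaque, as only these properties are needed and unfolding the
  -- inverse of lc is costly.
  abstract
    φ : Fin n → K.Carrier
    φ = φ°

    root⇒F : ∀ {x} → IsRoot x → evalF (ι ∘ φ) 1# x ≈ 0#
    root⇒F = root⇒F°

    F⇒root : ∀ {x} → evalF (ι ∘ φ) 1# x ≈ 0# → IsRoot x
    F⇒root = F⇒root°

    F-simple : SimpleRoots (ι ∘ φ)
    F-simple = F-simple°

  root-resp : ∀ {x y} → x ≈ y → IsRoot x → IsRoot y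
  root-resp x≈y e = F⇒root (trans (evalF-congˣ (ι ∘ φ) 1# (sym x≈y)) (root⇒F e))

  -- If α were a double root of μ, reducing F modulo μ at α + ε would leave a polynomial of degree
  -- below that of μ with root α. It is zero by independence, so F′(α) = 0, although F has simple
  -- roots.
  minimal-simple : ∀ {ℓ} {L : Pred Carrier ℓ} → IsIntermediate L → ∀ {d α} → IsRoot α →
    (dep : Dependent L α (suc d)) → Independent L α (suc d) → ¬ evalF (quot (proj₁ dep) 1# α) 1# α ≈ 0#
  minimal-simple isL {d} {α} α-root (μ , μ∈ , e) ind e′
    = let a , a∈ , eq , vanishing = Dual.reduce-double-root (isSubring isL) μ μ∈ e e′ (ι ∘ φ) (const isL ∘ φ) in
      F-simple α (root⇒F α-root) (vanishing (ind a a∈ (trans (sym eq) (root⇒F α-root))))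

  -- Any root of μ / (X - α) will do: it differs from α since α is a simple root of μ.
  other-root : ∀ {ℓ} {L : Pred Carrier ℓ} → IsIntermediate L → ∀ {d α} → IsRoot α →
    (dep : Dependent L α (suc (suc d))) → Independent L α (suc (suc d)) →
    ∃[ α′ ] ¬ α′ ≈ α × evalF (proj₁ dep) 1# α′ ≈ 0#
  other-root isL {d} {α} α-root dep@(μ , μ∈ , e) ind with α′ , e′ ← root-of (quot μ 1# α) =
    α′ , (λ α′≈α → minimal-simple isL α-root dep ind (trans (evalF-congˣ (quot μ 1# α) 1# (sym α′≈α)) e′)) ,
    trans (factor-root μ 1# α α′ e) (trans (*-congˡ e′) (zeroʳ _))

  record Distinct {p} (P : Pred Carrier p) (β : ℕ → Carrier) (j : ℕ) : Set (c′ ⊔ ℓ₁′ ⊔ p) where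
    field
      holds   : ∀ {i} → i ℕ.< j → P (β i)
      differ< : ∀ {i i′} → i ℕ.< i′ → i′ ℕ.< j → ¬ β i ≈ β i′

    differ : ∀ {i i′} → i ℕ.< j → i′ ℕ.< j → ¬ i ≡ i′ → ¬ β i ≈ β i′
    differ {i} {i′} i<j i′<j i≢i′ e with ℕₚ.<-cmp i i′
    ... | tri< i<i′ _ _ = differ< i<i′ i′<j e
    ... | tri≈ _ i≡i′ _ = i≢i′ i≡i′
    ... | tri> _ _ i′<i = differ< i′<i i<j (sym e)

    injective : ∀ {i i′} → i ℕ.< j → i′ ℕ.< j → β i ≈ β i′ → i ≡ i′
    injective {i} {i′} i<j i′<j e with i ℕₚ.≟ i′
    ... | yes i≡i′ = i≡i′
    ... | no i≢i′  = contradiction e (differ i<j i′<j i≢i′)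

    prefix : ∀ {j′} → j′ ℕ.≤ j → Distinct P β j′
    prefix j′≤j = record
      { holds = λ i<j′ → holds (ℕₚ.<-≤-trans i<j′ j′≤j)
      ; differ< = λ i<i′ i′<j′ → differ< i<i′ (ℕₚ.<-≤-trans i′<j′ j′≤j) }

  open Distinct public using (holds; differ<; differ; prefix)

  Distinct-snoc : ∀ {p} {P : Pred Carrier p} {β j x} → Distinct P β j → P x →
    (∀ {i} → i ℕ.< j → ¬ β i ≈ x) → Distinct P (snoc β j x) (suc j)
  Distinct-snoc {P = P} {β} {j} {x} dβ Px fresh = record
    { holds = λ i<1+j → <suc-cases i<1+j
        (λ i<j → ≡.subst P (≡.sym (snoc-init β j x i<j)) (holds dβ i<j))
        λ { ≡.refl → ≡.subst P (≡.sym (snoc-last β j x)) Px }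
    ; differ< = λ i<i′ i′<1+j e → <suc-cases i′<1+j
        (λ i′<j → differ< dβ i<i′ i′<j
          (trans (reflexive (≡.sym (snoc-init β j x (ℕₚ.<-trans i<i′ i′<j))))
            (trans e (reflexive (snoc-init β j x i′<j)))))
        λ { ≡.refl → fresh i<i′ (trans (reflexive (≡.sym (snoc-init β j x i<i′)))
                                  (trans e (reflexive (snoc-last β j x)))) } }

  Distinct-map : ∀ {p q} {P : Pred Carrier p} {Q : Pred Carrier q} {β j} → P ⊆ Q → Distinct P β j → Distinct Q β j
  Distinct-map P⊆Q dβ = record { holds = P⊆Q ∘ holds dβ ; differ< = differ< dβ }

  -- Division of F by the linear factors of j of its roots.
  F-deflate : ∀ {ℓ} {L : Pred Carrier ℓ} → IsIntermediate L → ∀ {β j m} → j ℕ.+ m ≡ n →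
    Distinct IsRoot β j → (∀ {i} → i ℕ.< j → L (β i)) →
    ∃[ a ] (∀ (i : Fin m) → L (a i)) ×
      (∀ {z} → IsRoot z → (∀ {i} → i ℕ.< j → ¬ z ≈ β i) → evalF a 1# z ≈ 0#)
  F-deflate isL {β} {j} {m} eq dβ β∈
    with a , a∈ , rest ← deflate (isSubring isL) (λ i → const isL (φ i)) (IsIntermediate.1∈ isL) β j m eq β∈
           (root⇒F ∘ holds dβ) (λ i<i′ i′<j → ≉⇒regular (differ< dβ i<i′ i′<j ∘ sym))
    = a , a∈ , λ z-root z≉ → rest _ (≉⇒regular ∘ z≉) (root⇒F z-root)

  Zero : ∀ {d} → (Fin d → Carrier) → Pred Carrier ℓ₁′
  Zero a x = evalF a 1# x ≈ 0#

  -- Dividing off d of the roots leaves the constant 1, which would have to vanish at the one that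
  -- remains.
  root-bound : ∀ {d} (a : Fin d → Carrier) {β} → ¬ Distinct (Zero a) β (suc d)
  root-bound {d} a {β} dβ
    with _ , _ , rest ← deflate {S = λ _ → ⊤} _ {c = a} {1#} _ _ β d 0 (ℕₚ.+-identityʳ d) _
           (λ i<d → holds dβ (ℕₚ.m<n⇒m<1+n i<d))
           (λ i<i′ i′<d → ≉⇒regular (differ< dβ i<i′ (ℕₚ.m<n⇒m<1+n i′<d) ∘ sym))
    = 1≉0 (rest (β d) (λ i<d → ≉⇒regular (differ< dβ i<d ℕₚ.≤-refl ∘ sym)) (holds dβ ℕₚ.≤-refl))

  -- Here x occurs both in the quotient and as the argument. Reading the derivative as the ε-part of
  -- a value at x + ε leaves a single occurrence.
  quot-congˣ : ∀ {d} (a : Fin (suc d) → Carrier) {x y} → x ≈ y →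
    evalF (quot a 1# x) 1# x ≈ evalF (quot a 1# y) 1# y
  quot-congˣ a {x} {y} x≈y = trans (sym (Dual.evalF-proj₂ a 1# x))
    (trans (proj₂ (D.evalF-congˣ (λ i → a i , 0#) (1# , 0#) (x≈y , refl))) (Dual.evalF-proj₂ a 1# y))

  quot-quot′ : ∀ {d} (a : Fin (suc (suc d)) → Carrier) γ α →
    evalF (quot a 1# α) 1# α ≈ evalF (quot a 1# γ) 1# α + (α - γ) * evalF (quot (quot a 1# γ) 1# α) 1# α
  quot-quot′ a γ α = trans (quot-congˣ a (split α γ)) (trans (quot-quot a 1# γ (α - γ))
    (+-cong (evalF-congˣ (quot a 1# γ) 1# (sym (split α γ))) (*-congˡ (quot-congˣ (quot a 1# γ) (sym (split α γ))))))

  -- From p = (X - γ) q follows p′(α) = q(α) + (α - γ) q′(α), so a double root of q is one of p.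
  quot-simple : ∀ {d} (a : Fin (suc (suc d)) → Carrier) {γ} → Zero a γ → SimpleRoots a →
    SimpleRoots (quot a 1# γ)
  quot-simple a {γ} e simple α q≈0 q′≈0 = simple α
    (trans (factor-root a 1# γ α e) (trans (*-congˡ q≈0) (zeroʳ _)))
    (trans (quot-quot′ a γ α) (trans (+-cong q≈0 (trans (*-congˡ q′≈0) (zeroʳ _))) (+-identityˡ 0#)))

  cons : Carrier → (ℕ → Carrier) → ℕ → Carrier
  cons γ β zero    = γ
  cons γ β (suc i) = β i

  Distinct-cons : ∀ {p} {P : Pred Carrier p} {γ β j} → P γ → Distinct P β j →
    (∀ {i} → i ℕ.< j → ¬ γ ≈ β i) → Distinct P (cons γ β) (suc j)
  Distinct-cons {P = P} {γ} {β} {j} Pγ dβ fresh = record { holds = holds′ ; differ< = differ′ }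
    where
    holds′ : ∀ {i} → i ℕ.< suc j → P (cons γ β i)
    holds′ {zero}  _           = Pγ
    holds′ {suc i} (ℕ.s≤s i<j) = holds dβ i<j
    differ′ : ∀ {i i′} → i ℕ.< i′ → i′ ℕ.< suc j → ¬ cons γ β i ≈ cons γ β i′
    differ′ {zero}  {suc i′} _ (ℕ.s≤s i′<j) = fresh i′<j
    differ′ {suc i} {suc i′} (ℕ.s≤s i<i′) (ℕ.s≤s i′<j) = differ< dβ i<i′ i′<j

  -- A root γ is split off and the quotient q is treated recursively. The roots of q differ from γ,
  -- as q(γ) = p′(γ) is nonzero.
  simple⇒distinct : ∀ d (a : Fin (suc d) → Carrier) → SimpleRoots a → ∃[ β ] Distinct (Zero a) β (suc d)
  simple⇒distinct zero a simple =
    let γ , e = root-of a in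
    cons γ (λ _ → γ) , Distinct-cons e record { holds = λ () ; differ< = λ _ () } (λ ())
  simple⇒distinct (suc d) a simple =
    let γ , e = root-of a
        β , dβ = simple⇒distinct d (quot a 1# γ) (quot-simple a e simple) in
    cons γ β , Distinct-cons e
      (Distinct-map (λ {x} qx≈0 → trans (factor-root a 1# γ x e) (trans (*-congˡ qx≈0) (zeroʳ _))) dβ)
      (λ i<d γ≈β → simple γ e (trans (evalF-congˣ (quot a 1# γ) 1# γ≈β) (holds dβ i<d)))

  private
    roots-of-F = simple⇒distinct n-1 (ι ∘ φ) F-simple

  abstract
    root : ℕ → Carrier
    root = proj₁ roots-of-F

    root-distinct : Distinct IsRoot root n
    root-distinct = Distinct-map F⇒root (proj₂ roots-of-F)

  root-cover : ∀ {x} → IsRoot x → ∃[ i ] i ℕ.< n × root i ≈ x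
  root-cover {x} x-root with em {P = ∃[ i ] i ℕ.< n × root i ≈ x}
  ... | yes found = found
  ... | no ¬found = contradiction
    (Distinct-map root⇒F (Distinct-snoc root-distinct x-root (λ i<n e → ¬found (_ , i<n , e))))
    (root-bound (ι ∘ φ))

  cover-size : ∀ (β : ℕ → Carrier) {j} → (∀ (i : Fin n) → ∃[ i′ ] i′ ℕ.< j × β i′ ≈ root (toℕ i)) → ¬ j ℕ.< n
  cover-size β hit j<n
    with i , i′ , i<i′ , e ← Finₚ.pigeonhole j<n (λ i → fromℕ< (proj₁ (proj₂ (hit i))))
    = differ< root-distinct i<i′ (Finₚ.toℕ<n i′)
        (trans (sym (proj₂ (proj₂ (hit i))))
          (trans (reflexive (≡.cong β (Finₚ.fromℕ<-injective _ _ _ _ e))) (proj₂ (proj₂ (hit i′)))))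

  fresh-root : ∀ (β : ℕ → Carrier) j → j ℕ.< n → ∃[ x ] IsRoot x × (∀ {i} → i ℕ.< j → ¬ β i ≈ x)
  fresh-root β j j<n with em {P = ∃[ x ] IsRoot x × (∀ {i} → i ℕ.< j → ¬ β i ≈ x)}
  ... | yes found = found
  ... | no ¬found = contradiction j<n (cover-size β hit)
    where
    hit : ∀ (i : Fin n) → ∃[ i′ ] i′ ℕ.< j × β i′ ≈ root (toℕ i)
    hit i with em {P = ∃[ i′ ] i′ ℕ.< j × β i′ ≈ root (toℕ i)}
    ... | yes hits = hits
    ... | no none  = contradiction
      (root (toℕ i) , holds root-distinct (Finₚ.toℕ<n i) , λ {i′} i′<j e → none (i′ , i′<j , e)) ¬found

  extend-distinct : ∀ {β j} k → Distinct IsRoot β j → j ℕ.≤ k → k ℕ.≤ n →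
    ∃[ γ ] Distinct IsRoot γ k × (∀ {i} → i ℕ.< j → γ i ≡ β i)
  extend-distinct {β} {j} k dβ j≤k k≤n with ℕₚ.m≤n⇒m<n∨m≡n j≤k
  ... | inj₂ ≡.refl = β , dβ , λ _ → ≡.refl
  extend-distinct {β} {j} (suc k) dβ _ k<n | inj₁ (ℕ.s≤s j≤k)
    with γ , dγ , agree ← extend-distinct k dβ j≤k (ℕₚ.<⇒≤ k<n)
    with x , x-root , x-fresh ← fresh-root γ k k<n
    = snoc γ k x , Distinct-snoc dγ x-root x-fresh ,
      λ i<j → ≡.trans (snoc-init γ k x (ℕₚ.<-≤-trans i<j j≤k)) (agree i<j)

  -- Large enough that `Span` over a relation of this level has this level again, so that
  -- isomorphisms can be extended by recursion.
  Λ : Level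
  Λ = c ⊔ c′ ⊔ ℓ₁′

  SF : IsIntermediate SplittingField
  SF = Adjoin-intermediate IsRoot

  module _ {ℓ} {S : Pred (Carrier × Carrier) ℓ} (isS : IsPartialIso S) where
    open IsPartialIso isS

    maps-root : ∀ {x y} → S (x , y) → IsRoot x → IsRoot y
    maps-root s = vanish (evalAt-∈² f s)

    -- Since roots go to roots, this field contains all roots as soon as they lie in the domain.
    -- Then it contains K_f, and K_f is mapped into itself.
    maps-into-SF : IsIntermediate (λ x → ∃[ y ] S (x , y) × SplittingField y)
    maps-into-SF = record
      { isSubring = record
        { 0∈ = _ , 0∈ , SF.0∈ ; 1∈ = _ , 1∈ , SF.1∈
        ; add = λ (_ , s , p) (_ , s′ , p′) → _ , add s s′ , SF.add p p′
        ; mul = λ (_ , s , p) (_ , s′ , p′) → _ , mul s s′ , SF.mul p p′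
        ; neg = λ (_ , s , p) → _ , neg s , SF.neg p
        ; resp = λ e (_ , s , p) → _ , resp (e , refl) s , p }
      ; const = λ a → _ , diag a , const SF a }
      where module SF = IsIntermediate SF

    abstract
      image : (∀ {x} → IsRoot x → dom x) → ∀ {x} → SplittingField x → ∃[ y ] S (x , y) × SplittingField y
      image total = Adjoin-least maps-into-SF λ x-root →
        let y , s = total x-root in y , s , Adjoin.gen (maps-root s x-root)

  module _ {ℓ} {S : Pred (Carrier × Carrier) ℓ} (isS : IsPartialIso S) where
    open IsPartialIso isS

    automorphism : (∀ {x} → IsRoot x → dom x) → (∀ {x} → IsRoot x → IsPartialIso.dom inverse-iso x) →
      ∃[ σ ] (∀ {x y} → S (x , y) → (p : SplittingField x) → proj₁ (Automorphism.to {B = IsRoot} σ (x , p)) ≈ y)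
    automorphism total total⁻¹ = record
      { to = to
      ; isIsomorphism = record
        { isRingMonomorphism = record
          { isRingHomomorphism = record
            { isSemiringHomomorphism = record
              { isNearSemiringHomomorphism = record
                { +-isMonoidHomomorphism = record
                  { isMagmaHomomorphism = record
                    { isRelHomomorphism = record { cong = λ {x} {y} e → functional (to-∈ x) (to-∈ y) e }
                    ; homo = λ x y → functional (to-∈ (x A.+ y)) (add (to-∈ x) (to-∈ y)) refl }
                  ; ε-homo = functional (to-∈ A.0#) 0∈ refl }
                ; *-homo = λ x y → functional (to-∈ (x A.* y)) (mul (to-∈ x) (to-∈ y)) refl }
              ; 1#-homo = functional (to-∈ A.1#) 1∈ refl }
            ; -‿homo = λ x → functional (to-∈ (A.- x)) (neg (to-∈ x)) refl }
          ; injective = λ {x} {y} e → injective (to-∈ x) (to-∈ y) e }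
        ; surjective = λ (y , q) → let x , s , p = image inverse-iso total⁻¹ q in
            (x , p) , λ {z} e → functional (to-∈ z) s e }
      ; fixesBase = λ a → functional (to-∈ (ι a , Adjoin.base a)) (diag a) refl
      } , λ {x} s p → functional (to-∈ (x , p)) s refl
      where
      module A = RawRing (adjoinRawRing IsRoot)
      to : ∃[ x ] SplittingField x → ∃[ x ] SplittingField x
      to (x , p) = let y , s , q = image isS total p in y , q
      to-∈ : ∀ x → S (proj₁ x , proj₁ (to x))
      to-∈ (x , p) = proj₁ (proj₂ (image isS total p))

  -- Every root is adjoined to the domain and then, by extending the inverse, to the range. The
  -- latter makes the resulting map on K_f surjective.
  extend-to-roots : ∀ m {S : Pred (Carrier × Carrier) Λ} → IsPartialIso S →
    ∃[ S′ ] Σ[ isS′ ∈ IsPartialIso {Λ} S′ ] S ⊆ S′ × (∀ {i} → i ℕ.< m →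
      IsPartialIso.dom isS′ (root i) × IsPartialIso.dom (IsPartialIso.inverse-iso isS′) (root i))
  extend-to-roots zero isS = _ , isS , (λ s → s) , λ ()
  extend-to-roots (suc m) isS =
    let S₁ , isS₁ , S⊆S₁ , total₁ = extend-to-roots m isS
        d₂ , y , isS₂ , S₁⊆S₂ , y∈ = IsPartialIso.extend isS₁ (root m)
        d₃ , x , isS₃ , S₂⊆S₃ , x∈ = IsPartialIso.extend (IsPartialIso.inverse-iso isS₂) (root m)
    in _ , IsPartialIso.inverse-iso isS₃ , (λ s → S₂⊆S₃ (S₁⊆S₂ (S⊆S₁ s))) , λ i<1+m → <suc-cases i<1+m
      (λ i<m → let (u , s) , (v , s′) = total₁ i<m in (u , S₂⊆S₃ (S₁⊆S₂ s)) , (v , S₂⊆S₃ (S₁⊆S₂ s′)))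
      λ { ≡.refl → (y , S₂⊆S₃ y∈) , (x , x∈) }

  abstract
    extend-to-automorphism : ∀ {S : Pred (Carrier × Carrier) Λ} → IsPartialIso S →
      ∃[ σ ] (∀ {x y} → S (x , y) → (p : SplittingField x) → proj₁ (Automorphism.to {B = IsRoot} σ (x , p)) ≈ y)
    extend-to-automorphism isS =
      let S′ , isS′ , S⊆S′ , total = extend-to-roots n isS
          dom-resp = IsIntermediate.resp (IsPartialIso.dom-intermediate isS′)
          cod-resp = IsIntermediate.resp (IsPartialIso.dom-intermediate (IsPartialIso.inverse-iso isS′))
          σ , σ-spec = automorphism isS′
            (λ r → let i , i<n , e = root-cover r in dom-resp e (proj₁ (total i<n)))
            (λ r → let i , i<n , e = root-cover r in cod-resp e (proj₂ (total i<n)))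
      in σ , λ s → σ-spec (S⊆S′ s)

  Graph : Galois → Pred (Carrier × Carrier) Λ
  Graph σ (x , y) = Σ[ p ∈ SplittingField x ] proj₁ (Automorphism.to σ (x , p)) ≈ y

  module _ (σ : Galois) where
    open Automorphism σ
    open RingMorphisms.IsRingIsomorphism isIsomorphism renaming (⟦⟧-cong to to-cong)
    private module SF = IsIntermediate SF

    Graph-iso : IsPartialIso (Graph σ)
    Graph-iso = record
      { subring = record
        { 0∈ = _ , 0#-homo ; 1∈ = _ , 1#-homo
        ; add = λ (p , e) (p′ , e′) → _ , trans (+-homo _ _) (+-cong e e′)
        ; mul = λ (p , e) (p′ , e′) → _ , trans (*-homo _ _) (*-cong e e′)
        ; neg = λ (p , e) → _ , trans (-‿homo _) (-‿cong e)
        ; resp = λ (e , e′) (p , q) → SF.resp e p , trans (to-cong (sym e)) (trans q e′) }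
      ; diag = λ a → _ , fixesBase a
      ; vanish = λ (p , e) x≈0 → trans (sym e) (trans (to-cong {_} {_ , SF.0∈} x≈0) 0#-homo) }

    Graph-to : ∀ x → Graph σ (proj₁ x , proj₁ (to x))
    Graph-to (x , p) = p , refl

  Diagonal : ∀ {ℓ} → Pred Carrier ℓ → Pred (Carrier × Carrier) (ℓ₁′ ⊔ ℓ)
  Diagonal L (x , y) = L x × x ≈ y

  Diagonal-iso : ∀ {ℓ} {L : Pred Carrier ℓ} → IsIntermediate L → IsPartialIso (Diagonal L)
  Diagonal-iso isL = record
    { subring = record
      { 0∈ = L.0∈ , refl ; 1∈ = L.1∈ , refl
      ; add = λ (p , e) (p′ , e′) → L.add p p′ , +-cong e e′
      ; mul = λ (p , e) (p′ , e′) → L.mul p p′ , *-cong e e′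
      ; neg = λ (p , e) → L.neg p , -‿cong e
      ; resp = λ (e , e′) (p , q) → L.resp e p , trans (sym e) (trans q e′) }
    ; diag = λ a → L.const a , refl
    ; vanish = λ (p , e) x≈0 → trans (sym e) x≈0 }
    where module L = IsIntermediate isL

  Diagonal-dom : ∀ {ℓ} {L : Pred Carrier ℓ} (isL : IsIntermediate L) → IsPartialIso.dom (Diagonal-iso isL) ⊆ L
  Diagonal-dom isL (_ , p , _) = p

  Independent-⊆ : ∀ {ℓ ℓ′} {L : Pred Carrier ℓ} {L′ : Pred Carrier ℓ′} {x d} → L′ ⊆ L →
    Independent L x d → Independent L′ x d
  Independent-⊆ L′⊆L ind a a∈ = ind a (L′⊆L ∘ a∈)

  First : (ℕ → Carrier) → ℕ → Pred Carrier Λ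
  First β j = Adjoin (λ x → ∃[ i ] i ℕ.< j × β i ≈ x)

  First-field : ∀ β j → IsIntermediate (First β j)
  First-field β j = Adjoin-intermediate _

  First-gen : ∀ {β j i} → i ℕ.< j → First β j (β i)
  First-gen i<j = Adjoin.gen (_ , i<j , refl)

  First-least : ∀ {β j ℓ} {L : Pred Carrier ℓ} → IsIntermediate L → (∀ {i} → i ℕ.< j → L (β i)) → First β j ⊆ L
  First-least isL β∈ = Adjoin-least isL λ { (i , i<j , e) → IsIntermediate.resp isL e (β∈ i<j) }

  First-mono : ∀ {β i j} → i ℕ.≤ j → First β i ⊆ First β j
  First-mono i≤j = First-least (First-field _ _) (λ h → First-gen (ℕₚ.<-≤-trans h i≤j))

  First-cong : ∀ {β γ j} → (∀ {i} → i ℕ.< j → β i ≈ γ i) → First β j ⊆ First γ j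
  First-cong e = First-least (First-field _ _) (λ i<j → Adjoin.resp (sym (e i<j)) (First-gen i<j))

  First⊆SF : ∀ {β j} → Distinct IsRoot β j → First β j ⊆ SplittingField
  First⊆SF dβ = First-least SF (λ i<j → Adjoin.gen (holds dβ i<j))

  -- Both properties together say that f behaves like the general polynomial for tuples of up to k roots.
  Generic : ℕ → Set Λ
  Generic k = ∀ β j → Distinct IsRoot β (suc j) → j ℕ.< k → Independent (First β j) (β j) (n ∸ j)

  Generates : ℕ → Set Λ
  Generates k = ∀ β → Distinct IsRoot β k → ∀ {x} → IsRoot x → First β k x

  -- The polynomial is f / ∏ (X - βᵢ). Genericity thus asks that it be minimal, n - j being the
  -- largest degree that βⱼ can have.
  dependent-on-first : ∀ β j → Distinct IsRoot β (suc j) → j ℕ.≤ n → Dependent (First β j) (β j) (n ∸ j)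
  dependent-on-first β j dβ j≤n =
    let a , a∈ , rest = F-deflate (First-field β j) (ℕₚ.m+[n∸m]≡n j≤n) (prefix dβ (ℕₚ.n≤1+n j)) First-gen
    in a , a∈ , rest (holds dβ ℕₚ.≤-refl) (λ i<j → differ< dβ i<j ℕₚ.≤-refl ∘ sym)

  linear⇒∈ : ∀ {ℓ} {L : Pred Carrier ℓ} → IsIntermediate L → ∀ {x} → Dependent L x 1 → L x
  linear⇒∈ isL {x} (a , a∈ , e) =
    L.resp (sym (+-inverseʳ-unique _ _ (trans (+-congˡ (sym (*-identityʳ x))) e))) (L.neg (a∈ zero))
    where module L = IsIntermediate isL

  independent⇒∉ : ∀ {ℓ} {L : Pred Carrier ℓ} → IsIntermediate L → ∀ {x d} → 1 ℕ.< d → Independent L x d → ¬ L x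
  independent⇒∉ isL {x} {suc (suc d)} _ ind x∈ = 1≉0 (ind a a∈ eq (suc zero))
    where
    module L = IsIntermediate isL
    -- The relation - x + 1 · x = 0, padded with zeros; it requires room for the powers 1 and x.
    a : Fin (suc (suc d)) → Carrier
    a zero          = - x
    a (suc zero)    = 1#
    a (suc (suc _)) = 0#
    a∈ : ∀ i → _
    a∈ zero          = L.neg x∈
    a∈ (suc zero)    = L.1∈
    a∈ (suc (suc _)) = L.0∈
    eq : - x + x * (1# + x * evalF {d} (λ _ → 0#) 0# x) ≈ 0#
    eq = trans (+-congˡ (trans (*-congˡ (trans (+-congˡ (trans (*-congˡ (evalF-zero {c = λ (_ : Fin d) → 0#} x (λ _ → refl) refl)) (zeroʳ x)))
           (+-identityʳ 1#))) (*-identityʳ x))) (-‿inverseˡ x)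
  independent⇒∉ isL {d = suc zero} (ℕ.s≤s ())

  toTuple : ∀ {β k} → Distinct IsRoot β k → DistinctRoots k
  toTuple {β} dβ = record
    { to = λ i → β (toℕ i) , holds dβ (Finₚ.toℕ<n i)
    ; cong = λ { ≡.refl → refl }
    ; injective = λ {i} {i′} e → Finₚ.toℕ-injective (injective dβ (Finₚ.toℕ<n i) (Finₚ.toℕ<n i′) e) }
    where open Distinct using (injective)

  module _ {k} (α : DistinctRoots k) where
    open Injection α using (to; injective)

    sequence : ℕ → Carrier
    sequence = padding (root 0) (proj₁ ∘ to)

    sequence-fin : ∀ i → sequence (toℕ i) ≡ proj₁ (to i)
    sequence-fin i = ≡.trans (padding-< (root 0) (proj₁ ∘ to) (Finₚ.toℕ<n i))
      (≡.cong (proj₁ ∘ to) (Finₚ.fromℕ<-toℕ i _))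

    sequence-distinct : Distinct IsRoot sequence k
    sequence-distinct = record
      { holds = λ i<k → ≡.subst IsRoot (≡.sym (padding-< (root 0) (proj₁ ∘ to) i<k)) (proj₂ (to (fromℕ< i<k)))
      ; differ< = λ {i} {i′} i<i′ i′<k e →
          ℕₚ.<-irrefl (Finₚ.fromℕ<-injective i i′ (ℕₚ.<-trans i<i′ i′<k) i′<k (injective
            (trans (reflexive (≡.sym (padding-< (root 0) (proj₁ ∘ to) (ℕₚ.<-trans i<i′ i′<k))))
              (trans e (reflexive (padding-< (root 0) (proj₁ ∘ to) i′<k)))))) i<i′ }

  -- Sharp transitivity implies genericity and generation

  module _ {k} (sharp : SharplyTransitive k) where
    private
      transitive : ∀ {β γ} → Distinct IsRoot β k → Distinct IsRoot γ k →
        ∃[ σ ] (∀ {i} → i ℕ.< k → Graph σ (β i , γ i))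
      transitive {β} {γ} dβ dγ =
        let σ , maps , _ = sharp (toTuple dβ) (toTuple dγ) in
        σ , λ i<k → ≡.subst (λ i → Graph σ (β i , γ i)) (Finₚ.toℕ-fromℕ< i<k) (_ , maps (fromℕ< i<k))

      to-≈ : ∀ σ {x y} p → Graph σ (x , y) → proj₁ (Automorphism.to σ (x , p)) ≈ y
      to-≈ σ p s = IsPartialIso.functional (Graph-iso σ) (Graph-to σ (_ , p)) s refl

      unique : ∀ {β γ} → Distinct IsRoot β k → Distinct IsRoot γ k → ∀ σ τ →
        (∀ {i} → i ℕ.< k → Graph σ (β i , γ i)) → (∀ {i} → i ℕ.< k → Graph τ (β i , γ i)) →
        ∀ {x y z} → Graph σ (x , y) → Graph τ (x , z) → y ≈ z
      unique dβ dγ σ τ σβ τβ {x} s@(p , _) t =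
        let υ , _ , u = sharp (toTuple dβ) (toTuple dγ)
            υ≈σ = u {σ} (λ i → to-≈ σ _ (σβ (Finₚ.toℕ<n i)))
            υ≈τ = u {τ} (λ i → to-≈ τ _ (τβ (Finₚ.toℕ<n i)))
        in trans (sym (to-≈ σ p s)) (trans (sym (υ≈σ (x , p))) (trans (υ≈τ (x , p)) (to-≈ τ p t)))

      -- A root outside K(β) would have a conjugate over K(β), hence be moved by an automorphism fixing β.
      no-conjugates : ∀ {β x d} → Distinct IsRoot β k → IsRoot x →
        Dependent (First β k) x d → Independent (First β k) x d → First β k x
      no-conjugates {d = zero} dβ x-root dep ind = contradiction (proj₂ (proj₂ dep)) 1≉0
      no-conjugates {β} {x} {suc zero} dβ x-root dep ind = linear⇒∈ (First-field β k) {x} dep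
      no-conjugates {β} {x} {suc (suc d)} dβ x-root (μ , μ∈ , e) ind =
        let L = First-field β k
            x′ , x′≉x , e′ = other-root L x-root (μ , μ∈ , e) ind
            isS , Δ⊆S , x∈S = IsPartialIso.extend-by (Diagonal-iso L) {μ = λ i → μ i , μ i} {x} {x′}
              (λ i → μ∈ i , refl) e e′ (Independent-⊆ {L = First β k} {x = x} (Diagonal-dom L) ind)
            σ , σ-spec = extend-to-automorphism isS
            τ , τ-spec = extend-to-automorphism (Diagonal-iso SF)
            β∈ : ∀ {i} → i ℕ.< k → SplittingField (β i)
            β∈ i<k = Adjoin.gen (holds dβ i<k)
            x∈ = Adjoin.gen x-root
        in contradiction
          (unique dβ dβ σ τ (λ i<k → _ , σ-spec (Δ⊆S (First-gen i<k , refl)) (β∈ i<k))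
            (λ i<k → _ , τ-spec (β∈ i<k , refl) (β∈ i<k))
            (_ , σ-spec x∈S x∈) (_ , τ-spec (x∈ , refl) x∈)) x′≉x

    sharp⇒generates : Generates k
    sharp⇒generates β dβ {x} x-root =
      let d , dep , ind = minimal-polynomial (First-field β k) x in no-conjugates dβ x-root dep ind

    -- The automorphisms fixing β₀, …, β_{j-1} move βⱼ to every other root.
    sharp-roots : k ℕ.≤ n → ∀ {β j e α} → Distinct IsRoot β (suc j) → j ℕ.< k →
      (dep : Dependent (First β j) (β j) e) →
      IsRoot α → (∀ {i} → i ℕ.< j → ¬ β i ≈ α) → evalF (proj₁ dep) 1# α ≈ 0#
    sharp-roots k≤n {β} {j} {e} {α} dβ j<k (μ , μ∈ , root) α-root fresh =
      let b , db , agree = extend-distinct k dβ j<k k≤n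
          b′ , db′ , agree′ = extend-distinct k (Distinct-snoc (prefix dβ (ℕₚ.n≤1+n j)) α-root fresh) j<k k≤n
          σ , spec = transitive db db′
          module σ = IsPartialIso (Graph-iso σ)
          -- The fixed elements of σ form an intermediate field, which contains the j roots shared
          -- by the two tuples.
          fixed : ∀ {y} → First β j y → Graph σ (y , y)
          fixed = First-least {β} {j} {L = λ y → Graph σ (y , y)}
            (record { isSubring = record
              { 0∈ = σ.0∈ ; 1∈ = σ.1∈ ; add = σ.add ; mul = σ.mul ; neg = σ.neg ; resp = λ e → σ.resp (e , e) }
                    ; const = σ.diag })
            (λ {i} i<j → σ.resp (reflexive (agree (ℕₚ.m<n⇒m<1+n i<j)) ,
                reflexive (≡.trans (agree′ (ℕₚ.m<n⇒m<1+n i<j)) (snoc-init β j α i<j)))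
              (spec (ℕₚ.<-trans i<j j<k)))
          moved : Graph σ (β j , α)
          moved = σ.resp (reflexive (agree ℕₚ.≤-refl) , reflexive (≡.trans (agree′ ℕₚ.≤-refl) (snoc-last β j α))) (spec j<k)
          μ² : Fin e → Carrier × Carrier
          μ² i = μ i , μ i
          -- The coefficients of μ are fixed, so the pair (μ(βⱼ), μ(α)) lies in the graph of σ, and
          -- with its first entry the second one vanishes.
          value = P.evalF-∈ σ.subring {c = μ²} {1# , 1#} {β j , α} (λ i → fixed (μ∈ i)) σ.1∈ moved
      in trans (reflexive (≡.sym (Product.evalF-proj₂ μ² (1# , 1#) (β j , α))))
           (σ.vanish value (trans (reflexive (Product.evalF-proj₁ μ² (1# , 1#) (β j , α))) root))

    sharp⇒generic : k ℕ.≤ n → Generic k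
    sharp⇒generic k≤n β j dβ j<k = minimal⇒independent (First-field β j) too-small
      where
      too-small : ∀ {e} → e ℕ.< n ∸ j → ¬ Dependent (First β j) (β j) e
      -- Here γ lists all the roots, the j given ones first. The e + 1 roots from γⱼ on, available
      -- because e < n - j, would be zeros of a monic polynomial of degree e.
      too-small {e} e<n∸j dep = root-bound (proj₁ dep) {λ i → γ (j ℕ.+ i)} record
        { holds = λ {i} i<1+e → sharp-roots k≤n dβ j<k dep (holds dγ (bound i<1+e))
            (λ {i′} i′<j βi≈γ → differ dγ (ℕₚ.<-trans i′<j j<n) (bound i<1+e)
              (ℕₚ.<⇒≢ (ℕₚ.<-≤-trans i′<j (ℕₚ.m≤m+n j i)))
              (trans (reflexive (agree i′<j)) βi≈γ))
        ; differ< = λ i<i′ i′<1+e → differ< dγ (ℕₚ.+-monoʳ-< j i<i′) (bound i′<1+e) }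
        where
        j<n = ℕₚ.<-≤-trans j<k k≤n
        extension = extend-distinct n (prefix dβ (ℕₚ.n≤1+n j)) (ℕₚ.<⇒≤ j<n) ℕₚ.≤-refl
        γ = proj₁ extension
        dγ = proj₁ (proj₂ extension)
        agree = proj₂ (proj₂ extension)
        bound : ∀ {i} → i ℕ.< suc e → j ℕ.+ i ℕ.< n
        bound {i} i<1+e = ≡.subst (j ℕ.+ i ℕ.<_) (ℕₚ.m+[n∸m]≡n (ℕₚ.<⇒≤ j<n))
          (ℕₚ.+-monoʳ-< j (ℕₚ.<-≤-trans i<1+e e<n∸j))

  -- Genericity and generation imply sharp transitivity

  module _ {k} (k≤n : k ℕ.≤ n) (generic : Generic k) where
    private
      ⟨φ⟩ : Fin n → Carrier × Carrier
      ⟨φ⟩ i = ι (φ i) , ι (φ i)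

      ⟨φ⟩-root : ∀ {x y} → IsRoot x → IsRoot y →
        CommutativeRing._≈_ Product.productRing (P.evalF ⟨φ⟩ (1# , 1#) (x , y)) (0# , 0#)
      ⟨φ⟩-root {x} {y} rx ry =
        trans (reflexive (Product.evalF-proj₁ ⟨φ⟩ (1# , 1#) (x , y))) (root⇒F rx) ,
        trans (reflexive (Product.evalF-proj₂ ⟨φ⟩ (1# , 1#) (x , y))) (root⇒F ry)

      regular² : ∀ {x y x′ y′} → ¬ x ≈ x′ → ¬ y ≈ y′ → P.Regular (x - x′ , y - y′)
      regular² x≉x′ y≉y′ (v , w) (p , q) = ≉⇒regular x≉x′ v p , ≉⇒regular y≉y′ w q

    -- F divided by the factors X - aᵢ and F divided by the factors X - bᵢ correspond under
    -- aᵢ ↦ bᵢ, and the former is the minimal polynomial of aⱼ.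
    tuple-iso : ∀ {a b} j → Distinct IsRoot a j → Distinct IsRoot b j → j ℕ.≤ k →
      ∃[ S ] Σ[ isS ∈ IsPartialIso {Λ} S ] (∀ {i} → i ℕ.< j → S (a i , b i)) ×
        (∀ {x y} → S (x , y) → First a j x)
    tuple-iso {a} zero da db _ =
      Diagonal (First a 0) , Diagonal-iso (First-field a 0) , (λ ()) , proj₁
    tuple-iso {a} {b} (suc j) da db j<k =
      let S , isS , S∋ , S-dom = tuple-iso j (prefix da (ℕₚ.n≤1+n j)) (prefix db (ℕₚ.n≤1+n j)) (ℕₚ.<⇒≤ j<k)
          module S = IsPartialIso isS
          μ , μ∈ , rest = P.deflate S.subring {c = ⟨φ⟩} {1# , 1#} (λ i → S.diag (φ i)) S.1∈ (λ i → a i , b i) j (n ∸ j)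
            (ℕₚ.m+[n∸m]≡n (ℕₚ.<⇒≤ (ℕₚ.<-≤-trans j<k k≤n))) S∋
            (λ i<j → ⟨φ⟩-root (holds da (ℕₚ.m<n⇒m<1+n i<j)) (holds db (ℕₚ.m<n⇒m<1+n i<j)))
            (λ i<i′ i′<j → regular² (differ< da i<i′ (ℕₚ.m<n⇒m<1+n i′<j) ∘ sym)
                                    (differ< db i<i′ (ℕₚ.m<n⇒m<1+n i′<j) ∘ sym))
          e , e′ = rest (a j , b j)
            (λ i<j → regular² (differ< da i<j ℕₚ.≤-refl ∘ sym) (differ< db i<j ℕₚ.≤-refl ∘ sym))
            (⟨φ⟩-root (holds da ℕₚ.≤-refl) (holds db ℕₚ.≤-refl))
          isS′ , S⊆S′ , new = S.extend-by {μ = μ} {a j} {b j} μ∈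
            (trans (reflexive (≡.sym (Product.evalF-proj₁ μ (1# , 1#) (a j , b j)))) e)
            (trans (reflexive (≡.sym (Product.evalF-proj₂ μ (1# , 1#) (a j , b j)))) e′)
            (Independent-⊆ {L = First a j} {S.dom} {a j} (λ (_ , s) → S-dom s) (generic a j da j<k))
      in P.Span S (a j , b j) (n ∸ j) , isS′ ,
         (λ i<1+j → <suc-cases i<1+j (λ i<j → S⊆S′ (S∋ i<j)) (λ { ≡.refl → new })) ,
         λ (d , d∈ , eq , _) → Adjoin.resp
           (sym (trans eq (reflexive (Product.evalF-proj₁ d (0# , 0#) (a j , b j)))))
           (evalF-∈ (isSubring (First-field a (suc j))) {c = proj₁ ∘ d} {0#} {a j}
             (λ i → First-mono (ℕₚ.n≤1+n j) (S-dom (d∈ i)))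
             (IsIntermediate.0∈ (First-field a (suc j))) (First-gen ℕₚ.≤-refl))

    generic⇒sharp : Generates k → SharplyTransitive k
    generic⇒sharp generates α β =
      let a = sequence α
          b = sequence β
          da = sequence-distinct α
          S , isS , S∋ , _ = tuple-iso k da (sequence-distinct β) ℕₚ.≤-refl
          σ , spec = extend-to-automorphism isS
          maps : ∀ i → σ maps Injection.to α i to Injection.to β i
          maps i = trans (spec (IsPartialIso.resp isS
            (reflexive (sequence-fin α i) , refl) (S∋ (Finₚ.toℕ<n i))) _) (reflexive (sequence-fin β i))
      in σ , maps , λ {τ} maps′ → agree {σ} {τ} da maps maps′
      where
      agree : ∀ {σ τ} → Distinct IsRoot (sequence α) k →
        (∀ i → σ maps Injection.to α i to Injection.to β i) →
        (∀ i → τ maps Injection.to α i to Injection.to β i) → σ ≈ᴳ τ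
      agree {σ} {τ} da σ-maps τ-maps (x , p) =
        let z , s , t = Adjoin-least both-field (λ r → First-least both-field on-tuple (generates _ da r)) p in
        trans (σ.functional (Graph-to σ (x , p)) s refl) (τ.functional t (Graph-to τ (x , p)) refl)
        where
        module σ = IsPartialIso (Graph-iso σ)
        module τ = IsPartialIso (Graph-iso τ)
        -- The equalizer of σ and τ. It is an intermediate field containing the tuple, hence all
        -- roots, hence K_f.
        Both : Pred Carrier _
        Both x = ∃[ z ] Graph σ (x , z) × Graph τ (x , z)
        both-field : IsIntermediate Both
        both-field = record
          { isSubring = record
            { 0∈ = _ , σ.0∈ , τ.0∈ ; 1∈ = _ , σ.1∈ , τ.1∈
            ; add = λ (_ , s , t) (_ , s′ , t′) → _ , σ.add s s′ , τ.add t t′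
            ; mul = λ (_ , s , t) (_ , s′ , t′) → _ , σ.mul s s′ , τ.mul t t′
            ; neg = λ (_ , s , t) → _ , σ.neg s , τ.neg t
            ; resp = λ e (_ , s , t) → _ , σ.resp (e , refl) s , τ.resp (e , refl) t }
          ; const = λ a → _ , σ.diag a , τ.diag a }
        on-tuple : ∀ {i} → i ℕ.< k → Both (sequence α i)
        on-tuple {i} i<k = proj₁ (Injection.to β (fromℕ< i<k)) ,
          σ.resp (reflexive (≡.sym (padding-< _ _ i<k)) , refl) (_ , σ-maps (fromℕ< i<k)) ,
          τ.resp (reflexive (≡.sym (padding-< _ _ i<k)) , refl) (_ , τ-maps (fromℕ< i<k))

-- Falling factorials and strict inclusions

open import Data.Nat.Combinatorics using (_C_; _P_)

P≡P′ : ∀ {n k} → k ℕ.≤ n → n P k ≡ n P′ k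
P≡P′ {n} {k} k≤n with k ≤ᵇ n | ℕₚ.≤⇒≤ᵇ k≤n
... | true | _ = ≡.refl

P-suc : ∀ {n k} → k ℕ.< n → n P suc k ≡ (n ∸ k) ℕ.* (n P k)
P-suc {n} {k} k<n = ≡.trans (P≡P′ k<n) (≡.cong ((n ∸ k) ℕ.*_) (≡.sym (P≡P′ (ℕₚ.<⇒≤ k<n))))

P-nonzero : ∀ {n} k → k ℕ.≤ n → ℕ.NonZero (n P k)
P-nonzero zero _ = _
P-nonzero {n} (suc k) k<n = ≡.subst ℕ.NonZero (≡.sym (P-suc k<n))
  (ℕₚ.m*n≢0 (n ∸ k) (n P k) ⦃ ℕ.>-nonZero (ℕₚ.m<n⇒0<n∸m k<n) ⦄ ⦃ P-nonzero k (ℕₚ.<⇒≤ k<n) ⦄)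

1<∸ : ∀ {j k n} → j ℕ.< k → k ℕ.< n → 1 ℕ.< n ∸ j
1<∸ {j} j<k k<n = ℕₚ.m+n≤o⇒m≤o∸n 2 (ℕₚ.≤-trans (ℕ.s≤s j<k) k<n)

⊂-resp-≐ : ∀ {a ℓ ℓ₁ ℓ₂ ℓ₃} {A : Set a} {P : Pred A ℓ} {Q : Pred A ℓ₁} {P′ : Pred A ℓ₂} {Q′ : Pred A ℓ₃} →
  P ≐ P′ → Q ≐ Q′ → P ⊂ Q → P′ ⊂ Q′
⊂-resp-≐ (p , p′) (q , q′) (P⊆Q , Q⊈P) = (λ x → q (P⊆Q (p′ x))) , λ Q′⊆P′ → Q⊈P (λ x → p′ (Q′⊆P′ (q x)))

-- Completing a sequence to a system of representatives

module GreedyEnumeration (em : ∀ {ℓ} → ExcludedMiddle ℓ) {a ℓ} (S : Setoid a ℓ) where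
  open Setoid S

  record Extension (β : ℕ → Carrier) (j : ℕ) (e : ℕ → Carrier) (m : ℕ) : Set (a ⊔ ℓ) where
    field
      size      : ℕ
      j≤size    : j ℕ.≤ size
      sequence  : ℕ → Carrier
      agrees    : ∀ {i} → i ℕ.< j → sequence i ≡ β i
      distinct  : ∀ {i i′} → i ℕ.< i′ → i′ ℕ.< size → ¬ sequence i ≈ sequence i′
      covers    : ∀ {i} → i ℕ.< m → ∃[ i′ ] i′ ℕ.< size × sequence i′ ≈ e i

    bijection : (∀ x → ∃[ i ] i ℕ.< m × e i ≈ x) → Bijection (≡.setoid (Fin size)) S
    bijection e-cover = record
      { to = sequence ∘ toℕ
      ; cong = λ { ≡.refl → refl }
      ; bijective = inj , λ x →
          let i , i<m , ei≈x = e-cover x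
              i′ , i′<s , eq = covers i<m
          in fromℕ< i′<s , λ { ≡.refl → trans (reflexive (≡.cong sequence (Finₚ.toℕ-fromℕ< i′<s))) (trans eq ei≈x) } }
      where
      inj : ∀ {i i′ : Fin size} → sequence (toℕ i) ≈ sequence (toℕ i′) → i ≡ i′
      inj {i} {i′} eq with ℕₚ.<-cmp (toℕ i) (toℕ i′)
      ... | tri< i<i′ _ _ = contradiction eq (distinct i<i′ (Finₚ.toℕ<n i′))
      ... | tri≈ _ i≡i′ _ = Finₚ.toℕ-injective i≡i′
      ... | tri> _ _ i′<i = contradiction (sym eq) (distinct i′<i (Finₚ.toℕ<n i))

  -- The candidates e are tried in turn, and one is appended only if it is equivalent to no earlier
  -- term. The prescribed first j terms stay in place, so a tuple from different clusters can be
  -- made the beginning of a tower.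
  extend-sequence : ∀ {β j} e m → (∀ {i i′} → i ℕ.< i′ → i′ ℕ.< j → ¬ β i ≈ β i′) → Extension β j e m
  extend-sequence {β} {j} e zero distinct = record
    { size = j ; j≤size = ℕₚ.≤-refl ; sequence = β ; agrees = λ _ → ≡.refl ; distinct = distinct ; covers = λ () }
  extend-sequence {β} {j} e (suc m) distinct = case-on em
    where
    E = extend-sequence {β} {j} e m distinct
    module E = Extension E
    case-on : Dec (∃[ i ] i ℕ.< E.size × E.sequence i ≈ e m) → Extension β j e (suc m)
    case-on (yes found) = record
      { size = E.size ; j≤size = E.j≤size ; sequence = E.sequence ; agrees = E.agrees ; distinct = E.distinct
      ; covers = λ i<1+m → <suc-cases i<1+m E.covers λ { ≡.refl → found } }
    case-on (no new) = record
      { size = suc E.size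
      ; j≤size = ℕₚ.m≤n⇒m≤1+n E.j≤size
      ; sequence = γ
      ; agrees = λ i<j → ≡.trans (old (ℕₚ.<-≤-trans i<j E.j≤size)) (E.agrees i<j)
      ; distinct = λ i<i′ i′<1+s eq → <suc-cases i′<1+s
          (λ i′<s → E.distinct i<i′ i′<s
            (trans (reflexive (≡.sym (old (ℕₚ.<-trans i<i′ i′<s)))) (trans eq (reflexive (old i′<s)))))
          λ { ≡.refl → new (_ , i<i′ , trans (reflexive (≡.sym (old i<i′)))
                                        (trans eq (reflexive (snoc-last E.sequence E.size (e m))))) }
      ; covers = λ i<1+m → <suc-cases i<1+m
          (λ i<m → let i′ , i′<s , eq = E.covers i<m in
             i′ , ℕₚ.m<n⇒m<1+n i′<s , trans (reflexive (old i′<s)) eq)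
          λ { ≡.refl → E.size , ℕₚ.≤-refl , reflexive (snoc-last E.sequence E.size (e m)) } }
      where
      γ = snoc E.sequence E.size (e m)
      old : ∀ {i} → i ℕ.< E.size → γ i ≡ E.sequence i
      old = snoc-init E.sequence E.size (e m)

-- Where a chain of fields grows

module GrowthSequences {c ℓ₁ ℓ₂ c′ ℓ₁′ ℓ₂′} {K : HeytingField c ℓ₁ ℓ₂}
    (K̄ : AlgebraicClosure K c′ ℓ₁′ ℓ₂′) where
  open AlgebraicClosure K̄ using (Carrier)
  open Extensions K̄ using (HasDegreeOverBase; DegreeSequence; done; stay; grow)

  module _ {ℓ} (F : ℕ → Pred Carrier ℓ) (g : ℕ → ℕ) where
    -- DegreeSequence F s (applyUpTo g m), with the list of degrees replaced by its length.
    data Growth : ℕ → ℕ → Set (c ⊔ ℓ₁ ⊔ c′ ⊔ ℓ₁′ ⊔ ℓ) where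
      done : Growth 0 0
      stay : ∀ {s m} → Growth s m → F s ≐ F (suc s) → Growth (suc s) m
      grow : ∀ {s m} → Growth s m → F s ⊂ F (suc s) → HasDegreeOverBase (F (suc s)) (g m) → Growth (suc s) (suc m)

    toGrowth : ∀ {s ds} → DegreeSequence F s ds → ∀ m → ds ≡ applyUpTo g m → Growth s m
    toGrowth done zero _ = done
    toGrowth (stay G e) m eq = stay (toGrowth G m eq) e
    toGrowth (grow {ds = ds} G p h) zero eq = contradiction eq (∷ʳ≢[] ds)
      where
      ∷ʳ≢[] : ∀ {A : Set} (xs : List A) {x} → ¬ xs ∷ʳ x ≡ []
      ∷ʳ≢[] [] ()
      ∷ʳ≢[] (_ ∷ _) ()
    toGrowth (grow {ds = ds} G p h) (suc m) eq
      with ≡.refl , ≡.refl ← Listₚ.∷ʳ-injective ds (applyUpTo g m) (≡.trans eq (≡.sym (Listₚ.applyUpTo-∷ʳ g m)))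
      = grow (toGrowth G m ≡.refl) p h

    fromGrowth : ∀ {s m} → Growth s m → DegreeSequence F s (applyUpTo g m)
    fromGrowth done         = done
    fromGrowth (stay G e)   = stay (fromGrowth G) e
    fromGrowth (grow {s} {m} G p h) =
      ≡.subst (DegreeSequence F (suc s)) (Listₚ.applyUpTo-∷ʳ g m) (grow (fromGrowth G) p h)

    growth-≤ : ∀ {s m} → Growth s m → m ℕ.≤ s
    growth-≤ done         = ℕ.z≤n
    growth-≤ (stay G _)   = ℕₚ.m≤n⇒m≤1+n (growth-≤ G)
    growth-≤ (grow G _ _) = ℕ.s≤s (growth-≤ G)

    module _ {j} (strict : ∀ {i} → i ℕ.< j → F i ⊂ F (suc i)) where
      -- Strictness rules out a `stay` among the first j steps, so each of them adds one to the
      -- count of growths.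
      strict-≤ : ∀ {s m} → Growth s m → ∀ {i} → i ℕ.≤ j → i ℕ.≤ s → i ℕ.≤ m
      strict-≤ done _ i≤0 = i≤0
      strict-≤ (stay G e) i≤j i≤1+s with ℕₚ.m≤n⇒m<n∨m≡n i≤1+s
      ... | inj₁ i<1+s  = strict-≤ G i≤j (ℕₚ.≤-pred i<1+s)
      ... | inj₂ ≡.refl = ⊥-elim (proj₂ (strict i≤j) (proj₂ e))
      strict-≤ (grow G _ _) i≤j i≤1+s with ℕₚ.m≤n⇒m<n∨m≡n i≤1+s
      ... | inj₁ i<1+s  = ℕₚ.m≤n⇒m≤1+n (strict-≤ G i≤j (ℕₚ.≤-pred i<1+s))
      ... | inj₂ ≡.refl = ℕ.s≤s (strict-≤ G (ℕₚ.<⇒≤ i≤j) ℕₚ.≤-refl)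

      -- The first j steps already account for all growths, so every later step is a `stay`.
      constant-after : ∀ {s m} → Growth s m → j ℕ.≤ s → m ℕ.≤ j → F j ≐ F s
      constant-after done ℕ.z≤n _ = ≐-refl
      constant-after (stay G e) j≤1+s m≤j with ℕₚ.m≤n⇒m<n∨m≡n j≤1+s
      ... | inj₁ j<1+s  = ≐-trans (constant-after G (ℕₚ.≤-pred j<1+s) m≤j) e
      ... | inj₂ ≡.refl = ≐-refl
      constant-after (grow G _ _) j≤1+s m<j with ℕₚ.m≤n⇒m<n∨m≡n j≤1+s
      ... | inj₁ j<1+s  = contradiction (strict-≤ G ℕₚ.≤-refl (ℕₚ.≤-pred j<1+s)) (ℕₚ.<⇒≱ m<j)
      ... | inj₂ ≡.refl = ≐-refl

      -- The first j growths happen at the first j steps. The next one has index j, counted from 0;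
      -- it takes place at some step t, up to which the field remains F j.
      next-growth : ∀ {s m} → Growth s m → j ℕ.< m →
        ∃[ t ] j ℕ.≤ t × t ℕ.< s × F j ≐ F t × HasDegreeOverBase (F (suc t)) (g j)
      next-growth (stay G e) j<m with t , j≤t , t<s , rest ← next-growth G j<m
        = t , j≤t , ℕₚ.m<n⇒m<1+n t<s , rest
      next-growth (grow {m = m} G p h) j<1+m with ℕₚ.m<1+n⇒m<n∨m≡n j<1+m
      ... | inj₁ j<m with t , j≤t , t<s , rest ← next-growth G j<m
        = t , j≤t , ℕₚ.m<n⇒m<1+n t<s , rest
      next-growth (grow G p h) _ | inj₂ ≡.refl =
        _ , growth-≤ G , ℕₚ.≤-refl , constant-after G (growth-≤ G) ℕₚ.≤-refl , h

-- Cardinalities, combinations and injective sequences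

module _ {a ℓ} {S : Setoid a ℓ} where
  open Setoid S

  card-≤ : ∀ {m k} (g : Fin m → Carrier) → (∀ {i j} → g i ≈ g j → i ≡ j) → HasCardinality S k → m ℕ.≤ k
  card-≤ g g-injective B = Finₚ.injective⇒≤ {f = index} λ {i} {j} e → g-injective
    (trans (sym (proj₂ (surjective (g i)) ≡.refl)) (trans (reflexive (≡.cong to e)) (proj₂ (surjective (g j)) ≡.refl)))
    where
    open Bijection B using (to; surjective)
    index = λ i → proj₁ (surjective (g i))

  card-unique : ∀ {m k} → HasCardinality S m → HasCardinality S k → m ≡ k
  card-unique B B′ = ℕₚ.≤-antisym (card-≤ B.to B.injective B′) (card-≤ B′.to B′.injective B)
    where module B = Bijection B; module B′ = Bijection B′

-- The k-element subsets of Fin n.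
data Comb : ℕ → ℕ → Set where
  none : Comb 0 0
  keep : ∀ {n k} → Comb n k → Comb (suc n) (suc k)
  skip : ∀ {n k} → Comb n k → Comb (suc n) k

elem : ∀ {n k} → Comb n k → Fin k → Fin n
elem (keep c) zero    = zero
elem (keep c) (suc i) = suc (elem c i)
elem (skip c) i       = suc (elem c i)

elem-injective : ∀ {n k} (c : Comb n k) {i j} → elem c i ≡ elem c j → i ≡ j
elem-injective (keep c) {zero}  {zero}  _ = ≡.refl
elem-injective (keep c) {suc i} {suc j} e = ≡.cong suc (elem-injective c (Finₚ.suc-injective e))
elem-injective (skip c) e = elem-injective c (Finₚ.suc-injective e)

InComb : ∀ {n k} → Comb n k → Fin n → Set
InComb c i = ∃[ m ] elem c m ≡ i

private
  tail-keep : ∀ {n k} {c : Comb n k} {i} → InComb (keep c) (suc i) → InComb c i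
  tail-keep (suc m , e) = m , Finₚ.suc-injective e

  tail-skip : ∀ {n k} {c : Comb n k} {i} → InComb (skip c) (suc i) → InComb c i
  tail-skip (m , e) = m , Finₚ.suc-injective e

Comb-ext : ∀ {n k} (c c′ : Comb n k) → (∀ i → InComb c i → InComb c′ i) → (∀ i → InComb c′ i → InComb c i) → c ≡ c′
Comb-ext none none _ _ = ≡.refl
Comb-ext (keep c) (keep c′) p q = ≡.cong keep (Comb-ext c c′
  (λ i (m , e) → tail-keep (p (suc i) (suc m , ≡.cong suc e)))
  (λ i (m , e) → tail-keep (q (suc i) (suc m , ≡.cong suc e))))
Comb-ext (skip c) (skip c′) p q = ≡.cong skip (Comb-ext c c′
  (λ i (m , e) → tail-skip (p (suc i) (m , ≡.cong suc e)))
  (λ i (m , e) → tail-skip (q (suc i) (m , ≡.cong suc e))))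
Comb-ext (keep c) (skip c′) p q with () ← p zero (zero , ≡.refl)
Comb-ext (skip c) (keep c′) p q with () ← q zero (zero , ≡.refl)

comb-of : (∀ {ℓ} → ExcludedMiddle ℓ) → ∀ {ℓ n} (Q : Fin n → Set ℓ) →
  ∃[ k ] Σ[ c ∈ Comb n k ] (∀ i → Q i → InComb c i) × (∀ m → Q (elem c m))
comb-of em {n = zero} Q = 0 , none , (λ ()) , λ ()
comb-of em {n = suc n} Q with comb-of em (Q ∘ suc) | em {P = Q zero}
... | k , c , complete , sound | yes q = suc k , keep c ,
  (λ { zero _ → zero , ≡.refl ; (suc i) qi → let m , e = complete i qi in suc m , ≡.cong suc e }) ,
  λ { zero → q ; (suc m) → sound m }
... | k , c , complete , sound | no ¬q = k , skip c ,
  (λ { zero q → contradiction q ¬q ; (suc i) qi → let m , e = complete i qi in m , ≡.cong suc e }) , sound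

Comb↔ : ∀ n k → Fin (n C k) ↔ Comb n k
Comb↔ zero zero = mk↔ₛ′ (λ _ → none) (λ _ → zero) (λ { none → ≡.refl }) (λ { zero → ≡.refl })
Comb↔ zero (suc k) = mk↔ₛ′ (λ ()) (λ ()) (λ ()) (λ ())
Comb↔ (suc n) zero = mk↔ₛ′ skip (λ { (skip c) → c }) (λ { (skip c) → ≡.refl }) (λ _ → ≡.refl) ↔-∘ Comb↔ n zero
Comb↔ (suc n) (suc k) = ≡.subst (λ m → Fin m ↔ Comb (suc n) (suc k)) (nCk+nC[k+1]≡[n+1]C[k+1] n k)
  (cases ↔-∘ ((Comb↔ n k ⊎-↔ Comb↔ n (suc k)) ↔-∘ Finₚ.+↔⊎))
  where
  cases : (Comb n k ⊎ Comb n (suc k)) ↔ Comb (suc n) (suc k)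
  cases = mk↔ₛ′ (λ { (inj₁ c) → keep c ; (inj₂ c) → skip c }) (λ { (keep c) → inj₁ c ; (skip c) → inj₂ c })
    (λ { (keep c) → ≡.refl ; (skip c) → ≡.refl }) (λ { (inj₁ c) → ≡.refl ; (inj₂ c) → ≡.refl })

-- The injective sequences of length j in Fin n: each further term is given by its position among the
-- elements that are still unused.
Arr : ℕ → ℕ → Set
Arr n       zero    = ⊤
Arr zero    (suc j) = ⊥
Arr (suc n) (suc j) = Fin (suc n) × Arr n j

entry : ∀ {n} j → Arr n j → Fin j → Fin n
entry {suc n} (suc j) (i , a) zero    = i
entry {suc n} (suc j) (i , a) (suc m) = punchIn i (entry j a m)

entry-injective : ∀ {n} j (a : Arr n j) {m m′} → entry j a m ≡ entry j a m′ → m ≡ m′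
entry-injective {suc n} (suc j) (i , a) {zero}  {zero}   _ = ≡.refl
entry-injective {suc n} (suc j) (i , a) {zero}  {suc m′} e = contradiction (≡.sym e) (Finₚ.punchInᵢ≢i i _)
entry-injective {suc n} (suc j) (i , a) {suc m} {zero}   e = contradiction e (Finₚ.punchInᵢ≢i i _)
entry-injective {suc n} (suc j) (i , a) {suc m} {suc m′} e =
  ≡.cong suc (entry-injective j a (Finₚ.punchIn-injective i _ _ e))

Arr-ext : ∀ {n} j (a a′ : Arr n j) → entry j a ≗ entry j a′ → a ≡ a′
Arr-ext zero a a′ e = ≡.refl
Arr-ext {suc n} (suc j) (i , a) (i′ , a′) e with ≡.refl ← e zero =
  ≡.cong (i ,_) (Arr-ext j a a′ (λ m → Finₚ.punchIn-injective i _ _ (e (suc m))))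

arr-of : ∀ {n} j (g : Fin j → Fin n) → (∀ {m m′} → g m ≡ g m′ → m ≡ m′) → ∃[ a ] entry j a ≗ g
arr-of zero g inj = tt , λ ()
arr-of {zero} (suc j) g inj with () ← g zero
arr-of {suc n} (suc j) g inj =
  let a , e = arr-of j g′ (λ {m} {m′} eq → Finₚ.suc-injective (inj (Finₚ.punchOut-injective (g₀≢ m) (g₀≢ m′) eq)))
  in (g zero , a) , λ { zero → ≡.refl ; (suc m) → ≡.trans (≡.cong (punchIn (g zero)) (e m)) (Finₚ.punchIn-punchOut (g₀≢ m)) }
  where
  g₀≢ : ∀ m → ¬ g zero ≡ g (suc m)
  g₀≢ m e with () ← inj e
  g′ : Fin j → Fin n
  g′ m = punchOut (g₀≢ m)

sucPsuc : ∀ n j → suc n ℕ.* (n P j) ≡ suc n P suc j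
sucPsuc n j with j ℕₚ.≤? n
... | yes j≤n = ≡.trans (≡.cong (suc n ℕ.*_) (P≡P′ j≤n))
  (≡.sym (≡.trans (P≡P′ (ℕ.s≤s j≤n)) (nP′k≡n[n∸1P′k∸1] (suc n) (suc j))))
... | no j≰n = ≡.trans (≡.cong (suc n ℕ.*_) (k>n⇒nPk≡0 (ℕₚ.≰⇒> j≰n)))
  (≡.trans (ℕₚ.*-zeroʳ (suc n)) (≡.sym (k>n⇒nPk≡0 (ℕ.s≤s (ℕₚ.≰⇒> j≰n)))))

Arr↔ : ∀ n j → Fin (n P j) ↔ Arr n j
Arr↔ n zero = mk↔ₛ′ (λ _ → tt) (λ _ → zero) (λ _ → ≡.refl) (λ { zero → ≡.refl })
Arr↔ zero (suc j) = mk↔ₛ′ (λ ()) (λ ()) (λ ()) (λ ())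
Arr↔ (suc n) (suc j) = ≡.subst (λ m → Fin m ↔ Arr (suc n) (suc j)) (sucPsuc n j)
  ((↔-id _ ×-↔ Arr↔ n j) ↔-∘ Finₚ.*↔×)

-- Fields of cluster towers

module Towers (em : ∀ {ℓ} → ExcludedMiddle ℓ) {c ℓ₁ ℓ₂ c′ ℓ₁′ ℓ₂′}
    (K : HeytingField c ℓ₁ ℓ₂) (K̄ : AlgebraicClosure K c′ ℓ₁′ ℓ₂′)
    (f : Polynomial.Poly (fieldRawRing K)) (n-1 : ℕ)
    (separable : Polynomial.Separable (fieldRawRing K) f)
    (degree : Polynomial.HasDegree (fieldRawRing K) f (suc n-1))
    (2<n : 2 ℕ.< suc n-1) where
  open AlgebraicClosure K̄
  open RingPolynomials (fieldRing closure)
  open Extensions K̄ hiding (base; gen; add; mul; neg; inv; resp)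
  open ClosureProperties em K K̄
  open Roots K̄ f
  open SeparablePolynomial em K K̄ f n-1 separable degree
  open Degrees em K K̄
  open GrowthSequences K̄

  first-span : ∀ {β j d} → Dependent (First β j) (β j) d → First β (suc j) ⊆ Span (First β j) (β j) d
  first-span {β} {j} {zero} dep = contradiction dep (¬Dependent0 {L = First β j} {β j})
  first-span {β} {j} {suc d} (μ , μ∈ , e) = First-least record
    { isSubring = Span-isSubring (isSubring Fβ) μ∈ e
    ; const = λ a → Span-const (isSubring Fβ) μ∈ e (const Fβ a) }
    (λ i<1+j → <suc-cases i<1+j (λ i<j → Span-const (isSubring Fβ) μ∈ e (First-gen i<j))
      λ { ≡.refl → Span-gen (isSubring Fβ) μ∈ e })
    where Fβ = First-field β j

  first-degree-step : ∀ {β j d D} → HasDegreeOverBase (First β j) D →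
    Dependent (First β j) (β j) d → Independent (First β j) (β j) d → HasDegreeOverBase (First β (suc j)) (d ℕ.* D)
  first-degree-step {β} {j} h dep ind = degree-tower (First-field β j) (First-field β (suc j)) h ind
    (First-mono (ℕₚ.n≤1+n j)) (First-gen ℕₚ.≤-refl) (first-span dep)

  first-degree-zero : ∀ β → HasDegreeOverBase (First β 0) 1
  first-degree-zero β = degree-base (First-field β 0) (First-least {β} {0} constants (λ ()))

  generic-degree : ∀ {k} → Generic k → k ℕ.≤ n → ∀ {β j} → Distinct IsRoot β j → j ℕ.≤ k →
    HasDegreeOverBase (First β j) (n P j)
  generic-degree generic k≤n {β} {zero} dβ _ = first-degree-zero β
  generic-degree generic k≤n {β} {suc j} dβ j<k =
    ≡.subst (HasDegreeOverBase (First β (suc j))) (≡.sym (P-suc (ℕₚ.<-≤-trans j<k k≤n)))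
      (first-degree-step (generic-degree generic k≤n (prefix dβ (ℕₚ.n≤1+n j)) (ℕₚ.<⇒≤ j<k))
        (dependent-on-first β j dβ (ℕₚ.<⇒≤ (ℕₚ.<-≤-trans j<k k≤n))) (generic β j dβ j<k))

  generic⇒∉ : ∀ {k} → Generic k → k ℕ.< n → ∀ {β j} → Distinct IsRoot β (suc j) → j ℕ.< k → ¬ First β j (β j)
  generic⇒∉ generic k<n {β} {j} dβ j<k = independent⇒∉ (First-field β j) (1<∸ j<k k<n) (generic β j dβ j<k)

  generic⇒strict : ∀ {k} → Generic k → k ℕ.< n → ∀ {β j} → Distinct IsRoot β (suc j) → j ℕ.< k →
    First β j ⊂ First β (suc j)
  generic⇒strict generic k<n dβ j<k = First-mono (ℕₚ.n≤1+n _) ,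
    λ ⊇ → generic⇒∉ generic k<n dβ j<k (⊇ (First-gen ℕₚ.≤-refl))

  ClusterDistinct : (ℕ → Carrier) → ℕ → Set _
  ClusterDistinct β j = ∀ {i i′} → i ℕ.< i′ → i′ ℕ.< j → ¬ Adjoin (β i ≈_) ≐ Adjoin (β i′ ≈_)

  -- Roots of one cluster generate the same field, so the second would lie in the field of the
  -- first. But it has degree n - 1 there, which is at least 2 because n > 2. Genericity at index 1
  -- is available since i < i′ < j forces j ≥ 2.
  generic⇒cluster-distinct : ∀ {j} → Generic j → ∀ {β} → Distinct IsRoot β j → ClusterDistinct β j
  generic⇒cluster-distinct {j} generic {β} dβ {i} {i′} i<i′ i′<j (_ , ⊇) =
    independent⇒∉ (First-field γ 1) (1<∸ (ℕₚ.≤-refl {2}) 2<n) (generic γ 1 dγ 1<j)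
      (Adjoin-⊆ {B = β i ≈_} (λ e → Adjoin.gen (0 , ℕ.s≤s ℕ.z≤n , e)) (⊇ (Adjoin.gen refl)))
    where
    1<j : 1 ℕ.< j
    1<j = ℕₚ.≤-trans (ℕ.s≤s (ℕₚ.≤-trans (ℕ.s≤s ℕ.z≤n) i<i′)) i′<j
    γ = cons (β i) (λ _ → β i′)
    dγ : Distinct IsRoot γ 2
    dγ = Distinct-cons (holds dβ (ℕₚ.<-trans i<i′ i′<j))
      (record { holds = λ _ → holds dβ i′<j ; differ< = λ p q → contradiction p (ℕₚ.≤⇒≯ (ℕₚ.≤-trans (ℕₚ.≤-pred q) ℕ.z≤n)) })
      (λ _ → differ< dβ i<i′ i′<j)

  asRoots : ∀ {β j} → Distinct IsRoot β j → ℕ → Root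
  asRoots {β} {j} dβ i with i ℕₚ.<? j
  ... | yes i<j = β i , holds dβ i<j
  ... | no _    = root 0 , holds root-distinct (ℕ.s≤s ℕ.z≤n)

  asRoots-< : ∀ {β j} (dβ : Distinct IsRoot β j) {i} → i ℕ.< j → proj₁ (asRoots dβ i) ≡ β i
  asRoots-< {β} {j} dβ {i} i<j with i ℕₚ.<? j
  ... | yes _  = ≡.refl
  ... | no i≮j = contradiction i<j i≮j

  same-cluster : ∀ {x y} → x ≈ y → Adjoin (x ≈_) ≐ Adjoin (y ≈_)
  same-cluster x≈y = Adjoin-⊆ (λ e → Adjoin.gen (trans (sym x≈y) e)) , Adjoin-⊆ (λ e → Adjoin.gen (trans x≈y e))

  module _ (T : ClusterTower) where
    open ClusterTower T
    private module ord = Bijection ordering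

    -- The filler beyond s is a root, and the field of step s contains all roots. Hence `step≐First`
    -- holds for every j, even past the end of the tower.
    sequenceᵀ : ℕ → Carrier
    sequenceᵀ = padding (root 0) rep

    sequenceᵀ-< : ∀ {i} (i<s : i ℕ.< s) → sequenceᵀ i ≡ rep (fromℕ< i<s)
    sequenceᵀ-< = padding-< (root 0) rep

    sequenceᵀ-fin : ∀ i → sequenceᵀ (toℕ i) ≡ rep i
    sequenceᵀ-fin i = ≡.trans (sequenceᵀ-< (Finₚ.toℕ<n i)) (≡.cong rep (Finₚ.fromℕ<-toℕ i _))

    -- A root lies in the field generated by the representative of its cluster.
    step-complete : ∀ {j} → s ℕ.≤ j → ∀ {x} → IsRoot x → step j x
    step-complete s≤j {x} x-root =
      let i , eq = ord.surjective (x , x-root) in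
      Adjoin-⊆ (λ e → Adjoin.gen (i , ℕₚ.<-≤-trans (Finₚ.toℕ<n i) s≤j , e)) (proj₂ (eq ≡.refl) (Adjoin.gen refl))

    step≐First : ∀ j → step j ≐ First sequenceᵀ j
    step≐First j =
      Adjoin-⊆ (λ { (i , i<j , e) → Adjoin.resp (trans (reflexive (sequenceᵀ-fin i)) e) (First-gen i<j) }) ,
      First-least (Adjoin-intermediate _) (λ {i} i<j → member i<j (i ℕₚ.<? s))
      where
      member : ∀ {i} → i ℕ.< j → Dec (i ℕ.< s) → step j (sequenceᵀ i)
      member i<j (yes i<s) = Adjoin.gen (fromℕ< i<s , ≡.subst (ℕ._< j) (≡.sym (Finₚ.toℕ-fromℕ< i<s)) i<j ,
        reflexive (≡.sym (sequenceᵀ-< i<s)))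
      member {i} i<j (no i≮s) with i ℕₚ.<? s
      ... | yes i<s = contradiction i<s i≮s
      ... | no _    = step-complete (ℕₚ.<⇒≤ (ℕₚ.≤-<-trans (ℕₚ.≮⇒≥ i≮s) i<j)) (holds root-distinct (ℕ.s≤s ℕ.z≤n))

    sequenceᵀ-distinct : Distinct IsRoot sequenceᵀ s
    sequenceᵀ-distinct = record
      { holds = λ i<s → ≡.subst IsRoot (≡.sym (sequenceᵀ-< i<s)) (proj₂ (ord.to (fromℕ< i<s)))
      ; differ< = λ {i} {i′} i<i′ i′<s e →
          let i<s = ℕₚ.<-trans i<i′ i′<s
              eq = ord.injective (same-cluster (trans (reflexive (≡.sym (sequenceᵀ-< i<s))) (trans e (reflexive (sequenceᵀ-< i′<s)))))
          in ℕₚ.<⇒≢ i<i′ (Finₚ.fromℕ<-injective i i′ i<s i′<s eq) }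

  extend-to-tower : ∀ {β j} → Distinct IsRoot β j → ClusterDistinct β j →
    ∃[ T ] j ℕ.≤ ClusterTower.s T × (∀ {i} → i ℕ.< j → sequenceᵀ T i ≡ β i)
  extend-to-tower {β} {j} dβ clusters-differ = T , E.j≤size , λ {i} i<j →
    let i<s = ℕₚ.<-≤-trans i<j E.j≤size in
    ≡.trans (sequenceᵀ-< T i<s) (≡.trans (≡.cong (proj₁ ∘ E.sequence) (Finₚ.toℕ-fromℕ< i<s))
      (≡.trans (≡.cong proj₁ (E.agrees i<j)) (asRoots-< dβ i<j)))
    where
    open GreedyEnumeration em clusters
    E : Extension (asRoots dβ) j (asRoots root-distinct) n
    E = extend-sequence (asRoots root-distinct) n λ i<i′ i′<j →
      ≡.subst₂ (λ x y → ¬ Adjoin (x ≈_) ≐ Adjoin (y ≈_))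
        (≡.sym (asRoots-< dβ (ℕₚ.<-trans i<i′ i′<j))) (≡.sym (asRoots-< dβ i′<j)) (clusters-differ i<i′ i′<j)
    module E = Extension E
    T : ClusterTower
    T = record
      { s = E.size
      ; ordering = E.bijection λ (x , x-root) →
          let i , i<n , e = root-cover x-root in
          i , i<n , same-cluster (trans (reflexive (asRoots-< root-distinct i<n)) e) }

  -- Mapping x to y gives an isomorphism of L(x) and L(y) over L, and a relation for y is carried
  -- back to the same relation for x.
  conjugate-independent : ∀ {L : Pred Carrier Λ} → IsIntermediate L → ∀ {d} {a : Fin d → Carrier} {x y} →
    (∀ i → L (a i)) → evalF a 1# x ≈ 0# → evalF a 1# y ≈ 0# → Independent L x d → Independent L y d
  conjugate-independent {L} isL {d} {a} {x} {y} a∈ ex ey ind b b∈ eb = ind b b∈ (S.vanish⁻¹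
      (S.resp (reflexive (Product.evalF-proj₁ b² (0# , 0#) (x , y)) , reflexive (Product.evalF-proj₂ b² (0# , 0#) (x , y)))
        (P.evalF-∈ S.subring {c = b²} {0# , 0#} {x , y} (λ i → Δ⊆S (b∈ i , refl)) S.0∈ xy∈S)) eb)
    where
    b² : Fin d → Carrier × Carrier
    b² i = b i , b i
    extension = IsPartialIso.extend-by (Diagonal-iso isL) {μ = λ i → a i , a i} {x} {y}
      (λ i → a∈ i , refl) ex ey (Independent-⊆ {L = L} {x = x} (Diagonal-dom isL) ind)
    module S = IsPartialIso (proj₁ extension)
    Δ⊆S = proj₁ (proj₂ extension)
    xy∈S = proj₂ (proj₂ extension)

  -- Condition (2) and genericity

  module _ {k} (k<n : k ℕ.< n) where
    private
      k≤n = ℕₚ.<⇒≤ k<n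
      fall : ℕ → ℕ
      fall i = n P suc i

      -- Genericity up to j has two uses here: it puts the roots β₀, ..., β_{j-1} into different
      -- clusters, so that they start a tower, and it makes the first j inclusions strict, so that
      -- the growths can be located.
      growing-tower : ∀ {j} → Generic j → j ℕ.≤ k → (∀ T → HasDegreeSequence T (applyUpTo fall k)) →
        ∀ {β} → Distinct IsRoot β j → Σ[ T ∈ ClusterTower ] let F = ClusterTower.step T in
          j ℕ.≤ ClusterTower.s T × (∀ {i} → i ℕ.< j → sequenceᵀ T i ≡ β i) ×
          (∀ {i} → i ℕ.< j → F i ⊂ F (suc i)) × Growth F fall (ClusterTower.s T) k
      growing-tower {j} generic j≤k H {β} dβ =
        let T , j≤s , agree = extend-to-tower dβ (generic⇒cluster-distinct generic dβ) in
        T , j≤s , agree ,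
        (λ {i} i<j → ⊂-resp-≐ (≐-sym (step≐First T i)) (≐-sym (step≐First T (suc i)))
          (generic⇒strict generic (ℕₚ.≤-<-trans j≤k k<n) (prefix (sequenceᵀ-distinct T) (ℕₚ.≤-trans i<j j≤s)) i<j)) ,
        toGrowth _ fall (H T) k ≡.refl

      generic-step : ∀ {j} → Generic j → j ℕ.< k → (∀ T → HasDegreeSequence T (applyUpTo fall k)) →
        ∀ β → Distinct IsRoot β (suc j) → Independent (First β j) (β j) (n ∸ j)
      generic-step {j} generic j<k H β dβ =
        -- The polynomial f / ∏ (X - βᵢ) of degree n - j vanishes at x and at βⱼ. As x has degree n
        -- - j, it is minimal for x, and βⱼ is a conjugate.
        conjugate-independent (First-field β j) a∈ x-zero (zeros (holds dβ ℕₚ.≤-refl) (λ i<j → differ< dβ i<j ℕₚ.≤-refl ∘ sym))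
          (≡.subst (Independent (First β j) x) d≡n∸j (Independent-⊆ {L = First ρ t} {x = x} (proj₁ same-field) ind))
        where
        j≤n = ℕₚ.<⇒≤ (ℕₚ.<-trans j<k k<n)
        dβ↾ = prefix dβ (ℕₚ.n≤1+n j)
        tower = growing-tower generic (ℕₚ.<⇒≤ j<k) H dβ↾
        T = proj₁ tower
        ρ = sequenceᵀ T
        agree = proj₁ (proj₂ (proj₂ tower))
        strict = proj₁ (proj₂ (proj₂ (proj₂ tower)))
        next = next-growth (ClusterTower.step T) fall strict (proj₂ (proj₂ (proj₂ (proj₂ tower)))) j<k
        t = proj₁ next
        j≤t = proj₁ (proj₂ next)
        t<s = proj₁ (proj₂ (proj₂ next))
        -- The tower is prescribed only for its first j terms and may stay in the same field
        -- afterwards, so the root that enlarges the field next can differ from βⱼ.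
        x = ρ t
        x-root = holds (sequenceᵀ-distinct T) t<s
        same-field : First β j ≐ First ρ t
        same-field = ≐-trans
          (First-cong (λ i<j → reflexive (≡.sym (agree i<j))) , First-cong (λ i<j → reflexive (agree i<j)))
          (≐-trans (≐-sym (step≐First T j)) (≐-trans (proj₁ (proj₂ (proj₂ (proj₂ next)))) (step≐First T t)))
        minimal = minimal-polynomial (First-field ρ t) x
        ind = proj₂ (proj₂ minimal)
        degree-eq : proj₁ minimal ℕ.* (n P j) ≡ n P suc j
        degree-eq = degree-unique (≐-sym (step≐First T (suc t)))
          (first-degree-step (degree-resp same-field (generic-degree generic j≤n dβ↾ ℕₚ.≤-refl)) (proj₁ (proj₂ minimal)) ind)
          (proj₂ (proj₂ (proj₂ (proj₂ next))))
        d≡n∸j : proj₁ minimal ≡ n ∸ j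
        d≡n∸j = ℕₚ.*-cancelʳ-≡ _ _ (n P j) ⦃ P-nonzero j j≤n ⦄
          (≡.trans degree-eq (P-suc (ℕₚ.<-trans j<k k<n)))
        deflated = F-deflate (First-field β j) {β} {j} {n ∸ j} (ℕₚ.m+[n∸m]≡n j≤n) dβ↾ First-gen
        a∈ = proj₁ (proj₂ deflated)
        zeros : ∀ {z} → IsRoot z → (∀ {i} → i ℕ.< j → ¬ z ≈ β i) → evalF (proj₁ deflated) 1# z ≈ 0#
        zeros = proj₂ (proj₂ deflated)
        x-zero : evalF (proj₁ deflated) 1# x ≈ 0#
        x-zero = zeros x-root λ i<j e → differ< (sequenceᵀ-distinct T) (ℕₚ.<-≤-trans i<j j≤t) t<s
          (trans (reflexive (agree i<j)) (sym e))

    module _ (H : ∀ T → HasDegreeSequence T (applyUpTo fall k)) where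
      private
        generic-upto : ∀ j → j ℕ.≤ k → Generic j
        generic-upto zero    _   β i dβ ()
        generic-upto (suc j) j<k β i dβ i<1+j = <suc-cases i<1+j (generic-upto j (ℕₚ.<⇒≤ j<k) β i dβ)
          λ { ≡.refl → generic-step (generic-upto j (ℕₚ.<⇒≤ j<k)) j<k H β dβ }

      falling⇒generic : Generic k
      falling⇒generic = generic-upto k ℕₚ.≤-refl

      -- By genericity the k growths are the first k steps; after them the tower is constant, and it
      -- ends in K_f.
      falling⇒generates : Generates k
      falling⇒generates β dβ {x} x-root =
        let T , k≤s , agree , strict , growth = growing-tower falling⇒generic ℕₚ.≤-refl H dβ
            x∈ = proj₂ (constant-after _ fall strict growth k≤s ℕₚ.≤-refl) (step-complete T ℕₚ.≤-refl x-root)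
        in First-cong (λ i<k → reflexive (agree i<k)) (proj₁ (step≐First T k) x∈)

    module _ (generic : Generic k) (generates : Generates k) where
      -- A tower with s < k terms would reach K_f, so one more root would lie in the field of s
      -- others, contrary to genericity.
      tower-size : ∀ T → k ℕ.≤ ClusterTower.s T
      tower-size T = ℕₚ.≮⇒≥ λ s<k →
        let s = ClusterTower.s T
            x , x-root , fresh = fresh-root (sequenceᵀ T) s (ℕₚ.<-trans s<k k<n)
            γ = snoc (sequenceᵀ T) s x
            x∈ : First (sequenceᵀ T) s x
            x∈ = proj₁ (step≐First T s) (step-complete T ℕₚ.≤-refl x-root)
        in generic⇒∉ generic k<n (Distinct-snoc (sequenceᵀ-distinct T) x-root fresh) s<k
             (Adjoin.resp (reflexive (≡.sym (snoc-last (sequenceᵀ T) s x)))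
               (First-cong (λ i<s → reflexive (≡.sym (snoc-init (sequenceᵀ T) s x i<s))) x∈))

      tower-prefix : ∀ T → Distinct IsRoot (sequenceᵀ T) k
      tower-prefix T = prefix (sequenceᵀ-distinct T) (tower-size T)

      tower-strict : ∀ T {i} → i ℕ.< k → ClusterTower.step T i ⊂ ClusterTower.step T (suc i)
      tower-strict T {i} i<k = ⊂-resp-≐ (≐-sym (step≐First T i)) (≐-sym (step≐First T (suc i)))
        (generic⇒strict generic k<n (prefix (tower-prefix T) i<k) i<k)

      tower-full : ∀ T {i} → k ℕ.≤ i → ClusterTower.step T i ≐ SplittingField
      tower-full T {i} k≤i = Adjoin-⊆ (λ { (i , _ , e) → Adjoin.gen (root-resp e (proj₂ (Bijection.to (ClusterTower.ordering T) i))) }) ,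
        Adjoin-least (Adjoin-intermediate _) (λ r →
          proj₂ (step≐First T i) (First-mono k≤i (generates (sequenceᵀ T) (tower-prefix T) r)))

      private
        growth-initial : ∀ T j → j ℕ.≤ k → Growth (ClusterTower.step T) fall j j
        growth-initial T zero    _   = done
        growth-initial T (suc j) j<k = grow (growth-initial T j (ℕₚ.<⇒≤ j<k)) (tower-strict T j<k)
          (degree-resp (≐-sym (step≐First T (suc j))) (generic-degree generic k≤n (prefix (tower-prefix T) j<k) j<k))

        growth-final : ∀ T i → Growth (ClusterTower.step T) fall (i ℕ.+ k) k
        growth-final T zero    = growth-initial T k ℕₚ.≤-refl
        growth-final T (suc i) = stay (growth-final T i)
          (≐-trans (tower-full T (ℕₚ.m≤n+m k i)) (≐-sym (tower-full T (ℕₚ.m≤n+m k (suc i)))))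

      generic⇒falling : ClusterTowersAreFalling n k
      generic⇒falling T = record
        { to = λ i → inject≤ i k≤s , ≡.subst (λ i → step i ⊂ step (suc i)) (≡.sym (Finₚ.toℕ-inject≤ i k≤s)) (tower-strict T (Finₚ.toℕ<n i))
        ; cong = λ { ≡.refl → ≡.refl }
        ; bijective = (λ {i} {i′} → Finₚ.inject≤-injective k≤s k≤s i i′) , λ (i , strict) →
            let i<k : toℕ i ℕ.< k
                i<k = ℕₚ.≰⇒> λ k≤i → proj₂ strict (proj₂ (≐-trans (tower-full T k≤i) (≐-sym (tower-full T (ℕₚ.m≤n⇒m≤1+n k≤i)))))
            in fromℕ< i<k , λ { ≡.refl → Finₚ.toℕ-injective (≡.trans (Finₚ.toℕ-inject≤ (fromℕ< i<k) k≤s) (Finₚ.toℕ-fromℕ< i<k)) }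
        } , fromGrowth step fall (≡.subst (λ s → Growth step fall s k) (ℕₚ.m∸n+n≡m k≤s) (growth-final T (s ∸ k)))
        where
        open ClusterTower T using (s; step)
        k≤s = tower-size T

  -- Minimal generating sets

  root-fin : Fin n → Carrier
  root-fin i = root (toℕ i)

  root-fin-injective : ∀ {i j} → root-fin i ≈ root-fin j → i ≡ j
  root-fin-injective {i} {j} e = Finₚ.toℕ-injective (Distinct.injective root-distinct (Finₚ.toℕ<n i) (Finₚ.toℕ<n j) e)

  root-fin-cover : ∀ {x} → IsRoot x → ∃[ i ] root-fin i ≈ x
  root-fin-cover r = let i , i<n , e = root-cover r in
    fromℕ< i<n , trans (reflexive (≡.cong root (Finₚ.toℕ-fromℕ< i<n))) e

  root-fin-root : ∀ i → IsRoot (root-fin i)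
  root-fin-root i = holds root-distinct (Finₚ.toℕ<n i)

  module _ {m} (g : Fin m → Carrier) (g-injective : ∀ {i j} → g i ≈ g j → i ≡ j)
           {p} {Q : Pred Carrier p} (Q∋ : ∀ i → Q (g i)) where
    padded : ℕ → Carrier
    padded = padding (root 0) g

    padded-distinct : Distinct Q padded m
    padded-distinct = record
      { holds = λ i<m → ≡.subst Q (≡.sym (padding-< (root 0) g i<m)) (Q∋ (fromℕ< i<m))
      ; differ< = λ {i} {i′} i<i′ i′<m e → ℕₚ.<⇒≢ i<i′ (Finₚ.fromℕ<-injective i i′ (ℕₚ.<-trans i<i′ i′<m) i′<m
          (g-injective (trans (reflexive (≡.sym (padding-< (root 0) g (ℕₚ.<-trans i<i′ i′<m))))
            (trans e (reflexive (padding-< (root 0) g i′<m)))))) }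

  combSubset : ∀ {k} → Comb n k → RootSubset
  combSubset I = record
    { Mem      = λ x → ∃[ m ] root-fin (elem I m) ≈ x
    ; respects = λ x≈y (m , e) → m , trans e x≈y
    ; isRoot   = λ (m , e) → root-resp e (root-fin-root (elem I m)) }

  combSubset-card : ∀ {k} (I : Comb n k) → HasCardinality (elements (combSubset I)) k
  combSubset-card I = record
    { to = λ m → root-fin (elem I m) , m , refl
    ; cong = λ { ≡.refl → refl }
    ; bijective = (λ e → elem-injective I (root-fin-injective e)) , λ (x , m , e) → m , λ { ≡.refl → e } }

  finite-subset : ∀ B → ∃[ k ] Σ[ I ∈ Comb n k ] Mem (combSubset I) ≐ Mem B
  finite-subset B =
    let k , I , complete , sound = comb-of em (λ i → Mem B (root-fin i)) in
    k , I , (λ (m , e) → respects B e (sound m)) , λ x∈ →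
      let i , e = root-fin-cover (isRoot B x∈)
          m , e′ = complete i (respects B (sym e) x∈)
      in m , trans (reflexive (≡.cong root-fin e′)) e

  elements-resp : ∀ B B′ {k} → Mem B ≐ Mem B′ → HasCardinality (elements B) k → HasCardinality (elements B′) k
  elements-resp B B′ (B⊆B′ , B′⊆B) b = record
    { to = λ i → let x , x∈ = to i in x , B⊆B′ x∈
    ; cong = λ { ≡.refl → refl }
    ; bijective = injective , λ (x , x∈) → surjective (x , B′⊆B x∈) }
    where open Bijection b

  module _ (B : RootSubset) {k} (b : HasCardinality (elements B) k) where
    open Bijection b

    enumeration : ℕ → Carrier
    enumeration = padding (root 0) (proj₁ ∘ to)

    enumeration-distinct : Distinct (Mem B) enumeration k
    enumeration-distinct = padded-distinct (proj₁ ∘ to) injective (proj₂ ∘ to)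

    enumeration-field : Adjoin (Mem B) ≐ First enumeration k
    enumeration-field =
      Adjoin-⊆ (λ {x} x∈ → let i , eq = surjective (x , x∈) in
        Adjoin.gen (toℕ i , Finₚ.toℕ<n i , trans (reflexive (padding-< (root 0) (proj₁ ∘ to) (Finₚ.toℕ<n i)))
          (eq (Finₚ.fromℕ<-toℕ i _)))) ,
      First-least (Adjoin-intermediate (Mem B)) (Adjoin.gen ∘ holds enumeration-distinct)

  distinct-≤ : ∀ B {k m β} → HasCardinality (elements B) k → Distinct (Mem B) β m → m ℕ.≤ k
  distinct-≤ B {β = β} b dβ = card-≤ {S = elements B} (λ i → β (toℕ i) , holds dβ (Finₚ.toℕ<n i))
    (λ {i} {j} e → Finₚ.toℕ-injective (Distinct.injective dβ (Finₚ.toℕ<n i) (Finₚ.toℕ<n j) e)) b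

  -- By condition (1) the sets to be counted are the k-subsets of the roots, and numbering the roots
  -- turns these into the k-subsets of `Fin n`.
  minimal-sets-count : ∀ {k} → MinimalGeneratingSetsAreKSubsets k → HasCardinality minimalGeneratingSets (n C k)
  minimal-sets-count {k} (min⇒k , k⇒min) = record
    { to = λ i → let I = Inverse.to (Comb↔ n k) i in combSubset I , k⇒min (combSubset I) (combSubset-card I)
    ; cong = λ { ≡.refl → ≐-refl }
    ; bijective = (λ {i} {j} e → inj e) , surj }
    where
    open Inverse (Comb↔ n k)
    same : ∀ {k} (I I′ : Comb n k) → Mem (combSubset I) ⊆ Mem (combSubset I′) → ∀ i → InComb I i → InComb I′ i
    same I I′ I⊆I′ i (m , e) = let m′ , e′ = I⊆I′ (m , reflexive (≡.cong root-fin e)) in m′ , root-fin-injective e′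
    inj : ∀ {i j} → Mem (combSubset (to i)) ≐ Mem (combSubset (to j)) → i ≡ j
    inj {i} {j} (p , q) = ≡.trans (≡.sym (strictlyInverseʳ i)) (≡.trans
      (≡.cong from (Comb-ext (to i) (to j) (same (to i) (to j) p) (same (to j) (to i) q))) (strictlyInverseʳ j))
    surj : ∀ (B : Σ[ B ∈ RootSubset ] IsMinimalGenerating B) →
      ∃[ i ] (∀ {j} → j ≡ i → Mem (combSubset (to j)) ≐ Mem (proj₁ B))
    surj (B , min) with k′ , I , I≐B ← finite-subset B
      with ≡.refl ← card-unique {S = elements B} (min⇒k B min) (elements-resp (combSubset I) B I≐B (combSubset-card I))
      = from I , λ { ≡.refl → ≡.subst (λ I → Mem (combSubset I) ≐ Mem B) (≡.sym (strictlyInverseˡ I)) I≐B }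

  module _ {k} (k<n : k ℕ.< n) (generic : Generic k) (generates : Generates k) where
    private
      first-full : ∀ {β} → Distinct IsRoot β k → First β k ≐ SplittingField
      first-full dβ = First⊆SF dβ , Adjoin-least (First-field _ k) (generates _ dβ)

    -- Any k roots generate. If a subset A generated K_f and missed x in B, then A would have fewer
    -- than k elements and x would lie in K(A), contrary to genericity.
    k-subset⇒minimal : ∀ B → HasCardinality (elements B) k → IsMinimalGenerating B
    k-subset⇒minimal B b = record
      { generates = ≐-trans (enumeration-field B b) (first-full (Distinct-map (isRoot B) (enumeration-distinct B b)))
      ; minimal = λ A (A⊆B , B⊈A) A-full → B⊈A λ {x} x∈B → by-contradiction λ x∉A →
          let m , I , I≐A = finite-subset A
              a = elements-resp (combSubset I) A I≐A (combSubset-card I)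
              dγ : Distinct (Mem B) (snoc (enumeration A a) m x) (suc m)
              dγ = Distinct-snoc (Distinct-map A⊆B (enumeration-distinct A a)) x∈B
                     (λ i<m e → x∉A (respects A e (holds (enumeration-distinct A a) i<m)))
          in generic⇒∉ generic k<n (Distinct-map (isRoot B) dγ) (distinct-≤ B b dγ)
               (Adjoin.resp (reflexive (≡.sym (snoc-last (enumeration A a) m x)))
                 (First-cong (λ i<m → reflexive (≡.sym (snoc-init (enumeration A a) m x i<m)))
                   (proj₁ (enumeration-field A a) (proj₂ A-full (Adjoin.gen (isRoot B x∈B)))))) }
      where
      by-contradiction : ∀ {a} {A : Set a} → ¬ ¬ A → A
      by-contradiction {A = A} ¬¬p with em {P = A}
      ... | yes p = p
      ... | no ¬p = contradiction ¬p ¬¬p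

    -- With fewer than k elements some other root stays outside the generated field; with more than
    -- k, the first k of them generate already and form a proper subset.
    minimal⇒k-subset : ∀ B → IsMinimalGenerating B → HasCardinality (elements B) k
    minimal⇒k-subset B min =
      let m , I , I≐B = finite-subset B
          b = elements-resp (combSubset I) B I≐B (combSubset-card I)
      in ≡.subst (HasCardinality (elements B)) (ℕₚ.≤-antisym (ℕₚ.≮⇒≥ (too-large b)) (ℕₚ.≮⇒≥ (too-small b))) b
      where
      open IsMinimalGenerating min renaming (generates to B-full)
      too-small : ∀ {m} → HasCardinality (elements B) m → ¬ m ℕ.< k
      too-small {m} b m<k =
        let β = enumeration B b
            x , x-root , fresh = fresh-root β m (ℕₚ.<-trans m<k k<n)
        in generic⇒∉ generic k<n (Distinct-snoc (Distinct-map (isRoot B) (enumeration-distinct B b)) x-root fresh) m<k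
             (Adjoin.resp (reflexive (≡.sym (snoc-last β m x)))
               (First-cong (λ i<m → reflexive (≡.sym (snoc-init β m x i<m)))
                 (proj₁ (enumeration-field B b) (proj₂ B-full (Adjoin.gen x-root)))))
      too-large : ∀ {m} → HasCardinality (elements B) m → ¬ k ℕ.< m
      too-large {m} b k<m = minimal A
        ( (λ (i , e) → respects B e (holds dβ (ℕₚ.<-trans (Finₚ.toℕ<n i) k<m)))
        , λ B⊆A → let i , e = B⊆A (holds dβ k<m) in differ< dβ (Finₚ.toℕ<n i) k<m e )
        ( Adjoin-⊆ (λ {x} x∈ → Adjoin.gen (isRoot A x∈))
        , λ p → First-least (Adjoin-intermediate (Mem A))
            (λ i<k → Adjoin.gen (fromℕ< i<k , reflexive (≡.cong β (Finₚ.toℕ-fromℕ< i<k))))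
            (proj₂ (first-full (prefix (Distinct-map (isRoot B) dβ) (ℕₚ.<⇒≤ k<m))) p) )
        where
        β = enumeration B b
        dβ = enumeration-distinct B b
        A : RootSubset
        A = record
          { Mem = λ x → Σ[ i ∈ Fin k ] β (toℕ i) ≈ x
          ; respects = λ x≈y (i , e) → i , trans e x≈y
          ; isRoot = λ (i , e) → root-resp e (isRoot B (holds dβ (ℕₚ.<-trans (Finₚ.toℕ<n i) k<m))) }

    generic⇒minimal-sets : MinimalGeneratingSetsAreKSubsets k
    generic⇒minimal-sets = minimal⇒k-subset , k-subset⇒minimal

  -- By genericity the roots in K(β₀, …, βᵢ) are β₀, …, βᵢ, so the fields determine the sequence.
  fields-determine-sequence : ∀ {k} → k ℕ.< n → Generic k → ∀ {β γ j} → j ℕ.< k →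
    Distinct IsRoot β j → Distinct IsRoot γ j → (∀ i → i ℕ.≤ j → First γ i ⊆ First β i) →
    ∀ {i} → i ℕ.< j → β i ≈ γ i
  fields-determine-sequence {k} k<n generic {β} {γ} {suc j} j<k dβ dγ ⊇ {i} i<1+j =
    <suc-cases i<1+j before λ { ≡.refl → last em }
    where
    before : ∀ {i} → i ℕ.< j → β i ≈ γ i
    before = fields-determine-sequence k<n generic {β} {γ} {j} (ℕₚ.<-trans (ℕₚ.n<1+n j) j<k) (prefix dβ (ℕₚ.n≤1+n j))
      (prefix dγ (ℕₚ.n≤1+n j)) (λ i i≤j → ⊇ i (ℕₚ.m≤n⇒m≤1+n i≤j))
    -- If γⱼ is an earlier βᵢ, it equals γᵢ as well, against distinctness. If it is none of β₀, ...,
    -- βⱼ, it has degree at least 2 over their field, although it lies in it.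
    last : Dec (∃[ i ] i ℕ.< suc j × β i ≈ γ j) → β j ≈ γ j
    last (yes (i , i<1+j , e)) = <suc-cases i<1+j
      (λ i<j → contradiction (trans (sym (before i<j)) e) (differ< dγ i<j ℕₚ.≤-refl))
      λ { ≡.refl → e }
    last (no new) = contradiction
      (Adjoin.resp (reflexive (≡.sym (snoc-last β (suc j) (γ j))))
        (First-cong (λ i<1+j → reflexive (≡.sym (snoc-init β (suc j) (γ j) i<1+j)))
          (⊇ (suc j) ℕₚ.≤-refl (First-gen ℕₚ.≤-refl))))
      (generic⇒∉ generic k<n (Distinct-snoc dβ (holds dγ ℕₚ.≤-refl) (λ i<1+j e → new (_ , i<1+j , e))) j<k)

  -- The number of cluster towers

  module _ {k} (k+1<n : suc k ℕ.< n) (generic : Generic (suc k)) (generates : Generates (suc k)) where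
    private
      generic↾ : Generic k
      generic↾ β j dβ j<k = generic β j dβ (ℕₚ.m<n⇒m<1+n j<k)

      arrRoot : Arr n k → Fin k → Carrier
      arrRoot a = root-fin ∘ entry k a

      arrRoot-injective : ∀ a {i j} → arrRoot a i ≈ arrRoot a j → i ≡ j
      arrRoot-injective a e = entry-injective k a (root-fin-injective e)

      arrSequence : Arr n k → ℕ → Carrier
      arrSequence a = padded (arrRoot a) (arrRoot-injective a) {Q = IsRoot} (root-fin-root ∘ entry k a)

      arrSequence-distinct : ∀ a → Distinct IsRoot (arrSequence a) k
      arrSequence-distinct a = padded-distinct (arrRoot a) (arrRoot-injective a) (root-fin-root ∘ entry k a)

      arrTower : ∀ a → ∃[ T ] k ℕ.≤ ClusterTower.s T × (∀ {i} → i ℕ.< k → sequenceᵀ T i ≡ arrSequence a i)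
      arrTower a = extend-to-tower (arrSequence-distinct a) (generic⇒cluster-distinct generic↾ (arrSequence-distinct a))

      initial : ∀ a {i} (i<k : i ℕ.< k) → sequenceᵀ (proj₁ (arrTower a)) i ≡ arrRoot a (fromℕ< i<k)
      initial a i<k = ≡.trans (proj₂ (proj₂ (arrTower a)) i<k) (padding-< (root 0) (arrRoot a) i<k)

      tower-prefix↾ : ∀ T → Distinct IsRoot (sequenceᵀ T) k
      tower-prefix↾ T = prefix (tower-prefix k+1<n generic generates T) (ℕₚ.n≤1+n k)

      -- The first k roots settle the fields up to step k, and from step k + 1 on every tower is at
      -- K_f.
      tower-⊆ : ∀ T U → (∀ {i} → i ℕ.< k → sequenceᵀ T i ≈ sequenceᵀ U i) →
        ∀ j → ClusterTower.step T j ⊆ ClusterTower.step U j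
      tower-⊆ T U agree j with j ℕₚ.≤? k
      ... | yes j≤k = λ x∈ → proj₂ (step≐First U j)
        (First-cong (λ i<j → agree (ℕₚ.<-≤-trans i<j j≤k)) (proj₁ (step≐First T j) x∈))
      ... | no j≰k = λ x∈ → proj₂ (tower-full k+1<n generic generates U (ℕₚ.≰⇒> j≰k))
        (proj₁ (tower-full k+1<n generic generates T (ℕₚ.≰⇒> j≰k)) x∈)

      tower-≐ : ∀ T U → (∀ {i} → i ℕ.< k → sequenceᵀ T i ≈ sequenceᵀ U i) →
        ∀ j → ClusterTower.step T j ≐ ClusterTower.step U j
      tower-≐ T U agree j = tower-⊆ T U agree j , tower-⊆ U T (λ i<k → sym (agree i<k)) j

      tower-arr : ∀ T → ∃[ a ] (∀ {i} → i ℕ.< k → sequenceᵀ (proj₁ (arrTower a)) i ≈ sequenceᵀ T i)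
      tower-arr T =
        let a , e = arr-of k index index-injective in a , λ i<k →
          trans (reflexive (≡.trans (initial a i<k) (≡.cong root-fin (e (fromℕ< i<k)))))
            (trans (proj₂ (index-spec (fromℕ< i<k))) (reflexive (≡.cong (sequenceᵀ T) (Finₚ.toℕ-fromℕ< i<k))))
        where
        index-spec : ∀ m → ∃[ i ] root-fin i ≈ sequenceᵀ T (toℕ m)
        index-spec m = root-fin-cover (holds (tower-prefix↾ T) (Finₚ.toℕ<n m))
        index : Fin k → Fin n
        index m = proj₁ (index-spec m)
        index-injective : ∀ {m m′} → index m ≡ index m′ → m ≡ m′
        index-injective {m} {m′} e = Finₚ.toℕ-injective (Distinct.injective (tower-prefix↾ T) (Finₚ.toℕ<n m) (Finₚ.toℕ<n m′)
          (trans (sym (proj₂ (index-spec m))) (trans (reflexive (≡.cong root-fin e)) (proj₂ (index-spec m′)))))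

      tower-determines-arr : ∀ a b → (∀ j → ClusterTower.step (proj₁ (arrTower a)) j ≐ ClusterTower.step (proj₁ (arrTower b)) j) → a ≡ b
      tower-determines-arr a b e = Arr-ext k a b λ m →
        let T = proj₁ (arrTower a)
            U = proj₁ (arrTower b)
            m<k = Finₚ.toℕ<n m
            m≡ = Finₚ.fromℕ<-toℕ m m<k
        in root-fin-injective (trans (reflexive (≡.sym (≡.trans (initial a m<k) (≡.cong (arrRoot a) m≡))))
          (trans (fields-determine-sequence k+1<n generic ℕₚ.≤-refl (tower-prefix↾ T) (tower-prefix↾ U)
                   (λ i _ x∈ → proj₁ (step≐First T i) (proj₂ (e i) (proj₂ (step≐First U i) x∈))) m<k)
            (reflexive (≡.trans (initial b m<k) (≡.cong (arrRoot b) m≡)))))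

    -- In this module k is one less than the degree of transitivity. The choice of the last
    -- generating root leaves no trace in the fields, so a tower amounts to an injective sequence of
    -- k roots.
    towers-count : HasCardinality clusterTowers (n P k)
    towers-count = record
      { to = λ i → proj₁ (arrTower (to i))
      ; cong = λ { ≡.refl j → ≐-refl }
      ; bijective = (λ {i} {j} e → ≡.trans (≡.sym (strictlyInverseʳ i))
            (≡.trans (≡.cong from (tower-determines-arr (to i) (to j) e)) (strictlyInverseʳ j))) , surj }
      where
      open Inverse (Arr↔ n k)
      surj : ∀ T → ∃[ i ] (∀ {j} → j ≡ i → ∀ l → ClusterTower.step (proj₁ (arrTower (to j))) l ≐ ClusterTower.step T l)
      surj T = let a , agree = tower-arr T in from a , λ { ≡.refl →
        ≡.subst (λ a → ∀ l → ClusterTower.step (proj₁ (arrTower a)) l ≐ ClusterTower.step T l)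
          (≡.sym (strictlyInverseˡ a)) (tower-≐ (proj₁ (arrTower a)) T agree) }

theorem3p10 : (∀ {ℓ} → ExcludedMiddle ℓ) →
    ∀ {c ℓ₁ ℓ₂ c′ ℓ₁′ ℓ₂′} (K : HeytingField c ℓ₁ ℓ₂) (K̄ : AlgebraicClosure K c′ ℓ₁′ ℓ₂′) →
    Perfect K →
    (f : Polynomial.Poly (fieldRawRing K)) (n : ℕ) →
    Polynomial.Irreducible (fieldRawRing K) f →
    Polynomial.HasDegree (fieldRawRing K) f n →
    2 < n →
    (k : ℕ) → 1 ≤ k → k < n →
    let open Roots K̄ f in
    (SharplyTransitive k ⇔
    (MinimalGeneratingSetsAreKSubsets k × ClusterTowersAreFalling n k)) ×
    (MinimalGeneratingSetsAreKSubsets k →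
    HasCardinality minimalGeneratingSets (n C k)) ×
    (ClusterTowersAreFalling n k →
    HasCardinality clusterTowers (n P (k ∸ 1)))
theorem3p10 em K K̄ perfect f (suc n-1) irreducible degree 2<n (suc k-1) _ k<n =
  mk⇔
    (λ sharp → let generic = sharp⇒generic sharp (ℕₚ.<⇒≤ k<n)
                   generates = sharp⇒generates sharp
               in generic⇒minimal-sets k<n generic generates , generic⇒falling k<n generic generates)
    (λ (_ , falling) → generic⇒sharp (ℕₚ.<⇒≤ k<n) (falling⇒generic k<n (proj₂ ∘ falling))
                         (falling⇒generates k<n (proj₂ ∘ falling))) ,
  minimal-sets-count ,
  (λ falling → towers-count k<n (falling⇒generic k<n (proj₂ ∘ falling)) (falling⇒generates k<n (proj₂ ∘ falling)))
  where
  separable = perfect f irreducible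
  open SeparablePolynomial em K K̄ f n-1 separable degree
  open Towers em K K̄ f n-1 separable degree 2<n
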